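{- Let $p$ and $q$ be odd primes with $p \neq 3$ and $p^2 \equiv 1 \pmod{q}$. Let $B$ be an abelian group of odd order with $3 \nmid |B|$ and $p \nmid |B|$. (1) If $\alpha$ is an automorphism of $\mathbb{Z}_p^2 \times \mathbb{Z}_3 \times B$ of order $q$ such that its restriction to the subgroup $\mathbb{Z}_p^2$ (viewed as an element of $\mathrm{GL}(2,p)$) has order $q$ and is not diagonalisable, then $G_1 = \mathbb{Z}_q \ltimes_\alpha (\mathbb{Z}_p^2 \times \mathbb{Z}_3 \times B)$ is sequenceable. (2) If $\alpha$ is an automorphism of $\mathbb{Z}_p^2 \times \mathbb{Z}_9 \times B$ of order $q$ such that its restriction to the subgroup $\mathbb{Z}_p^2$ has order $q$ and is not diagonalisable, then $G_2 = \mathbb{Z}_q \ltimes_\alpha (\mathbb{Z}_p^2 \times \mathbb{Z}_9 \times B)$ is sequenceable.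
   Context: For an abelian group $A$ with automorphism $\alpha$ of order $q$, $\mathbb{Z}_q \ltimes_\alpha A$ is the set $\{(u,v): u\in\mathbb{Z}_q, v\in A\}$ with multiplication $(u,v)(x,y) = (u+x, \alpha^x(v)+y)$. A group $G$ of order $n$ is sequenceable if there is an arrangement $(a_1,\ldots,a_n)$ of its elements such that $a_1^{ -1}a_2, \ldots, a_{n-1}^{ -1}a_n$ are exactly the non-identity elements of $G$, each once. Since $p\nmid|B|$ and $p\ne 3$, $\mathbb{Z}_p^2$ is the Sylow $p$-subgroup and is $\alpha$-invariant; diagonalisability is over the field $\mathbb{Z}_p$. -}

module Defs where

open import Data.Nat using (ℕ; zero; suc; NonZero; _<_; _∸_) renaming (_+_ to _+ℕ_; _*_ to _*ℕ_)
open import Data.Nat.DivMod using (_mod_)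
open import Data.Fin using (Fin; toℕ; inject₁) renaming (suc to fsuc)
open import Data.Product using (Σ; ∃; _×_; _,_; proj₁; proj₂)
open import Relation.Binary.PropositionalEquality using (_≡_; _≢_)
open import Relation.Nullary using (¬_)
open import Algebra.Structures using (IsAbelianGroup)
open import Function.Definitions using (Injective; Bijective)

iter : {A : Set} → ℕ → (A → A) → A → A
iter zero    f x = x
iter (suc k) f x = f (iter k f x)

module Zmod (n : ℕ) .{{_ : NonZero n}} where
  0ₙ : Fin n
  0ₙ = 0 mod n

  1ₙ : Fin n
  1ₙ = 1 mod n

  _+ₙ_ : Fin n → Fin n → Fin n
  a +ₙ b = (toℕ a +ℕ toℕ b) mod n

  _*ₙ_ : Fin n → Fin n → Fin n
  a *ₙ b = (toℕ a *ℕ toℕ b) mod n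

  -ₙ_ : Fin n → Fin n
  -ₙ a = (n ∸ toℕ a) mod n

  _-ₙ_ : Fin n → Fin n → Fin n
  a -ₙ b = a +ₙ (-ₙ b)

record FinAbGroup : Set₁ where
  field
    Carrier        : Set
    _+_            : Carrier → Carrier → Carrier
    0#             : Carrier
    -_             : Carrier → Carrier
    isAbelianGroup : IsAbelianGroup _≡_ _+_ 0# -_
    order          : ℕ
    enum           : Fin order → Carrier
    enum-bijective : Bijective _≡_ _≡_ enum

module Ambient (p m : ℕ) .{{_ : NonZero p}} .{{_ : NonZero m}} (B : FinAbGroup) where
  open Zmod p
  open Zmod m using () renaming (_+ₙ_ to _+ₘ_; 0ₙ to 0ₘ)
  module B = FinAbGroup B

  Vp : Set
  Vp = Fin p × Fin p

  A : Set
  A = Vp × Fin m × B.Carrier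

  _+A_ : A → A → A
  ((a₁ , a₂) , c , b) +A ((a₁' , a₂') , c' , b') =
    ((a₁ +ₙ a₁') , (a₂ +ₙ a₂')) , (c +ₘ c') , (b B.+ b')

  0A : A
  0A = (0ₙ , 0ₙ) , 0ₘ , B.0#

  IsAutomorphism : (A → A) → Set
  IsAutomorphism α = (∀ x y → α (x +A y) ≡ (α x +A α y)) × Bijective _≡_ _≡_ α

  -- the restriction of α to the subgroup Z_p^2 = Z_p^2 × 0 × 0
  -- (this subgroup is the Sylow p-subgroup, hence α-invariant)
  restrict : (A → A) → Vp → Vp
  restrict α v = proj₁ (α (v , 0ₘ , B.0#))

  record Mat2 : Set where
    constructor mat
    field
      m₁₁ m₁₂ m₂₁ m₂₂ : Fin p

  _·M_ : Mat2 → Mat2 → Mat2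
  mat a b c d ·M mat a' b' c' d' =
    mat ((a *ₙ a') +ₙ (b *ₙ c')) ((a *ₙ b') +ₙ (b *ₙ d'))
        ((c *ₙ a') +ₙ (d *ₙ c')) ((c *ₙ b') +ₙ (d *ₙ d'))

  det : Mat2 → Fin p
  det (mat a b c d) = (a *ₙ d) -ₙ (b *ₙ c)

  diag : Fin p → Fin p → Mat2
  diag λ₁ λ₂ = mat λ₁ 0ₙ 0ₙ λ₂

  matrixOf : (Vp → Vp) → Mat2
  matrixOf f = mat (proj₁ (f (1ₙ , 0ₙ))) (proj₁ (f (0ₙ , 1ₙ)))
                   (proj₂ (f (1ₙ , 0ₙ))) (proj₂ (f (0ₙ , 1ₙ)))

  Diagonalisable : Mat2 → Set
  Diagonalisable M =
    Σ Mat2 λ P → det P ≢ 0ₙ × Σ (Fin p) λ λ₁ → Σ (Fin p) λ λ₂ → (M ·M P) ≡ (P ·M diag λ₁ λ₂)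

HasOrder : {X : Set} → (X → X) → ℕ → Set
HasOrder f k = (∀ x → iter k f x ≡ x) × (∀ j → 0 < j → j < k → ¬ (∀ x → iter j f x ≡ x))

module Semidirect (q : ℕ) .{{_ : NonZero q}} {A : Set}
                  (_+A_ : A → A → A) (0A : A) (α : A → A) where
  open Zmod q

  G : Set
  G = Fin q × A

  _·_ : G → G → G
  (u , v) · (x , y) = (u +ₙ x) , (iter (toℕ x) α v +A y)

  e : G
  e = 0ₙ , 0A

-- Sequenceability of a (finite) group with operation _·_ and identity e.
-- An arrangement a₀,…,a_m of all elements (a bijection Fin (suc m) → G)
-- whose successive quotients dᵢ = aᵢ⁻¹ aᵢ₊₁ (i.e. aᵢ₊₁ = aᵢ · dᵢ) are
-- exactly the non-identity elements, each once.

Sequenceable : (G : Set) → (G → G → G) → G → Set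
Sequenceable G _·_ e =
  Σ ℕ λ m → Σ (Fin (suc m) → G) λ a → Bijective _≡_ _≡_ a ×
    Σ (Fin m → G) λ d →
      (∀ i → a (fsuc i) ≡ (a (inject₁ i) · d i)) ×
      Injective _≡_ _≡_ d ×
      (∀ i → d i ≢ e) ×
      (∀ g → g ≢ e → ∃ λ i → d i ≡ g)

Claim : (p q m : ℕ) .{{_ : NonZero p}} .{{_ : NonZero q}} .{{_ : NonZero m}} →
        FinAbGroup → Set
Claim p q m B =
  (α : A → A) → IsAutomorphism α → HasOrder α q →
  HasOrder (restrict α) q → ¬ Diagonalisable (matrixOf (restrict α)) →
  Sequenceable (Semidirect.G q _+A_ 0A α) (Semidirect._·_ q _+A_ 0A α) (Semidirect.e q _+A_ 0A α)
  where open Ambient p m B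

module Submission where

-- With N = ℤₚ² × B, of odd order prime to 3, and Q = ℤ_q ⋉ ℤₘ, the group G is an extension of Q by N.  To each u ∈ N
-- belongs a block: a walk through Q lifted to G with N-coefficients ± u, such that the blocks together visit all
-- elements of G but one and the quotients along them miss only one coset of N.  The quotient across a junction from
-- block u to block u′ lies in that coset and depends only on u + u′, so a harmonious cyclic order of N (in which the
-- sums of consecutive elements run through N) supplies the missing quotients.  The cyclic arrangement of blocks is
-- cut at three places and reassembled into a path through the remaining element; the quotients lost by the cuts are
-- regained when the blocks at the cuts satisfy linear relations, solvable in terms of some v ∈ ℤₚ² and α v that are
-- linearly independent.  Such a v exists: were (1 , 0) an eigenvector of α, then α would be diagonalisable, as p ∤ q.
-- The walk through Q comes from an R*-sequencing: a zigzag if Q is cyclic, explicit if q = 3 and m = 9.  For q = m = 3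
-- there is none, and two different walks are used, one for each half of N ∖ {0}.

open import Defs
open import Algebra.Bundles using (AbelianGroup)
open import Algebra.Structures using (IsAbelianGroup)
open import Data.Bool using (Bool; true; false; not)
open import Data.Fin using (Fin; zero; suc; toℕ; inject₁)
open import Data.Integer using (ℤ; -[1+_]; ∣_∣)
open import Data.List using (List; []; _∷_; _++_; _∷ʳ_; [_]; map; concat; length; lookup; foldr; allFin; applyUpTo)
open import Data.List.Membership.Propositional using (_∈_; _∉_)
open import Data.List.Membership.Propositional.Properties using (∈-++⁺ˡ; ∈-++⁺ʳ; ∈-++⁻; ∈-concat⁺′; ∈-map⁺; ∈-map⁻; ∈-∃++; ∈-allFin; ∈-applyUpTo⁺; ∈-applyUpTo⁻; ∈-concat⁻′; ∈-lookup)
open import Data.List.Membership.Propositional.Properties.WithK using (unique∧set⇒bag)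
open import Data.List.Relation.Binary.BagAndSetEquality using (∼bag⇒↭)
open import Data.List.Relation.Binary.Permutation.Propositional using (_↭_)
open import Data.List.Relation.Unary.All using (All; []; _∷_)
open import Data.List.Relation.Unary.AllPairs using ([]; _∷_)
open import Data.List.Relation.Unary.Any using (Any; here; there)
open import Data.List.Relation.Unary.Unique.Propositional using (Unique)
open import Data.Nat using (ℕ; zero; suc; NonZero; _+_; _*_; _^_; _∸_; _≤_; _<_; z≤n; s≤s; _<?_; _≤?_)
open import Data.Nat.Coprimality using (Coprime; coprime-divisor; coprime-Bézout)
open import Data.Nat.DivMod using (_mod_; _%_)
open import Data.Nat.Divisibility using (_∣_; divides; m%n≡0⇒n∣m; n∣m⇒m%n≡0; ∣m+n∣m⇒∣n; ∣-trans; m∣m*n; n∣m*n; ∣⇒≤; ∣m∣n⇒∣m+n; ∣-refl)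
open import Data.Nat.GCD using (module Bézout)
open import Data.Nat.ListAction using (sum)
open import Data.Nat.ListAction.Properties using (sum-↭; sum-++)
open import Data.Nat.Primality using (Prime; euclidsLemma; prime⇒irreducible; ¬prime[0]; ¬prime[1]; prime?)
open import Data.Nat.Tactic.RingSolver using (solve-∀)
open import Data.Product using (∃; ∃₂; _×_; _,_; proj₁; proj₂)
open import Data.Product.Function.NonDependent.Propositional using (_×-↔_)
open import Data.Product.Properties using (≡-dec)
open import Data.Sum using (_⊎_; inj₁; inj₂; [_,_]′)
open import Data.Unit using (tt)
open import Function.Base using (_∘_; id)
open import Function.Bundles using (_↔_; Inverse; mk↔ₛ′; mk⇔)
open import Function.Construct.Composition using (_↔-∘_)
open import Function.Construct.Identity using (↔-id)
open import Function.Construct.Symmetry using (↔-sym)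
open import Function.Definitions using (Injective)
open import Relation.Binary.Definitions using (DecidableEquality; tri<; tri≈; tri>)
open import Relation.Binary.PropositionalEquality using (_≡_; _≢_; refl; sym; trans; cong; cong₂; subst; isEquivalence; module ≡-Reasoning)
open import Relation.Nullary using (¬_; Dec; yes; no; contradiction)
open import Relation.Nullary.Decidable using (True; toWitness; _×-dec_; _⊎-dec_; _→-dec_; map′; from-yes)
import Algebra.Properties.AbelianGroup
import Algebra.Properties.CommutativeMonoid.Mult
import Algebra.Properties.CommutativeSemigroup
import Data.Bool.Properties as Bool
import Data.Fin.Properties as Fin
import Data.Integer as ℤ
import Data.Integer.Divisibility.Signed as ℤ∣
import Data.Integer.Properties as ℤ
import Data.Integer.Tactic.RingSolver as ℤSolver
import Data.List.Membership.DecPropositional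
import Data.List.Properties as List
import Data.List.Relation.Binary.Permutation.Propositional as Perm
import Data.List.Relation.Binary.Permutation.Propositional.Properties as ↭
import Data.List.Relation.Unary.All as All
import Data.List.Relation.Unary.Any as Any
import Data.List.Relation.Unary.Any.Properties as AnyP
import Data.List.Relation.Unary.Unique.Propositional.Properties as Unique
import Data.Nat.DivMod as DM
import Data.Nat.Properties as ℕ

-- Placed in a cycle, the blocks have as many quotients as `G` has non-identity elements, so the
-- extra point z must be inserted without changing the collection of quotients. One cut cannot do
-- this, since z would have to equal an end of the resulting path. Nor can two: with z between the
-- two pieces, the product of the two new quotients is one of the lost ones, and if the new
-- quotients are the lost ones, then one of them is the identity. With three cuts there are three
-- equations between quotients. They become linear equations in N with one free parameter t₂, and
-- for t₂ = v all cuts are combinations of v and α v. The cyclic order has to contain the cut blocks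
-- in the right positions, which is arranged along two directions spanning ℤₚ²; hence the
-- independence of v and α v. A block begins with u and ends with - u, so junctions depend on sums.
-- Up to sign and powers of α, each step inside a block multiplies u by 1, 2, 3 or 1 + αᵏ. These
-- maps are bijective on N, because |N| is prime to 6 and α has odd order.

injective⇒surjective : ∀ {n} (f : Fin n → Fin n) → Injective _≡_ _≡_ f → ∀ y → ∃ λ x → f x ≡ y
injective⇒surjective {suc n} f inj y with Fin.any? (λ x → f x Fin.≟ y)
... | yes found  = found
... | no missing = contradiction
  (λ {i} {j} e → inj (Fin.punchOut-injective (λ y≡ → missing (i , sym y≡)) (λ y≡ → missing (j , sym y≡)) e))
  (Fin.<⇒notInjective (ℕ.n<1+n n))

section-injective : ∀ {n} {f : Fin n → Fin n} (surj : ∀ y → ∃ λ x → f x ≡ y) → Injective _≡_ _≡_ (proj₁ ∘ surj)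
section-injective {f = f} surj {x} {y} e = trans (sym (proj₂ (surj x))) (trans (cong f e) (proj₂ (surj y)))

surjective⇒injective : ∀ {n} (f : Fin n → Fin n) → (∀ y → ∃ λ x → f x ≡ y) → Injective _≡_ _≡_ f
surjective⇒injective f surj {a} {b} fa≡fb
  with a′ , refl ← injective⇒surjective (proj₁ ∘ surj) (section-injective surj) a
  with b′ , refl ← injective⇒surjective (proj₁ ∘ surj) (section-injective surj) b
  = cong (proj₁ ∘ surj) (trans (sym (proj₂ (surj a′))) (trans fa≡fb (proj₂ (surj b′))))

module Finite {X : Set} {n : ℕ} (X↔n : X ↔ Fin n) where
  open Inverse X↔n using (to; from; strictlyInverseˡ; strictlyInverseʳ)

  to-injective : Injective _≡_ _≡_ to
  to-injective {x} {y} e = trans (sym (strictlyInverseʳ x)) (trans (cong from e) (strictlyInverseʳ y))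

  _≟_ : DecidableEquality X
  x ≟ y with to x Fin.≟ to y
  ... | yes e  = yes (to-injective e)
  ... | no  ne = no (ne ∘ cong to)

  endo-surjective : (f : X → X) → Injective _≡_ _≡_ f → ∀ y → ∃ λ x → f x ≡ y
  endo-surjective f inj y = from (proj₁ preimage) , to-injective (proj₂ preimage)
    where
    conj-injective : Injective _≡_ _≡_ (to ∘ f ∘ from)
    conj-injective {i} {j} e = trans (sym (strictlyInverseˡ i))
      (trans (cong to (inj (to-injective e))) (strictlyInverseˡ j))
    preimage : ∃ λ i → to (f (from i)) ≡ to y
    preimage = injective⇒surjective (to ∘ f ∘ from) conj-injective (to y)

  family-injective : (f : Fin n → X) → (∀ x → ∃ λ i → f i ≡ x) → Injective _≡_ _≡_ f
  family-injective f surj e = surjective⇒injective (to ∘ f) to-f-surjective (cong to e)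
    where
    to-f-surjective : ∀ j → ∃ λ i → to (f i) ≡ j
    to-f-surjective j with i , e ← surj (from j) = i , trans (cong to e) (strictlyInverseˡ j)

-- Neighbours, first and last elements of lists

data Adj {X : Set} (a b : X) : List X → Set where
  here  : ∀ {xs} → Adj a b (a ∷ b ∷ xs)
  there : ∀ {x xs} → Adj a b xs → Adj a b (x ∷ xs)

module _ {X : Set} {a b : X} where

  Adj-++ˡ : ∀ {xs ys} → Adj a b xs → Adj a b (xs ++ ys)
  Adj-++ˡ here      = here
  Adj-++ˡ (there p) = there (Adj-++ˡ p)

  Adj-++ʳ : ∀ xs {ys} → Adj a b ys → Adj a b (xs ++ ys)
  Adj-++ʳ []       p = p
  Adj-++ʳ (x ∷ xs) p = there (Adj-++ʳ xs p)

  Adj-lookup : ∀ {x xs} → Adj a b (x ∷ xs) →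
    ∃ λ i → lookup (x ∷ xs) (inject₁ i) ≡ a × lookup (x ∷ xs) (suc i) ≡ b
  Adj-lookup here = zero , refl , refl
  Adj-lookup {xs = y ∷ ys} (there p) with i , e , e′ ← Adj-lookup p = suc i , e , e′

Starts Ends : {X : Set} → X → List X → Set
Starts a xs = ∃ λ ys → xs ≡ a ∷ ys
Ends   a xs = ∃ λ ys → xs ≡ ys ∷ʳ a

module _ {X : Set} {a b : X} where

  Adj-join : ∀ xs ys → Ends a xs → Starts b ys → Adj a b (xs ++ ys)
  Adj-join _ _ (xs , refl) (ys , refl) = subst (Adj a b) (sym (List.++-assoc xs [ a ] (b ∷ ys))) (Adj-++ʳ xs here)

  Adj-split : ∀ xs {ys} → Adj a b (xs ++ ys) → Adj a b xs ⊎ (Ends a xs × Starts b ys) ⊎ Adj a b ys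
  Adj-split []           p         = inj₂ (inj₂ p)
  Adj-split (x ∷ [])     here      = inj₂ (inj₁ (([] , refl) , (_ , refl)))
  Adj-split (x ∷ [])     (there p) = inj₂ (inj₂ p)
  Adj-split (x ∷ y ∷ xs) here      = inj₁ here
  Adj-split (x ∷ y ∷ xs) (there p) with Adj-split (y ∷ xs) p
  ... | inj₁ q                           = inj₁ (there q)
  ... | inj₂ (inj₁ ((zs , e) , s))       = inj₂ (inj₁ ((x ∷ zs , cong (x ∷_) e) , s))
  ... | inj₂ (inj₂ q)                    = inj₂ (inj₂ q)

  Adj-∈ˡ : ∀ {xs} → Adj a b xs → a ∈ xs
  Adj-∈ˡ here      = here refl
  Adj-∈ˡ (there p) = there (Adj-∈ˡ p)

  Adj-map : ∀ {Y : Set} (f : X → Y) {xs} → Adj a b xs → Adj (f a) (f b) (map f xs)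
  Adj-map f here      = here
  Adj-map f (there p) = there (Adj-map f p)

Starts-unique : ∀ {X : Set} {a b : X} {xs} → Starts a xs → Starts b xs → a ≡ b
Starts-unique (_ , refl) (_ , refl) = refl

Ends-unique : ∀ {X : Set} {a b : X} {xs} → Ends a xs → Ends b xs → a ≡ b
Ends-unique (ys , refl) (zs , e) = List.∷ʳ-injectiveʳ ys zs e

Ends-++ : ∀ {X : Set} {a : X} xs {ys} → Ends a ys → Ends a (xs ++ ys)
Ends-++ {a = a} xs (ys , refl) = xs ++ ys , sym (List.++-assoc xs ys [ a ])

Starts-++ : ∀ {X : Set} {a : X} {xs} ys → Starts a xs → Starts a (xs ++ ys)
Starts-++ ys (xs , refl) = xs ++ ys , refl

suffix-Ends : ∀ {X : Set} {x : X} xs {ys y} → Ends x (xs ++ ys) → Starts y ys → Ends x ys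
suffix-Ends [] es ss = es
suffix-Ends (w ∷ []) {ys} ([] , ()) (_ , refl)
suffix-Ends (w ∷ []) (v ∷ vs , refl) ss = vs , refl
suffix-Ends (w ∷ w′ ∷ xs) ([] , ()) ss
suffix-Ends (w ∷ w′ ∷ xs) (v ∷ vs , eq) ss = suffix-Ends (w′ ∷ xs) (vs , List.∷-injectiveʳ eq) ss

-- A counting criterion for sequenceability

module Criterion {G : Set} (_·_ : G → G → G) (e : G) {n : ℕ} (G↔n : G ↔ Fin n)
  (quotient : G → G → G) (·-quotient : ∀ a b → a · quotient a b ≡ b)
  (cancelˡ : ∀ a {c d} → a · c ≡ a · d → c ≡ d) where

  private module G = Finite G↔n

  -- Covering is enough: a list of `n` entries that reaches all `n` elements repeats none, and the
  -- quotients are counted in the same way. Distinctness never has to be checked for a concrete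
  -- path.
  sequenceable : (P : List G) → length P ≡ n → (∀ g → g ∈ P) →
    (∀ d → d ≢ e → ∃₂ λ a b → Adj a b P × a · d ≡ b) → Sequenceable G _·_ e
  sequenceable []       _    covers _        with () ← covers e
  sequenceable (p ∷ ps) refl covers quotients =
    length ps , arrangement , (arrangement-injective , arrangement-surjective) , steps ,
    (λ i → sym (·-quotient _ _)) , steps-injective , steps≢e , steps-cover
    where
    arrangement : Fin n → G
    arrangement = lookup (p ∷ ps)

    index-of : ∀ {g} xs → g ∈ xs → ∃ λ i → lookup xs i ≡ g
    index-of (x ∷ xs) (here refl) = zero , refl
    index-of (x ∷ xs) (there m) with i , eq ← index-of xs m = suc i , eq

    arrangement-covers : ∀ g → ∃ λ i → arrangement i ≡ g
    arrangement-covers g = index-of (p ∷ ps) (covers g)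

    arrangement-surjective : ∀ g → ∃ λ i → ∀ {j} → j ≡ i → arrangement j ≡ g
    arrangement-surjective g with i , eq ← arrangement-covers g = i , λ { refl → eq }

    arrangement-injective : Injective _≡_ _≡_ arrangement
    arrangement-injective = G.family-injective arrangement arrangement-covers

    steps : Fin (length ps) → G
    steps i = quotient (arrangement (inject₁ i)) (arrangement (suc i))

    steps-cover : ∀ d → d ≢ e → ∃ λ i → steps i ≡ d
    steps-cover d d≢e with a , b , adj , ad≡b ← quotients d d≢e
      with i , refl , refl ← Adj-lookup adj = i , cancelˡ _ (trans (·-quotient _ _) (sym ad≡b))

    -- There are `n` - 1 quotients; with `e` in front there are `n` values, so covering `G` makes
    -- the family injective. This shows both that the quotients are distinct and that none of them
    -- is `e`.
    padded : Fin (suc (length ps)) → G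
    padded zero    = e
    padded (suc i) = steps i

    padded-covers : ∀ g → ∃ λ i → padded i ≡ g
    padded-covers g with g G.≟ e
    ... | yes g≡e = zero , sym g≡e
    ... | no  g≢e with i , eq ← steps-cover g g≢e = suc i , eq

    padded-injective : Injective _≡_ _≡_ padded
    padded-injective = G.family-injective padded padded-covers

    steps-injective : Injective _≡_ _≡_ steps
    steps-injective eq = Fin.suc-injective (padded-injective {suc _} {suc _} eq)

    steps≢e : ∀ i → steps i ≢ e
    steps≢e i eq with () ← padded-injective {suc i} {zero} eq

-- Cutting a cyclic sequence of blocks and reassembling it

Adj-concat : ∀ {X : Set} {a b : X} {seg segs} → seg ∈ segs → Adj a b seg → Adj a b (concat segs)
Adj-concat (here refl)               p = Adj-++ˡ p
Adj-concat {segs = s ∷ _} (there m) p = Adj-++ʳ s (Adj-concat m p)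

-- Cutting a cyclic concatenation of blocks at the edges t → t⁺ , inside block t₁ and inside block t₂ (in this
-- cyclic order) leaves three pieces, which are reassembled into a path through the extra point z.  The three
-- hypotheses *-step say that the quotients lost at the cuts are the quotients gained at the new junctions.
module Splice {G N : Set} (_·_ : G → G → G) (_+ᴺ_ : N → N → N) (e z : G)
  (B : N → List G) (first last : N → G)
  (starts : ∀ u → Starts (first u) (B u)) (ends : ∀ u → Ends (last u) (B u))
  (t t⁺ t₁ t₂ : N) (R₁ R₂ R₃ : List N) {α₁ ω₁ α₂ ω₂ : List G} {a₁ o₁ a₂ o₂ : G}
  (split₁ : B t₁ ≡ α₁ ++ ω₁) (split₂ : B t₂ ≡ α₂ ++ ω₂)
  (ends₁ : Ends a₁ α₁) (starts₁ : Starts o₁ ω₁) (ends₂ : Ends a₂ α₂) (starts₂ : Starts o₂ ω₂)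
  (cut₁-step : ∀ d → (a₁ · d) ≡ o₁ → (a₂ · d) ≡ first t⁺)
  (cut₂-step : ∀ d → (a₂ · d) ≡ o₂ → (last t · d) ≡ z)
  (cut₃-step : ∀ d → (last t · d) ≡ first t⁺ → (z · d) ≡ o₁) where

  private
    segments : List G → List N → List G → List (List G)
    segments s M s′ = s ∷ map B M ∷ʳ s′

    -- The cyclic order is `X₁`, `X₂`, `X₃`, and the path takes them as `X₃`, `z`, `X₂`, `X₁`, so
    -- that none of the three old junctions between pieces survives.
    X₁ X₂ X₃ : List (List G)
    X₁ = segments (B t⁺) R₁ α₁
    X₂ = segments ω₁ R₂ α₂
    X₃ = segments ω₂ R₃ (B t)

  path : List G
  path = concat X₃ ++ z ∷ concat X₂ ++ concat X₁

  order : List N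
  order = t ∷ t⁺ ∷ R₁ ++ t₁ ∷ R₂ ++ t₂ ∷ R₃

  Consecutive : N → N → Set
  Consecutive u u′ = Adj u u′ (t⁺ ∷ R₁ ∷ʳ t₁) ⊎ Adj u u′ (t₁ ∷ R₂ ∷ʳ t₂) ⊎ Adj u u′ (t₂ ∷ R₃ ∷ʳ t) ⊎ (u ≡ t × u′ ≡ t⁺)

  private
    segments-first : ∀ {s M s′} → s ∈ segments s M s′
    segments-first = here refl

    segments-last : ∀ {s s′} M → s′ ∈ segments s M s′
    segments-last M = there (∈-++⁺ʳ (map B M) (here refl))

    segments-mid : ∀ {s M s′ u} → u ∈ M → B u ∈ segments s M s′
    segments-mid m = there (∈-++⁺ˡ (∈-map⁺ B m))

    -- In a piece only the outer segments may be partial blocks; `a` and `b` label the blocks from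
    -- which these come, so that a junction is described by labels alone.
    run : ∀ {a s b s′} M {u u′} → Ends (last a) s → Starts (first b) s′ →
      Adj u u′ (a ∷ M ∷ʳ b) → Adj (last u) (first u′) (concat (segments s M s′))
    run {s = s} [] es ss here = Adj-join s _ es (Starts-++ [] ss)
    run [] es ss (there (there ()))
    run {s = s} (c ∷ M) es ss here = Adj-join s _ es (Starts-++ _ (starts c))
    run {s = s} (c ∷ M) es ss (there p) = Adj-++ʳ s (run M (ends c) ss p)

    concat-Ends : ∀ s M {s′ a} → Ends a s′ → Ends a (concat (segments s M s′))
    concat-Ends s [] {s′} {a} es = Ends-++ s (subst (Ends a) (sym (List.++-identityʳ s′)) es)
    concat-Ends s (u ∷ M) es = Ends-++ s (concat-Ends (B u) M es)

    in₁ : ∀ {a b} → Adj a b (concat X₁) → Adj a b path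
    in₁ p = Adj-++ʳ (concat X₃) (there (Adj-++ʳ (concat X₂) p))

    in₂ : ∀ {a b} → Adj a b (concat X₂) → Adj a b path
    in₂ p = Adj-++ʳ (concat X₃) (there (Adj-++ˡ p))

    in₃ : ∀ {a b} → Adj a b (concat X₃) → Adj a b path
    in₃ p = Adj-++ˡ p

    adj₁ : ∀ {a b seg} → seg ∈ X₁ → Adj a b seg → Adj a b path
    adj₁ m p = in₁ (Adj-concat m p)

    adj₂ : ∀ {a b seg} → seg ∈ X₂ → Adj a b seg → Adj a b path
    adj₂ m p = in₂ (Adj-concat m p)

    adj₃ : ∀ {a b seg} → seg ∈ X₃ → Adj a b seg → Adj a b path
    adj₃ m p = in₃ (Adj-concat m p)

    mem₁ : ∀ {g seg} → seg ∈ X₁ → g ∈ seg → g ∈ path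
    mem₁ m p = ∈-++⁺ʳ (concat X₃) (there (∈-++⁺ʳ (concat X₂) (∈-concat⁺′ p m)))

    mem₂ : ∀ {g seg} → seg ∈ X₂ → g ∈ seg → g ∈ path
    mem₂ m p = ∈-++⁺ʳ (concat X₃) (there (∈-++⁺ˡ (∈-concat⁺′ p m)))

    mem₃ : ∀ {g seg} → seg ∈ X₃ → g ∈ seg → g ∈ path
    mem₃ m p = ∈-++⁺ˡ (∈-concat⁺′ p m)

    IsStep : G → Set
    IsStep d = ∃₂ λ a b → Adj a b path × (a · d) ≡ b

    prefix-Starts : ∀ {x y : G} xs {ys} → Ends y xs → Starts x (xs ++ ys) → Starts x xs
    prefix-Starts []       ([] , ())    ss
    prefix-Starts []       (_ ∷ _ , ()) ss
    prefix-Starts (x ∷ xs) es           (_ , refl) = xs , refl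

    starts₁′ : Starts (first t₁) α₁
    starts₁′ = prefix-Starts α₁ ends₁ (subst (Starts (first t₁)) split₁ (starts t₁))

    starts₂′ : Starts (first t₂) α₂
    starts₂′ = prefix-Starts α₂ ends₂ (subst (Starts (first t₂)) split₂ (starts t₂))

    ends₁′ : Ends (last t₁) ω₁
    ends₁′ = suffix-Ends α₁ (subst (Ends (last t₁)) split₁ (ends t₁)) starts₁

    ends₂′ : Ends (last t₂) ω₂
    ends₂′ = suffix-Ends α₂ (subst (Ends (last t₂)) split₂ (ends t₂)) starts₂

    consecutive-step : ∀ {u u′ d} → Consecutive u u′ → (last u · d) ≡ first u′ → IsStep d
    consecutive-step (inj₁ p) eq = _ , _ , in₁ (run R₁ (ends t⁺) starts₁′ p) , eq
    consecutive-step (inj₂ (inj₁ p)) eq = _ , _ , in₂ (run R₂ ends₁′ starts₂′ p) , eq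
    consecutive-step (inj₂ (inj₂ (inj₁ p))) eq = _ , _ , in₃ (run R₃ ends₂′ (starts t) p) , eq
    consecutive-step {d = d} (inj₂ (inj₂ (inj₂ (refl , refl)))) eq =
      z , o₁ , Adj-++ʳ (concat X₃) (Adj-join [ z ] (concat X₂ ++ concat X₁) ([] , refl)
                 (Starts-++ _ (Starts-++ _ starts₁))) , cut₃-step d eq

    -- An edge of a block survives unless it is one of the two cut edges. Their quotients reappear
    -- at the junction from `a₂` to `first t⁺` and at the one from `last t` to `z`.
    block-step : ∀ {u a b d} → u ∈ order → Adj a b (B u) → (a · d) ≡ b → IsStep d
    block-step (here refl) p eq = _ , _ , adj₃ (segments-last R₃) p , eq
    block-step (there (here refl)) p eq = _ , _ , adj₁ segments-first p , eq
    block-step {d = d} (there (there m)) p eq with ∈-++⁻ R₁ m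
    ... | inj₁ m₁ = _ , _ , adj₁ (segments-mid m₁) p , eq
    ... | inj₂ (here refl) with Adj-split α₁ (subst (Adj _ _) split₁ p)
    ...   | inj₁ q = _ , _ , adj₁ (segments-last R₁) q , eq
    ...   | inj₂ (inj₂ q) = _ , _ , adj₂ segments-first q , eq
    ...   | inj₂ (inj₁ (ea , sb)) with refl ← Ends-unique ea ends₁ with refl ← Starts-unique sb starts₁ =
            _ , _ , Adj-++ʳ (concat X₃) (there (Adj-join (concat X₂) (concat X₁)
              (concat-Ends ω₁ R₂ ends₂) (Starts-++ _ (starts t⁺)))) , cut₁-step d eq
    block-step {d = d} (there (there m)) p eq | inj₂ (there m₂) with ∈-++⁻ R₂ m₂
    ... | inj₁ m₃ = _ , _ , adj₂ (segments-mid m₃) p , eq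
    ... | inj₂ (there m₃) = _ , _ , adj₃ (segments-mid m₃) p , eq
    ... | inj₂ (here refl) with Adj-split α₂ (subst (Adj _ _) split₂ p)
    ...   | inj₁ q = _ , _ , adj₂ (segments-last R₂) q , eq
    ...   | inj₂ (inj₂ q) = _ , _ , adj₃ segments-first q , eq
    ...   | inj₂ (inj₁ (ea , sb)) with refl ← Ends-unique ea ends₂ with refl ← Starts-unique sb starts₂ =
            _ , _ , Adj-join (concat X₃) _ (concat-Ends ω₂ R₃ (ends t)) (_ , refl) , cut₂-step d eq

    block-covered : ∀ {u g} → u ∈ order → g ∈ B u → g ∈ path
    block-covered (here refl) g∈ = mem₃ (segments-last R₃) g∈
    block-covered (there (here refl)) g∈ = mem₁ segments-first g∈
    block-covered (there (there m)) g∈ with ∈-++⁻ R₁ m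
    ... | inj₁ m₁ = mem₁ (segments-mid m₁) g∈
    ... | inj₂ (here refl) with ∈-++⁻ α₁ (subst (_ ∈_) split₁ g∈)
    ...   | inj₁ q = mem₁ (segments-last R₁) q
    ...   | inj₂ q = mem₂ segments-first q
    block-covered (there (there m)) g∈ | inj₂ (there m₂) with ∈-++⁻ R₂ m₂
    ... | inj₁ m₃ = mem₂ (segments-mid m₃) g∈
    ... | inj₂ (there m₃) = mem₃ (segments-mid m₃) g∈
    ... | inj₂ (here refl) with ∈-++⁻ α₂ (subst (_ ∈_) split₂ g∈)
    ...   | inj₁ q = mem₂ (segments-last R₂) q
    ...   | inj₂ q = mem₃ segments-first q

  path-covers : (∀ u → u ∈ order) → (∀ g → g ≡ z ⊎ ∃ λ u → g ∈ B u) → ∀ g → g ∈ path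
  path-covers all∈ cover g with cover g
  ... | inj₁ refl     = ∈-++⁺ʳ (concat X₃) (here refl)
  ... | inj₂ (u , g∈) = block-covered (all∈ u) g∈

  path-steps : (∀ u → u ∈ order) → (∀ n → ∃₂ λ u u′ → Consecutive u u′ × (u +ᴺ u′) ≡ n) →
    (∀ d → d ≢ e → (∃ λ u → ∃₂ λ a b → Adj a b (B u) × (a · d) ≡ b) ⊎
                   (∃ λ n → ∀ u u′ → (u +ᴺ u′) ≡ n → (last u · d) ≡ first u′)) →
    ∀ d → d ≢ e → ∃₂ λ a b → Adj a b path × (a · d) ≡ b
  path-steps all∈ sums differences d d≢e with differences d d≢e
  ... | inj₁ (u , a , b , adj , eq) = block-step (all∈ u) adj eq
  ... | inj₂ (n , steps) with u , u′ , c , eq ← sums n = consecutive-step c (steps u u′ eq)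

  private
    weight : List N → ℕ
    weight M = sum (map (length ∘ B) M)

    weight-++ : ∀ M M′ → weight (M ++ M′) ≡ weight M + weight M′
    weight-++ [] M′ = refl
    weight-++ (u ∷ M) M′ = trans (cong (length (B u) +_) (weight-++ M M′)) (sym (ℕ.+-assoc (length (B u)) _ _))

    segments-length : ∀ s M s′ → length (concat (segments s M s′)) ≡ length s + (weight M + length s′)
    segments-length s M s′ = trans (List.length-++ s) (cong (length s +_) (tail-length M))
      where
      tail-length : ∀ M → length (concat (map B M ∷ʳ s′)) ≡ weight M + length s′
      tail-length [] = trans (List.length-++ s′) (ℕ.+-identityʳ _)
      tail-length (u ∷ M) = trans (List.length-++ (B u)) (trans (cong (length (B u) +_) (tail-length M))
        (sym (ℕ.+-assoc (length (B u)) _ _)))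

  path-length : length path ≡ suc (sum (map (length ∘ B) order))
  path-length = begin
    length path
      ≡⟨ List.length-++ (concat X₃) ⟩
    length (concat X₃) + suc (length (concat X₂ ++ concat X₁))
      ≡⟨ cong₂ (λ i j → i + suc j) (segments-length ω₂ R₃ (B t))
           (trans (List.length-++ (concat X₂)) (cong₂ _+_ (segments-length ω₁ R₂ α₂) (segments-length (B t⁺) R₁ α₁))) ⟩
    (length ω₂ + (weight R₃ + length (B t))) +
      suc ((length ω₁ + (weight R₂ + length α₂)) + (length (B t⁺) + (weight R₁ + length α₁)))
      ≡⟨ rearrange (length ω₂) (weight R₃) (length (B t)) (length ω₁) (weight R₂) (length α₂) (length (B t⁺)) (weight R₁) (length α₁) ⟩
    suc (length (B t) + (length (B t⁺) + (weight R₁ + ((length α₁ + length ω₁) + (weight R₂ + ((length α₂ + length ω₂) + weight R₃))))))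
      ≡⟨ cong (λ k → suc (length (B t) + (length (B t⁺) + k))) (sym (trans (weight-++ R₁ _)
           (cong (weight R₁ +_) (cong₂ _+_ (trans (cong length split₁) (List.length-++ α₁))
             (trans (weight-++ R₂ _) (cong (weight R₂ +_) (cong (_+ weight R₃) (trans (cong length split₂) (List.length-++ α₂))))))))) ⟩
    suc (sum (map (length ∘ B) order)) ∎
    where
    open ≡-Reasoning
    rearrange : ∀ a b c d f g h i j → (a + (b + c)) + suc ((d + (f + g)) + (h + (i + j))) ≡
      suc (c + (h + (i + ((j + d) + (f + ((g + a) + b))))))
    rearrange = solve-∀

-- Harmonious cyclic orders of abelian groups of odd exponent

module Abelian {N : Set} {_⊕_ : N → N → N} {0ᴺ : N} {⊖_ : N → N} (isAb : IsAbelianGroup _≡_ _⊕_ 0ᴺ ⊖_) where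

  group : AbelianGroup _ _
  group = record { isAbelianGroup = isAb }

  open AbelianGroup group public using (commutativeMonoid)
  open IsAbelianGroup isAb public using (assoc; comm; identityˡ; identityʳ; inverseˡ; inverseʳ)
  open Algebra.Properties.CommutativeMonoid.Mult commutativeMonoid public
    renaming (_×_ to _•_; ×-homo-+ to •-+; ×-assocˡ to •-assoc; ×-distrib-+ to •-⊕)
    using ()
  open Algebra.Properties.AbelianGroup group public using ()
    renaming (∙-cancelˡ to ⊕-cancelˡ; ∙-cancelʳ to ⊕-cancelʳ; ⁻¹-∙-comm to ⊖-⊕; ⁻¹-involutive to ⊖-involutive; inverseʳ-unique to ⊖-unique; ε⁻¹≈ε to ⊖-0; ⁻¹-injective to ⊖-injective)
  open Algebra.Properties.CommutativeSemigroup (AbelianGroup.commutativeSemigroup group) public using (interchange)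

  •-0 : ∀ k → k • 0ᴺ ≡ 0ᴺ
  •-0 zero    = refl
  •-0 (suc k) = trans (identityˡ _) (•-0 k)

  two-• : ∀ x → 2 • x ≡ x ⊕ x
  two-• x = cong (x ⊕_) (identityʳ x)

  cancel-⊖ : ∀ x y → (x ⊕ y) ⊕ (⊖ y) ≡ x
  cancel-⊖ x y = trans (assoc x y (⊖ y)) (trans (cong (x ⊕_) (inverseʳ y)) (identityʳ x))

parity : ∀ r → ∃ λ i → r ≡ i + i ⊎ r ≡ suc (i + i)
parity zero = 0 , inj₁ refl
parity (suc r) with parity r
... | i , inj₁ refl = i , inj₂ refl
... | i , inj₂ refl = suc i , inj₁ (cong suc (sym (ℕ.+-suc i i)))

double≢odd : ∀ i j → i + i ≢ suc (j + j)
double≢odd (suc i) zero eq with () ← trans (sym (ℕ.+-suc i i)) (ℕ.suc-injective eq)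
double≢odd (suc i) (suc j) eq = double≢odd i j (ℕ.suc-injective (trans (sym (ℕ.+-suc i i))
  (trans (ℕ.suc-injective eq) (cong suc (ℕ.+-suc j j)))))

Adj-through : ∀ {X : Set} {a b : X} xs {m ys} → Adj a b (xs ++ m ∷ ys) → Adj a b (xs ∷ʳ m) ⊎ Adj a b (m ∷ ys)
Adj-through [] p = inj₂ p
Adj-through (x ∷ []) here = inj₁ here
Adj-through (x ∷ y ∷ xs) here = inj₁ here
Adj-through (x ∷ xs) (there p) with Adj-through xs p
... | inj₁ q = inj₁ (there q)
... | inj₂ q = inj₂ q

-- Every subgroup of a finite abelian group of odd exponent is listed cyclically so that the sums of
-- consecutive elements again run through the subgroup.  Adjoining x of relative order k replaces each
-- element a by the run a, a + x, …, a + (k - 1)x: the sums inside runs are 2a + (2i + 1)x, those between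
-- runs are a + b + (k - 1)x, and k is odd.
module Harmonious {N : Set} {_⊕_ : N → N → N} {0ᴺ : N} {⊖_ : N → N} (isAb : IsAbelianGroup _≡_ _⊕_ 0ᴺ ⊖_)
  (_≟_ : DecidableEquality N) (ε : ℕ) where

  open Abelian isAb
  open import Data.List.Membership.DecPropositional _≟_ using (_∈?_)

  private
    E : ℕ
    E = suc (ε + ε)

  record IsHarmonious (L : List N) : Set where
    field
      tail   : List N
      head   : L ≡ 0ᴺ ∷ tail
      closed : ∀ {a b} → a ∈ L → b ∈ L → (a ⊕ b) ∈ L
      sums   : ∀ {h} → h ∈ L → ∃₂ λ a b → a ∈ L × b ∈ L × Adj a b (L ∷ʳ 0ᴺ) × (a ⊕ b) ≡ h
      unique : Unique L

    zero∈ : 0ᴺ ∈ L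
    zero∈ = subst (0ᴺ ∈_) (sym head) (here refl)

    multiple∈ : ∀ {a} k → a ∈ L → (k • a) ∈ L
    multiple∈ zero    a∈ = zero∈
    multiple∈ (suc k) a∈ = closed a∈ (multiple∈ k a∈)

  trivial : IsHarmonious [ 0ᴺ ]
  trivial = record
    { tail = [] ; head = refl
    ; closed = λ { (here refl) (here refl) → here (identityˡ 0ᴺ) }
    ; sums = λ { (here refl) → 0ᴺ , 0ᴺ , here refl , here refl , here , identityˡ 0ᴺ }
    ; unique = [] ∷ [] }

  module _ (exponent : ∀ a → E • a ≡ 0ᴺ) where

    -- Since 2(`ε` + 1) = `E` + 1, multiplication by `suc ε` halves. Halves, and inverses as
    -- multiples by `ε + ε`, are thus obtained by addition, so the field `closed` yields them as
    -- well.
    double-half : ∀ h → (suc ε • h) ⊕ (suc ε • h) ≡ h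
    double-half h = trans (sym (•-+ h (suc ε) (suc ε)))
      (trans (cong (_• h) (cong suc (ℕ.+-suc ε ε))) (trans (cong (h ⊕_) (exponent h)) (identityʳ h)))

    opposite : ∀ a → a ⊕ ((ε + ε) • a) ≡ 0ᴺ
    opposite = exponent

    run : ℕ → N → N → List N
    run k x a = applyUpTo (λ i → a ⊕ (i • x)) k

    extend : ℕ → N → List N → List N
    extend k x L = concat (map (run k x) L)

    module _ {L : List N} (H : IsHarmonious L) (x : N) (κ : ℕ)
      (kx∈ : (suc (κ + κ) • x) ∈ L) (minimal : ∀ j → 0 < j → j < suc (κ + κ) → (j • x) ∉ L) where
      open IsHarmonious H

      private
        k : ℕ
        k = suc (κ + κ)

      ∈-extend⁺ : ∀ {h} r → h ∈ L → r < k → (h ⊕ (r • x)) ∈ extend k x L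
      ∈-extend⁺ {h} r h∈ r<k = ∈-concat⁺′ (∈-applyUpTo⁺ (λ i → h ⊕ (i • x)) r<k) (∈-map⁺ (run k x) h∈)

      ∈-extend⁻ : ∀ {g} → g ∈ extend k x L → ∃₂ λ h r → h ∈ L × r < k × g ≡ h ⊕ (r • x)
      ∈-extend⁻ g∈ with seg , g∈seg , seg∈ ← ∈-concat⁻′ (map (run k x) L) g∈
        with h , h∈ , refl ← ∈-map⁻ (run k x) seg∈
        with r , r<k , refl ← ∈-applyUpTo⁻ (λ i → h ⊕ (i • x)) g∈seg = h , r , h∈ , r<k , refl

      private
        regroup : ∀ a b c d → (a ⊕ c) ⊕ (b ⊕ d) ≡ (a ⊕ b) ⊕ (c ⊕ d)
        regroup a b c d = interchange a c b d

        combine : ∀ a b i j → (a ⊕ (i • x)) ⊕ (b ⊕ (j • x)) ≡ (a ⊕ b) ⊕ ((i + j) • x)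
        combine a b i j = trans (regroup a b _ _) (cong ((a ⊕ b) ⊕_) (sym (•-+ x i j)))

        reduce : ∀ {g} h s → h ∈ L → g ≡ h ⊕ (s • x) → s < k + k → g ∈ extend k x L
        reduce h s h∈ refl s<2k with s <? k
        ... | yes s<k = ∈-extend⁺ s h∈ s<k
        ... | no  s≮k = subst (_∈ extend k x L) wrap
              (∈-extend⁺ (s ∸ k) (closed h∈ kx∈) (ℕ.+-cancelʳ-< k (s ∸ k) k (subst (_< k + k) (sym s∸k+k) s<2k)))
          where
          s∸k+k : s ∸ k + k ≡ s
          s∸k+k = ℕ.m∸n+n≡m (ℕ.≮⇒≥ s≮k)
          wrap : (h ⊕ (k • x)) ⊕ ((s ∸ k) • x) ≡ h ⊕ (s • x)
          wrap = trans (assoc h _ _) (cong (h ⊕_) (trans (sym (•-+ x k (s ∸ k))) (cong (_• x) (trans (ℕ.+-comm k (s ∸ k)) s∸k+k))))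

        extend-closed : ∀ {a b} → a ∈ extend k x L → b ∈ extend k x L → (a ⊕ b) ∈ extend k x L
        extend-closed a∈ b∈ with h , r , h∈ , r<k , refl ← ∈-extend⁻ a∈ with h′ , r′ , h′∈ , r′<k , refl ← ∈-extend⁻ b∈ =
          reduce (h ⊕ h′) (r + r′) (closed h∈ h′∈) (combine h h′ r r′) (ℕ.+-mono-< r<k r′<k)

        applyUpTo-Adj : ∀ (f : ℕ → N) {n} i → suc i < n → Adj (f i) (f (suc i)) (applyUpTo f n)
        applyUpTo-Adj f {suc (suc n)} zero    (s≤s (s≤s _)) = here
        applyUpTo-Adj f {suc n}       (suc i) (s≤s i<n)     = there (applyUpTo-Adj (f ∘ suc) i i<n)

        inside : ∀ {a} i → a ∈ L → suc i < k → Adj (a ⊕ (i • x)) (a ⊕ (suc i • x)) (extend k x L ∷ʳ 0ᴺ)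
        inside {a} i a∈ i<k = Adj-++ˡ (Adj-concat (∈-map⁺ (run k x) a∈) (applyUpTo-Adj (λ i → a ⊕ (i • x)) i i<k))

        run-Starts : ∀ a → Starts a (run k x a)
        run-Starts a = applyUpTo (λ i → a ⊕ (suc i • x)) (κ + κ) ,
          cong (_∷ applyUpTo (λ i → a ⊕ (suc i • x)) (κ + κ)) (identityʳ a)

        applyUpTo-Ends : ∀ (f : ℕ → N) n → Ends (f n) (applyUpTo f (suc n))
        applyUpTo-Ends f zero    = [] , refl
        applyUpTo-Ends f (suc n) = Ends-++ [ f 0 ] (applyUpTo-Ends (f ∘ suc) n)

        run-Ends : ∀ a → Ends (a ⊕ ((κ + κ) • x)) (run k x a)
        run-Ends a = applyUpTo-Ends (λ i → a ⊕ (i • x)) (κ + κ)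

        across : ∀ {a b} M c → Adj a b (M ∷ʳ c) → Adj (a ⊕ ((κ + κ) • x)) b (extend k x M ∷ʳ c)
        across []           c (there ())
        across (a ∷ [])     c here = Adj-join (run k x a ++ []) [ c ]
          (subst (Ends _) (sym (List.++-identityʳ (run k x a))) (run-Ends a)) ([] , refl)
        across (a ∷ [])     c (there (there ()))
        across (a ∷ b ∷ M)  c here = Adj-++ˡ (Adj-join (run k x a) _ (run-Ends a) (Starts-++ _ (run-Starts b)))
        across (a ∷ b ∷ M)  c (there p) = subst (Adj _ _) (sym (List.++-assoc (run k x a) (extend k x (b ∷ M)) [ c ]))
          (Adj-++ʳ (run k x a) (across (b ∷ M) c p))

        Sum : N → Set
        Sum g = ∃₂ λ a b → a ∈ extend k x L × b ∈ extend k x L × Adj a b (extend k x L ∷ʳ 0ᴺ) × (a ⊕ b) ≡ g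

        inside-sum : ∀ {a g} i → a ∈ L → suc i < k → (a ⊕ a) ⊕ ((i + suc i) • x) ≡ g → Sum g
        inside-sum {a} i a∈ i<k eq = _ , _ , ∈-extend⁺ i a∈ (ℕ.<-trans (ℕ.n<1+n i) i<k) , ∈-extend⁺ (suc i) a∈ i<k ,
          inside i a∈ i<k , trans (combine a a i (suc i)) eq

        -- Let the target be h + rx. For r = 2i + 1 it is the sum at positions i and i + 1 of the
        -- run of h/2. For r = 2`κ` it occurs at a junction of two runs. For smaller r = 2i, write
        -- rx = (r + k)x - kx: now r + k is odd, and kx, which lies in `L`, is absorbed into h.
        extend-sums : ∀ {g} → g ∈ extend k x L → Sum g
        extend-sums g∈ with h , r , h∈ , r<k , refl ← ∈-extend⁻ g∈ with parity r
        ... | i , inj₂ refl = inside-sum i (multiple∈ (suc ε) h∈) (ℕ.≤-<-trans (s≤s (ℕ.m≤m+n i i)) r<k)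
              (cong₂ _⊕_ (double-half h) (cong (_• x) (ℕ.+-suc i i)))
        ... | i , inj₁ refl with ℕ.<-cmp i κ
        ...   | tri> _ _ κ<i = contradiction (ℕ.+-mono-< κ<i κ<i) (ℕ.≤⇒≯ (ℕ.≤-pred r<k))
        ...   | tri≈ _ refl _ with a , b , a∈ , b∈ , adj , refl ← sums h∈ =
                a ⊕ ((κ + κ) • x) , b , ∈-extend⁺ (κ + κ) a∈ r<k ,
                subst (_∈ extend k x L) (identityʳ b) (∈-extend⁺ 0 b∈ (s≤s z≤n)) , across L 0ᴺ adj ,
                trans (assoc a _ b) (trans (cong (a ⊕_) (comm _ b)) (sym (assoc a b _)))
        ...   | tri< i<κ _ _ = inside-sum (i + κ) (multiple∈ (suc ε) (closed h∈ (multiple∈ (ε + ε) kx∈)))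
                  (s≤s (ℕ.+-monoˡ-< κ i<κ))
                  (trans (cong₂ _⊕_ (double-half _) (trans (cong (_• x) shift) (•-+ x k (i + i)))) cancel)
          where
          shift : (i + κ) + suc (i + κ) ≡ k + (i + i)
          shift = shift′ i κ
            where
            shift′ : ∀ i κ → (i + κ) + suc (i + κ) ≡ suc (κ + κ) + (i + i)
            shift′ = solve-∀
          cancel : (h ⊕ ((ε + ε) • (k • x))) ⊕ ((k • x) ⊕ ((i + i) • x)) ≡ h ⊕ ((i + i) • x)
          cancel = trans (assoc h _ _) (cong (h ⊕_) (trans (sym (assoc _ (k • x) _))
            (trans (cong (_⊕ ((i + i) • x)) (trans (comm _ (k • x)) (opposite (k • x)))) (identityˡ _))))

        difference : ∀ {a b} i d → a ∈ L → b ∈ L → a ⊕ (i • x) ≡ b ⊕ ((i + d) • x) → (d • x) ∈ L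
        difference {a} {b} i d a∈ b∈ eq = subst (_∈ L) solved (closed a∈ (multiple∈ (ε + ε) b∈))
          where
          a≡ : a ≡ b ⊕ (d • x)
          a≡ = ⊕-cancelʳ (i • x) _ _ (trans eq (trans (cong (b ⊕_) (trans (•-+ x i d) (comm _ _))) (sym (assoc b _ _))))
          solved : a ⊕ ((ε + ε) • b) ≡ d • x
          solved = trans (cong (_⊕ ((ε + ε) • b)) (trans a≡ (comm b (d • x)))) (trans (assoc _ b _)
            (trans (cong ((d • x) ⊕_) (opposite b)) (identityʳ _)))

        run-apart : ∀ {a b} i d → a ∈ L → b ∈ L → i + d < k → a ⊕ (i • x) ≡ b ⊕ ((i + d) • x) → d ≡ 0
        run-apart i zero    a∈ b∈ d<k eq = refl
        run-apart i (suc d) a∈ b∈ d<k eq =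
          contradiction (difference i (suc d) a∈ b∈ eq) (minimal (suc d) (s≤s z≤n) (ℕ.≤-<-trans (ℕ.m≤n+m (suc d) i) d<k))

      private
        ordered : ∀ {a b i j} → a ∈ L → b ∈ L → j < k → i ≤ j → a ⊕ (i • x) ≡ b ⊕ (j • x) → i ≡ j
        ordered {b = b} {i} {j} a∈ b∈ j<k i≤j eq = ℕ.≤-antisym i≤j (ℕ.m∸n≡0⇒m≤n
          (run-apart i (j ∸ i) a∈ b∈ (subst (_< k) split j<k) (trans eq (cong (λ l → b ⊕ (l • x)) split))))
          where
          split : j ≡ i + (j ∸ i)
          split = sym (ℕ.m+[n∸m]≡n i≤j)

      extend-coordinates : ∀ {a b i j} → a ∈ L → b ∈ L → i < k → j < k → a ⊕ (i • x) ≡ b ⊕ (j • x) → i ≡ j × a ≡ b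
      extend-coordinates {a} {b} {i} {j} a∈ b∈ i<k j<k eq =
        i≡j , ⊕-cancelʳ (i • x) a b (trans eq (cong (λ l → b ⊕ (l • x)) (sym i≡j)))
        where
        i≡j : i ≡ j
        i≡j with ℕ.≤-total i j
        ... | inj₁ i≤j = ordered a∈ b∈ j<k i≤j eq
        ... | inj₂ j≤i = sym (ordered b∈ a∈ i<k j≤i (sym eq))

      private
        extend-unique : ∀ M → (∀ {a} → a ∈ M → a ∈ L) → Unique M → Unique (extend k x M)
        extend-unique []      M⊆L _        = []
        extend-unique (a ∷ M) M⊆L (a∉ ∷ u) = Unique.++⁺
          (Unique.applyUpTo⁺₁ _ k λ i<j j<k eq → ℕ.<⇒≢ i<j (proj₁ (extend-coordinates a∈L a∈L (ℕ.<-trans i<j j<k) j<k eq)))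
          (extend-unique M (M⊆L ∘ there) u) disjoint
          where
          a∈L : a ∈ L
          a∈L = M⊆L (here refl)
          disjoint : ∀ {g} → ¬ (g ∈ run k x a × g ∈ extend k x M)
          disjoint (g∈a , g∈M) with seg , g∈seg , seg∈ ← ∈-concat⁻′ (map (run k x) M) g∈M
            with b , b∈ , refl ← ∈-map⁻ (run k x) seg∈
            with j , j<k , refl ← ∈-applyUpTo⁻ (λ i → b ⊕ (i • x)) g∈seg
            with i , i<k , eq ← ∈-applyUpTo⁻ (λ i → a ⊕ (i • x)) g∈a
            = All.lookup a∉ b∈ (sym (proj₂ (extend-coordinates (M⊆L (there b∈)) a∈L j<k i<k eq)))

      extend-harmonious : IsHarmonious (extend k x L)
      extend-harmonious = record
        { tail   = applyUpTo (λ i → 0ᴺ ⊕ (suc i • x)) (κ + κ) ++ extend k x tail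
        ; head   = trans (cong (extend k x) head) (cong (_∷ (applyUpTo (λ i → 0ᴺ ⊕ (suc i • x)) (κ + κ) ++ extend k x tail)) (identityʳ 0ᴺ))
        ; closed = extend-closed
        ; sums   = extend-sums
        ; unique = extend-unique L id unique }

    private
      record LeastMultiple (L : List N) (x : N) : Set where
        field
          k       : ℕ
          0<k     : 0 < k
          k•x∈    : (k • x) ∈ L
          minimal : ∀ j → 0 < j → j < k → (j • x) ∉ L

    module _ {L : List N} (H : IsHarmonious L) (x : N) where
      open IsHarmonious H

      private
        search : ∀ fuel k → k + fuel ≡ E → 0 < k → (∀ j → 0 < j → j < k → (j • x) ∉ L) → LeastMultiple L x
        search fuel k k+f≡E 0<k none with (k • x) ∈? L
        ... | yes k•x∈ = record { k = k ; 0<k = 0<k ; k•x∈ = k•x∈ ; minimal = none }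
        search zero k k+f≡E 0<k none | no k•x∉ = contradiction
          (subst (_∈ L) (sym (trans (cong (_• x) (trans (sym (ℕ.+-identityʳ k)) k+f≡E)) (exponent x))) zero∈) k•x∉
        search (suc fuel) k k+f≡E 0<k none | no k•x∉ =
          search fuel (suc k) (trans (sym (ℕ.+-suc k fuel)) k+f≡E) (s≤s z≤n) none′
          where
          none′ : ∀ j → 0 < j → j < suc k → (j • x) ∉ L
          none′ j 0<j j<1+k with ℕ.m<1+n⇒m<n∨m≡n j<1+k
          ... | inj₁ j<k  = none j 0<j j<k
          ... | inj₂ refl = k•x∉

        least : LeastMultiple L x
        least = search (ε + ε) 1 refl (s≤s z≤n) λ { (suc _) _ (s≤s ()) }

        -- Otherwise the remainder of `E` modulo `k` would give a smaller positive multiple of `x`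
        -- in `L`. As `E` is odd, the relative order is odd too, as the extension requires.
        k∣E : ∀ k .{{_ : NonZero k}} → (k • x) ∈ L → (∀ j → 0 < j → j < k → (j • x) ∉ L) → E ≡ (E DM./ k) * k
        k∣E k k•x∈ minimal with E DM.% k | DM.m≡m%n+[m/n]*n E k | DM.m%n<n E k
        ... | zero  | eq | _   = eq
        ... | suc r | eq | r<k = contradiction (subst (_∈ L) remainder (multiple∈ (ε + ε) quot∈)) (minimal (suc r) (s≤s z≤n) r<k)
          where
          q : ℕ
          q = E DM./ k
          quot∈ : ((q * k) • x) ∈ L
          quot∈ = subst (_∈ L) (•-assoc x q k) (multiple∈ q k•x∈)
          total : (suc r • x) ⊕ ((q * k) • x) ≡ 0ᴺ
          total = trans (sym (•-+ x (suc r) (q * k))) (trans (cong (_• x) (sym eq)) (exponent x))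
          remainder : (ε + ε) • ((q * k) • x) ≡ suc r • x
          remainder = ⊕-cancelˡ ((q * k) • x) _ _ (trans (opposite _) (sym (trans (comm _ _) total)))

        odd-order : ∃ λ κ → LeastMultiple.k least ≡ suc (κ + κ)
        odd-order with LeastMultiple.k least | LeastMultiple.0<k least | LeastMultiple.k•x∈ least | LeastMultiple.minimal least
        ... | k@(suc _) | _ | k•x∈ | minimal with parity k
        ...   | κ , inj₂ eq = κ , eq
        ...   | κ , inj₁ eq = contradiction (trans (sym (ℕ.*-distribˡ-+ (E DM./ k) κ κ))
                  (trans (cong ((E DM./ k) *_) (sym eq)) (sym (k∣E k k•x∈ minimal)))) (double≢odd ((E DM./ k) * κ) ε)

      adjoin : (S : N → Set) → (∀ {a b} → S a → S b → S (a ⊕ b)) → S 0ᴺ → (∀ {a} → a ∈ L → S a) → S x →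
        ∃ λ L′ → IsHarmonious L′ × (∀ {a} → a ∈ L → a ∈ L′) × x ∈ L′ × (∀ {a} → a ∈ L′ → S a)
      adjoin S S-⊕ S-0 L⊆S Sx with x ∈? L
      ... | yes x∈ = L , H , id , x∈ , L⊆S
      ... | no  x∉ with LeastMultiple.k least | LeastMultiple.k•x∈ least | LeastMultiple.minimal least | odd-order
      ...   | _ | k•x∈ | minimal | zero , refl = contradiction (subst (_∈ L) (identityʳ x) k•x∈) x∉
      ...   | _ | k•x∈ | minimal | κ@(suc _) , refl = extend (suc (κ + κ)) x L , extend-harmonious H x κ k•x∈ minimal ,
              (λ {a} a∈ → subst (_∈ extend (suc (κ + κ)) x L) (identityʳ a) (∈-extend⁺ H x κ k•x∈ minimal 0 a∈ (s≤s z≤n))) ,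
              subst (_∈ extend (suc (κ + κ)) x L) (trans (identityˡ _) (identityʳ x)) (∈-extend⁺ H x κ k•x∈ minimal 1 zero∈ (s≤s (s≤s z≤n))) , inside
        where
        S-• : ∀ j → S (j • x)
        S-• zero    = S-0
        S-• (suc j) = S-⊕ Sx (S-• j)
        inside : ∀ {a} → a ∈ extend (suc (κ + κ)) x L → S a
        inside a∈ with h , r , h∈ , _ , refl ← ∈-extend⁻ H x κ k•x∈ minimal a∈ = S-⊕ (L⊆S h∈) (S-• r)

    -- S is the predicate of a subgroup containing the list.
    subgroup : (S : N → Set) → (∀ {a b} → S a → S b → S (a ⊕ b)) → S 0ᴺ → (xs : List N) → (∀ {a} → a ∈ xs → S a) →
      ∃ λ L → IsHarmonious L × (∀ {a} → a ∈ xs → a ∈ L) × (∀ {a} → a ∈ L → S a)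
    subgroup S S-⊕ S-0 []       xs⊆S = [ 0ᴺ ] , trivial , (λ ()) , λ { (here refl) → S-0 }
    subgroup S S-⊕ S-0 (x ∷ xs) xs⊆S with L , H , xs⊆L , L⊆S ← subgroup S S-⊕ S-0 xs (xs⊆S ∘ there)
      with L′ , H′ , L⊆L′ , x∈ , L′⊆S ← adjoin H x S S-⊕ S-0 L⊆S (xs⊆S (here refl))
      = L′ , H′ , (λ { (here refl) → x∈ ; (there a∈) → L⊆L′ (xs⊆L a∈) }) , L′⊆S

-- The total length of the blocks

module Counting {X : Set} {n : ℕ} (X↔n : X ↔ Fin n) where
  open Inverse X↔n using (to; from; strictlyInverseˡ)
  private module X = Finite X↔n

  complete-length : ∀ {xs : List X} → Unique xs → (∀ x → x ∈ xs) → length xs ≡ n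
  complete-length {xs} unique complete = ℕ.≤-antisym
    (Fin.injective⇒≤ {f = to ∘ lookup xs} (lookup-injective unique _ _ ∘ X.to-injective))
    (Fin.injective⇒≤ {f = position ∘ from} (position-injective))
    where
    lookup-injective : ∀ {xs : List X} → Unique xs → ∀ i j → lookup xs i ≡ lookup xs j → i ≡ j
    lookup-injective (_ ∷ _)  zero    zero    _  = refl
    lookup-injective (x∉ ∷ _) zero    (suc j) eq = contradiction eq (All.lookup x∉ (∈-lookup j))
    lookup-injective (x∉ ∷ _) (suc i) zero    eq = contradiction (sym eq) (All.lookup x∉ (∈-lookup i))
    lookup-injective (_ ∷ u)  (suc i) (suc j) eq = cong suc (lookup-injective u i j eq)
    position : X → Fin (length xs)
    position x = Any.index (complete x)
    position-injective : ∀ {i j} → position (from i) ≡ position (from j) → i ≡ j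
    position-injective {i} {j} eq = trans (sym (strictlyInverseˡ i)) (trans (cong to
      (trans (AnyP.lookup-index (complete (from i))) (trans (cong (lookup xs) eq) (sym (AnyP.lookup-index (complete (from j)))))))
      (strictlyInverseˡ j))

module _ {X : Set} where

  same-elements : ∀ {xs ys : List X} → Unique xs → Unique ys → (∀ x → x ∈ xs) → (∀ x → x ∈ ys) → xs ↭ ys
  same-elements uxs uys xs-complete ys-complete =
    ∼bag⇒↭ (unique∧set⇒bag uxs uys (mk⇔ (λ _ → ys-complete _) (λ _ → xs-complete _)))

  sum-map-+ : ∀ (f g : X → ℕ) xs → sum (map f xs) + sum (map g xs) ≡ sum (map (λ x → f x + g x) xs)
  sum-map-+ f g []       = refl
  sum-map-+ f g (x ∷ xs) = trans (interchange (f x) _ (g x) _) (cong ((f x + g x) +_) (sum-map-+ f g xs))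
    where
    interchange : ∀ a b c d → (a + b) + (c + d) ≡ (a + c) + (b + d)
    interchange = solve-∀

  sum-map-const : ∀ (f : X → ℕ) c xs → (∀ x → x ∈ xs → f x ≡ c) → sum (map f xs) ≡ length xs * c
  sum-map-const f c []       _  = refl
  sum-map-const f c (x ∷ xs) eq = cong₂ _+_ (eq x (here refl)) (sum-map-const f c xs (λ y y∈ → eq y (there y∈)))

module _ {N : Set} {_⊕_ : N → N → N} {0ᴺ : N} {⊖_ : N → N} (isAb : IsAbelianGroup _≡_ _⊕_ 0ᴺ ⊖_) where
  open Abelian isAb

  -- ℓ u + ℓ (- u) is constant away from 0, and the deficit at 0 is one.
  paired-sum : ∀ (ℓ : N → ℕ) w → suc (ℓ 0ᴺ) ≡ w → (∀ u → u ≢ 0ᴺ → ℓ u + ℓ (⊖ u) ≡ w + w) →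
    ∀ {xs} → Unique xs → (∀ u → u ∈ xs) → suc (sum (map ℓ xs)) ≡ length xs * w
  paired-sum ℓ w refl pairs {xs} unique complete = halve (suc (sum (map ℓ xs))) (length xs * w)
    (trans doubled (ℕ.*-distribˡ-+ (length xs) w w))
    where
    halve : ∀ a b → a + a ≡ b + b → a ≡ b
    halve zero zero _ = refl
    halve (suc a) (suc b) eq = cong suc (halve a b (ℕ.suc-injective (ℕ.suc-injective
      (trans (cong suc (sym (ℕ.+-suc a a))) (trans eq (cong suc (ℕ.+-suc b b)))))))

    -- Single blocks need not have length `w`: for ℤ₃ × ℤ₃ the two walks have lengths 10 and 8.
    -- Adding the sum over `u` to the sum over `⊖ u` makes every term except that of 0 constant.
    reflected : sum (map ℓ xs) ≡ sum (map (λ u → ℓ (⊖ u)) xs)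
    reflected = trans (sum-↭ (↭.map⁺ ℓ (same-elements unique (Unique.map⁺ ⊖-injective unique) complete
      (λ u → subst (_∈ map ⊖_ xs) (⊖-involutive u) (∈-map⁺ ⊖_ (complete (⊖ u))))))) (cong sum (sym (List.map-∘ xs)))

    total : N → ℕ
    total u = ℓ u + ℓ (⊖ u)

    punctured : ∀ {pre post : List N} → Unique (pre ++ 0ᴺ ∷ post) →
      suc (suc (sum (map total (pre ++ 0ᴺ ∷ post)))) ≡ length (pre ++ 0ᴺ ∷ post) * (w + w)
    punctured {pre} {post} u = begin
      2 + sum (map total (pre ++ 0ᴺ ∷ post))
        ≡⟨ cong (λ s → 2 + sum s) (List.map-++ total pre (0ᴺ ∷ post)) ⟩
      2 + sum (map total pre ++ map total (0ᴺ ∷ post))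
        ≡⟨ cong (2 +_) (sum-++ (map total pre) _) ⟩
      2 + (sum (map total pre) + (total 0ᴺ + sum (map total post)))
        ≡⟨ cong₂ (λ a b → 2 + (a + (total 0ᴺ + b)))
             (sum-map-const total (w + w) pre (λ v v∈ → pairs v (λ { refl → before pre u v∈ })))
             (sum-map-const total (w + w) post (λ v v∈ → pairs v (λ { refl → after pre u v∈ }))) ⟩
      2 + (length pre * (w + w) + (total 0ᴺ + length post * (w + w)))
        ≡⟨ cong (λ k → 2 + (length pre * (w + w) + ((ℓ 0ᴺ + k) + length post * (w + w)))) (cong ℓ ⊖-0) ⟩
      2 + (length pre * (w + w) + ((ℓ 0ᴺ + ℓ 0ᴺ) + length post * (w + w)))
        ≡⟨ collect (length pre) (ℓ 0ᴺ) (length post) ⟩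
      (length pre + suc (length post)) * (w + w)
        ≡⟨ cong (_* (w + w)) (sym (List.length-++ pre)) ⟩
      length (pre ++ 0ᴺ ∷ post) * (w + w) ∎
      where
      open ≡-Reasoning
      before : ∀ pre {post} → Unique (pre ++ 0ᴺ ∷ post) → 0ᴺ ∉ pre
      before (x ∷ pre) (x∉ ∷ _) (here refl) = All.lookup x∉ (∈-++⁺ʳ pre (here refl)) refl
      before (x ∷ pre) (_ ∷ u) (there m) = before pre u m
      after : ∀ pre {post} → Unique (pre ++ 0ᴺ ∷ post) → 0ᴺ ∉ post
      after [] (0∉ ∷ _) m = All.lookup 0∉ m refl
      after (x ∷ pre) (_ ∷ u) m = after pre u m
      collect : ∀ a c b → 2 + (a * (suc c + suc c) + ((c + c) + b * (suc c + suc c))) ≡ (a + suc b) * (suc c + suc c)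
      collect = solve-∀

    doubled : suc (sum (map ℓ xs)) + suc (sum (map ℓ xs)) ≡ length xs * (w + w)
    doubled with pre , post , refl ← ∈-∃++ (complete 0ᴺ) = trans (cong suc (ℕ.+-suc _ _))
      (trans (cong (λ s → suc (suc s)) (trans (cong (sum (map ℓ xs) +_) reflected) (sum-map-+ ℓ (λ u → ℓ (⊖ u)) xs)))
        (punctured unique))

-- Harmonious orders with prescribed positions

module Arranged {N : Set} {_⊕_ : N → N → N} {0ᴺ : N} {⊖_ : N → N} (isAb : IsAbelianGroup _≡_ _⊕_ 0ᴺ ⊖_) where
  open Abelian isAb

  record Arrangement (t t⁺ t₁ t₂ : N) : Set where
    field
      R₁ R₂ R₃ : List N
    order : List N
    order = t ∷ t⁺ ∷ R₁ ++ t₁ ∷ R₂ ++ t₂ ∷ R₃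
    Consecutive : N → N → Set
    Consecutive u u′ = Adj u u′ (t⁺ ∷ R₁ ∷ʳ t₁) ⊎ Adj u u′ (t₁ ∷ R₂ ∷ʳ t₂) ⊎ Adj u u′ (t₂ ∷ R₃ ∷ʳ t) ⊎ (u ≡ t × u′ ≡ t⁺)
    field
      complete : ∀ u → u ∈ order
      unique   : Unique order
      sums     : ∀ n → ∃₂ λ u u′ → Consecutive u u′ × (u ⊕ u′) ≡ n

  module _ (_≟_ : DecidableEquality N) (ε : ℕ) (exponent : ∀ a → suc (ε + ε) • a ≡ 0ᴺ) where
    open Harmonious isAb _≟_ ε

    -- Adjoining `y` before `x` makes the list begin with 0, x, 2x, ..., (p - 1)x, y. Translated by
    -- `t` it begins with `t`, `t⁺`, and `t₁` opens the second run. Since `t₂` is off the line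
    -- through `t` in direction `x` and differs from `t₁`, it comes later. Translation adds `t ⊕ t`
    -- to every sum, so the sums still exhaust the group.
    module _ {L₀ : List N} (H : IsHarmonious (0ᴺ ∷ L₀)) (κ′ : ℕ) (t t⁺ t₁ t₂ x y : N)
      (x≡ : t⁺ ⊕ (⊖ t) ≡ x) (y≡ : t₁ ⊕ (⊖ t) ≡ y) where

      private
        κ p : ℕ
        -- A positive `κ` ensures that every run has a second element; in the runs of 0 these become
        -- `t⁺` and `t₁`.
        κ = suc κ′
        p = suc (κ + κ)

        L′ : List N
        L′ = extend exponent p y (0ᴺ ∷ L₀)

      module _ (py∈ : (p • y) ∈ (0ᴺ ∷ L₀)) (y-minimal : ∀ j → 0 < j → j < p → (j • y) ∉ (0ᴺ ∷ L₀))
        (px∈ : (p • x) ∈ L′) (x-minimal : ∀ j → 0 < j → j < p → (j • x) ∉ L′)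
        (full : ∀ u → u ∈ extend exponent p x L′) (t₂≢t₁ : t₂ ≢ t₁) (t₂∉ : ∀ i → t₂ ≢ t ⊕ (i • x)) where

        private
          module H″ = IsHarmonious (extend-harmonious exponent (extend-harmonious exponent H y κ py∈ y-minimal) x κ px∈ x-minimal)

          L″ X₀ X₁ : List N
          L″ = extend exponent p x L′
          X₀ = applyUpTo (λ i → (0ᴺ ⊕ 0ᴺ) ⊕ (suc (suc i) • x)) (κ′ + κ)
          X₁ = applyUpTo (λ i → (0ᴺ ⊕ (1 • y)) ⊕ (suc i • x)) (κ + κ) ++
                 extend exponent p x (applyUpTo (λ i → 0ᴺ ⊕ (suc (suc i) • y)) (κ′ + κ) ++ extend exponent p y L₀)

          τ : N → N
          τ = t ⊕_

          to-t : τ ((0ᴺ ⊕ 0ᴺ) ⊕ 0ᴺ) ≡ t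
          to-t = trans (cong τ (trans (identityʳ _) (identityʳ 0ᴺ))) (identityʳ t)

          recover : ∀ s → t ⊕ (s ⊕ (⊖ t)) ≡ s
          recover s = trans (comm t _) (trans (assoc s _ t) (trans (cong (s ⊕_) (inverseˡ t)) (identityʳ s)))

          to-t⁺ : τ ((0ᴺ ⊕ 0ᴺ) ⊕ (1 • x)) ≡ t⁺
          to-t⁺ = trans (cong τ (trans (cong (_⊕ (1 • x)) (identityʳ 0ᴺ)) (trans (identityˡ _) (identityʳ x)))) (trans (cong τ (sym x≡)) (recover t⁺))

          to-t₁ : τ ((0ᴺ ⊕ (1 • y)) ⊕ 0ᴺ) ≡ t₁
          to-t₁ = trans (cong τ (trans (identityʳ _) (trans (identityˡ _) (identityʳ y)))) (trans (cong τ (sym y≡)) (recover t₁))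

          map-shape : map τ L″ ≡ t ∷ t⁺ ∷ map τ X₀ ++ t₁ ∷ map τ X₁
          map-shape = cong₂ _∷_ to-t (cong₂ _∷_ to-t⁺ (trans (List.map-++ τ X₀ _) (cong (λ s → map τ X₀ ++ s ∷ map τ X₁) to-t₁)))

          map-complete : ∀ u → u ∈ map τ L″
          map-complete u = subst (_∈ map τ L″) (recover u) (∈-map⁺ τ (full (u ⊕ (⊖ t))))

          not-x : ∀ {z} i → z ≡ (0ᴺ ⊕ 0ᴺ) ⊕ (i • x) → t₂ ≢ τ z
          not-x i refl eq = t₂∉ i (trans eq (cong τ (trans (cong (_⊕ (i • x)) (identityʳ 0ᴺ)) (identityˡ _))))

          t₂∈ : t₂ ∈ map τ X₁
          t₂∈ with subst (t₂ ∈_) map-shape (map-complete t₂)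
          ... | here eq = contradiction (trans eq (sym to-t)) (not-x 0 refl)
          ... | there (here eq) = contradiction (trans eq (sym to-t⁺)) (not-x 1 refl)
          ... | there (there m) with ∈-++⁻ (map τ X₀) m
          ...   | inj₂ (here eq) = contradiction eq t₂≢t₁
          ...   | inj₂ (there m′) = m′
          ...   | inj₁ m′ with z , z∈ , eq ← ∈-map⁻ τ m′
                  with i , _ , eq′ ← ∈-applyUpTo⁻ (λ i → (0ᴺ ⊕ 0ᴺ) ⊕ (suc (suc i) • x)) z∈ =
                  contradiction eq (not-x (suc (suc i)) eq′)

        arrangement : Arrangement t t⁺ t₁ t₂
        arrangement with S₂ , S₃ , eq ← ∈-∃++ t₂∈ = record
          { R₁ = map τ X₀ ; R₂ = S₂ ; R₃ = S₃
          ; complete = λ u → subst (u ∈_) (shape eq) (map-complete u)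
          ; unique = subst Unique (shape eq) (Unique.map⁺ (⊕-cancelˡ t _ _) H″.unique)
          ; sums = λ n → sums eq n }
          where
          shape : ∀ {S₂ S₃} → map τ X₁ ≡ S₂ ++ [ t₂ ] ++ S₃ → map τ L″ ≡ t ∷ t⁺ ∷ map τ X₀ ++ t₁ ∷ S₂ ++ t₂ ∷ S₃
          shape eq = trans map-shape (cong (λ S → t ∷ t⁺ ∷ map τ X₀ ++ t₁ ∷ S) eq)

          consecutive : ∀ {S₂ S₃ u u′} → Adj u u′ ((t ∷ t⁺ ∷ map τ X₀ ++ t₁ ∷ S₂ ++ t₂ ∷ S₃) ∷ʳ t) →
            Adj u u′ (t⁺ ∷ map τ X₀ ∷ʳ t₁) ⊎ Adj u u′ (t₁ ∷ S₂ ∷ʳ t₂) ⊎ Adj u u′ (t₂ ∷ S₃ ∷ʳ t) ⊎ (u ≡ t × u′ ≡ t⁺)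
          consecutive here = inj₂ (inj₂ (inj₂ (refl , refl)))
          consecutive {S₂} {S₃} (there p) with Adj-through (t⁺ ∷ map τ X₀) (subst (Adj _ _) (List.++-assoc (t⁺ ∷ map τ X₀) _ [ t ]) p)
          ... | inj₁ q = inj₁ q
          ... | inj₂ q with Adj-through (t₁ ∷ S₂) (subst (Adj _ _) (List.++-assoc (t₁ ∷ S₂) _ [ t ]) q)
          ...   | inj₁ r = inj₂ (inj₁ r)
          ...   | inj₂ r = inj₂ (inj₂ (inj₁ r))

          sums : ∀ {S₂ S₃} → map τ X₁ ≡ S₂ ++ [ t₂ ] ++ S₃ → ∀ n → ∃₂ λ u u′ →
            (Adj u u′ (t⁺ ∷ map τ X₀ ∷ʳ t₁) ⊎ Adj u u′ (t₁ ∷ S₂ ∷ʳ t₂) ⊎ Adj u u′ (t₂ ∷ S₃ ∷ʳ t) ⊎ (u ≡ t × u′ ≡ t⁺)) × (u ⊕ u′) ≡ n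
          sums eq n with a , b , _ , _ , adj , a⊕b ← H″.sums (full (n ⊕ (⊖ (t ⊕ t)))) =
            τ a , τ b , consecutive (subst (Adj (τ a) (τ b)) (trans (List.map-++ τ L″ [ 0ᴺ ]) (cong₂ _++_ (shape eq) (cong [_] (identityʳ t)))) (Adj-map τ adj)) ,
            trans (interchange t a t b) (trans (cong ((t ⊕ t) ⊕_) a⊕b)
              (trans (comm _ _) (trans (assoc n _ _) (trans (cong (n ⊕_) (inverseˡ _)) (identityʳ n)))))

-- Residues and iterated maps

module Residues (n : ℕ) .{{_ : NonZero n}} where
  open Zmod n hiding (_-ₙ_)

  red : ℕ → Fin n
  red k = k mod n

  toℕ-red : ∀ k → toℕ (red k) ≡ k % n
  toℕ-red k = Fin.toℕ-fromℕ< (DM.m%n<n k n)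

  red-cong : ∀ {j k} → j % n ≡ k % n → red j ≡ red k
  red-cong {j} {k} eq = Fin.toℕ-injective (trans (toℕ-red j) (trans eq (sym (toℕ-red k))))

  red-toℕ : ∀ i → red (toℕ i) ≡ i
  red-toℕ i = Fin.toℕ-injective (trans (toℕ-red (toℕ i)) (DM.m<n⇒m%n≡m (Fin.toℕ<n i)))

  red-+ : ∀ j k → red j +ₙ red k ≡ red (j + k)
  red-+ j k = red-cong (trans (cong₂ (λ a b → (a + b) % n) (toℕ-red j) (toℕ-red k)) (sym (DM.%-distribˡ-+ j k n)))

  red-* : ∀ j k → red j *ₙ red k ≡ red (j * k)
  red-* j k = red-cong (trans (cong₂ (λ a b → (a * b) % n) (toℕ-red j) (toℕ-red k)) (sym (DM.%-distribˡ-* j k n)))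

  red-n : red n ≡ 0ₙ
  red-n = red-cong (trans (DM.n%n≡0 n) (sym (DM.m*n%n≡0 0 n)))

  +ₙ-comm : ∀ i j → i +ₙ j ≡ j +ₙ i
  +ₙ-comm i j = cong red (ℕ.+-comm (toℕ i) (toℕ j))

  +ₙ-assoc : ∀ i j k → (i +ₙ j) +ₙ k ≡ i +ₙ (j +ₙ k)
  +ₙ-assoc i j k = trans (cong (red (toℕ i + toℕ j) +ₙ_) (sym (red-toℕ k))) (trans (red-+ _ _)
    (trans (cong red (ℕ.+-assoc (toℕ i) _ _)) (trans (sym (red-+ _ _)) (cong (_+ₙ red (toℕ j + toℕ k)) (red-toℕ i)))))

  +ₙ-identityˡ : ∀ i → 0ₙ +ₙ i ≡ i
  +ₙ-identityˡ i = trans (cong (red 0 +ₙ_) (sym (red-toℕ i))) (trans (red-+ 0 (toℕ i)) (red-toℕ i))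

  +ₙ-inverseʳ : ∀ i → i +ₙ (-ₙ i) ≡ 0ₙ
  +ₙ-inverseʳ i = trans (cong (_+ₙ red (n ∸ toℕ i)) (sym (red-toℕ i))) (trans (red-+ (toℕ i) (n ∸ toℕ i))
    (trans (cong red (ℕ.m+[n∸m]≡n (ℕ.<⇒≤ (Fin.toℕ<n i)))) red-n))

  isAbelianGroup : IsAbelianGroup _≡_ _+ₙ_ 0ₙ -ₙ_
  isAbelianGroup = record
    { isGroup = record
      { isMonoid = record
        { isSemigroup = record
          { isMagma = record { isEquivalence = isEquivalence ; ∙-cong = cong₂ _+ₙ_ }
          ; assoc = +ₙ-assoc }
        ; identity = +ₙ-identityˡ , λ i → trans (+ₙ-comm i 0ₙ) (+ₙ-identityˡ i) }
      ; inverse = (λ i → trans (+ₙ-comm (-ₙ i) i) (+ₙ-inverseʳ i)) , +ₙ-inverseʳ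
      ; ⁻¹-cong = cong -ₙ_ }
    ; comm = +ₙ-comm }

  open Abelian isAbelianGroup using (_•_; •-+)

  •-red : ∀ j k → j • red k ≡ red (j * k)
  •-red zero    k = refl
  •-red (suc j) k = trans (cong (red k +ₙ_) (•-red j k)) (red-+ k (j * k))

iter-+ : ∀ {X : Set} (f : X → X) j k x → iter j f (iter k f x) ≡ iter (j + k) f x
iter-+ f zero    k x = refl
iter-+ f (suc j) k x = cong f (iter-+ f j k x)

iter-fixed : ∀ {X : Set} (f : X → X) {q} → (∀ x → iter q f x ≡ x) → ∀ k x → iter (k * q) f x ≡ x
iter-fixed f {q} period zero    x = refl
iter-fixed f {q} period (suc k) x = trans (sym (iter-+ f q (k * q) x)) (trans (period _) (iter-fixed f period k x))

iter-% : ∀ {X : Set} (f : X → X) {q} .{{_ : NonZero q}} → (∀ x → iter q f x ≡ x) → ∀ k x → iter (k % q) f x ≡ iter k f x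
iter-% f {q} period k x = trans (sym (cong (iter (k % q) f) (iter-fixed f period (k DM./ q) x)))
  (trans (iter-+ f (k % q) _ x) (cong (λ j → iter j f x) (sym (DM.m≡m%n+[m/n]*n k q))))

-- The group as an extension of `Q` by `N`

module Quotient (q m : ℕ) .{{_ : NonZero q}} .{{_ : NonZero m}} (act : ℕ → Fin m → Fin m) where
  open Zmod q using () renaming (_+ₙ_ to _+q_; 0ₙ to 0q)
  open Zmod m using () renaming (_+ₙ_ to _+m_; 0ₙ to 0m)

  Q : Set
  Q = Fin q × Fin m

  deg : Q → ℕ
  deg g = toℕ (proj₁ g)

  _∗_ : Q → Q → Q
  (u , c) ∗ (u′ , c′) = (u +q u′) , (act (toℕ u′) c +m c′)

  1Q : Q
  1Q = 0q , 0m

-- The semidirect product with A = ℤₘ × N, where α acts on ℤₘ through act and on N through a.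
module Extension (q m : ℕ) .{{_ : NonZero q}} .{{_ : NonZero m}} (act : ℕ → Fin m → Fin m)
  {N : Set} {_⊕_ : N → N → N} {0ᴺ : N} {⊖_ : N → N} (isAb : IsAbelianGroup _≡_ _⊕_ 0ᴺ ⊖_)
  (a : N → N) (a-⊕ : ∀ x y → a (x ⊕ y) ≡ a x ⊕ a y) (a-period : ∀ x → iter q a x ≡ x) where

  open Abelian isAb public
  open Zmod q public using () renaming (_+ₙ_ to _+q_; 0ₙ to 0q)
  open Zmod m public using () renaming (_+ₙ_ to _+m_; 0ₙ to 0m)
  private
    module Rq = Residues q
    module Rm = Residues m
    module Aq = Abelian Rq.isAbelianGroup
    module Am = Abelian Rm.isAbelianGroup

  open Quotient q m act public

  Γ : Set
  Γ = Q × N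

  _·_ : Γ → Γ → Γ
  (g , n) · (h , n′) = (g ∗ h) , (iter (deg h) a n ⊕ n′)

  1Γ : Γ
  1Γ = 1Q , 0ᴺ

  a^_ : ℕ → N → N
  (a^ k) n = iter k a n

  a^-⊕ : ∀ k x y → (a^ k) (x ⊕ y) ≡ (a^ k) x ⊕ (a^ k) y
  a^-⊕ zero    x y = refl
  a^-⊕ (suc k) x y = trans (cong a (a^-⊕ k x y)) (a-⊕ _ _)

  hom-0 : ∀ {f : N → N} → (∀ x y → f (x ⊕ y) ≡ f x ⊕ f y) → f 0ᴺ ≡ 0ᴺ
  hom-0 {f} f-⊕ = ⊕-cancelˡ (f 0ᴺ) _ _ (trans (sym (f-⊕ 0ᴺ 0ᴺ)) (trans (cong f (identityˡ 0ᴺ)) (sym (identityʳ _))))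

  hom-⊖ : ∀ {f : N → N} → (∀ x y → f (x ⊕ y) ≡ f x ⊕ f y) → ∀ x → f (⊖ x) ≡ ⊖ f x
  hom-⊖ {f} f-⊕ x = ⊖-unique (f x) (f (⊖ x)) (trans (sym (f-⊕ x (⊖ x))) (trans (cong f (inverseʳ x)) (hom-0 f-⊕)))

  quotient : Γ → Γ → Γ
  quotient ((u , c) , n) ((u′ , c′) , n′) =
    let d = u′ +q Zmod.-ₙ_ q u in
    (d , (c′ +m Zmod.-ₙ_ m (act (toℕ d) c))) , (n′ ⊕ (⊖ (a^ (toℕ d)) n))

  ·-quotient : ∀ x y → x · quotient x y ≡ y
  ·-quotient ((u , c) , n) ((u′ , c′) , n′) = cong₂ _,_ (cong₂ _,_ (restore Rq.isAbelianGroup u u′) (restore Rm.isAbelianGroup _ c′)) (restore isAb _ n′)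
    where
    restore : ∀ {M : Set} {_+ᴹ_ : M → M → M} {0# : M} {neg : M → M} (isM : IsAbelianGroup _≡_ _+ᴹ_ 0# neg) →
      ∀ x y → x +ᴹ (y +ᴹ neg x) ≡ y
    restore {_+ᴹ_ = _+ᴹ_} isM x y = trans (comm′ x _) (trans (assoc′ y _ x) (trans (cong (y +ᴹ_) (inverse′ x)) (identity′ y)))
      where open Abelian isM renaming (comm to comm′; assoc to assoc′; inverseˡ to inverse′; identityʳ to identity′) using ()

  ·-cancelˡ : ∀ x {y z} → x · y ≡ x · z → y ≡ z
  ·-cancelˡ ((u , c) , n) {(v , d) , k} {(v′ , d′) , k′} eq
    with refl ← Aq.⊕-cancelˡ u v v′ (cong (proj₁ ∘ proj₁) eq)
    with refl ← Am.⊕-cancelˡ (act (toℕ v) c) d d′ (cong (proj₂ ∘ proj₁) eq)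
    with refl ← ⊕-cancelˡ ((a^ (toℕ v)) n) k k′ (cong proj₂ eq) = refl

  -- The quotient of two points (g , aᵍ τ) and (g′ , aᵍ′ τ′) is aᵍ′ (τ′ - τ).
  pt : Q → N → Γ
  pt g τ = g , (a^ (deg g)) τ

  a^-∗ : ∀ g δ n → (a^ (deg δ)) ((a^ (deg g)) n) ≡ (a^ (deg (g ∗ δ))) n
  a^-∗ g δ n = trans (iter-+ a (deg δ) (deg g) n) (trans (cong (λ k → (a^ k) n) (ℕ.+-comm (deg δ) (deg g)))
    (trans (sym (iter-% a a-period (deg g + deg δ) n)) (cong (λ k → (a^ k) n) (sym (Rq.toℕ-red _)))))

  pt-step : ∀ {g δ g′ τ τ′ v} → g ∗ δ ≡ g′ → (a^ (deg g′)) (τ′ ⊕ (⊖ τ)) ≡ v → pt g τ · (δ , v) ≡ pt g′ τ′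
  pt-step {g} {δ} {τ = τ} {τ′} refl refl = cong (g ∗ δ ,_)
    (trans (cong (_⊕ (a^ (deg (g ∗ δ))) (τ′ ⊕ (⊖ τ))) (a^-∗ g δ τ)) (trans (sym (a^-⊕ (deg (g ∗ δ)) _ _)) (cong (a^ (deg (g ∗ δ)))
      (trans (comm τ _) (trans (assoc τ′ _ τ) (trans (cong (τ′ ⊕_) (inverseˡ τ)) (identityʳ τ′)))))))

  module Assembly {ν : ℕ} (N↔ν : N ↔ Fin ν) (B : N → List Γ) (first last : N → Γ) (z : Γ)
    (starts : ∀ u → Starts (first u) (B u)) (ends : ∀ u → Ends (last u) (B u))
    (t t⁺ t₁ t₂ : N) (arr : Arranged.Arrangement isAb t t⁺ t₁ t₂)
    {α₁ ω₁ α₂ ω₂ : List Γ} {a₁ o₁ a₂ o₂ : Γ}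
    (split₁ : B t₁ ≡ α₁ ++ ω₁) (split₂ : B t₂ ≡ α₂ ++ ω₂)
    (ends₁ : Ends a₁ α₁) (starts₁ : Starts o₁ ω₁) (ends₂ : Ends a₂ α₂) (starts₂ : Starts o₂ ω₂)
    (cut₁-step : ∀ d → (a₁ · d) ≡ o₁ → (a₂ · d) ≡ first t⁺)
    (cut₂-step : ∀ d → (a₂ · d) ≡ o₂ → (last t · d) ≡ z)
    (cut₃-step : ∀ d → (last t · d) ≡ first t⁺ → (z · d) ≡ o₁)
    (cover : ∀ g → g ≡ z ⊎ ∃ λ u → g ∈ B u)
    (differences : ∀ d → d ≢ 1Γ → (∃ λ u → ∃₂ λ a b → Adj a b (B u) × (a · d) ≡ b) ⊎
                                  (∃ λ n → ∀ u u′ → (u ⊕ u′) ≡ n → (last u · d) ≡ first u′))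
    (size₀ : suc (length (B 0ᴺ)) ≡ q * m)
    (sizes : ∀ u → u ≢ 0ᴺ → length (B u) + length (B (⊖ u)) ≡ q * m + q * m) where

    open Arranged.Arrangement arr using (R₁; R₂; R₃; complete; unique; sums)
    private
      module S = Splice _·_ _⊕_ 1Γ z B first last starts ends t t⁺ t₁ t₂ R₁ R₂ R₃
        split₁ split₂ ends₁ starts₁ ends₂ starts₂ cut₁-step cut₂-step cut₃-step

      Γ↔ : Γ ↔ Fin (q * m * ν)
      Γ↔ = ↔-sym Fin.*↔× ↔-∘ (↔-sym Fin.*↔× ×-↔ N↔ν)

      size : length S.path ≡ q * m * ν
      size = trans S.path-length (trans (paired-sum isAb (length ∘ B) (q * m) size₀ sizes unique complete)
        (trans (cong (_* (q * m)) (Counting.complete-length N↔ν unique complete)) (ℕ.*-comm ν (q * m))))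

    sequenceable : Sequenceable Γ _·_ 1Γ
    sequenceable = Criterion.sequenceable _·_ 1Γ Γ↔ quotient ·-quotient ·-cancelˡ S.path size
      (S.path-covers complete cover) (S.path-steps complete sums differences)

-- Bijective combinations of powers of `a`, and half systems of `N`

record Setup (q m : ℕ) .{{_ : NonZero q}} .{{_ : NonZero m}} (act : ℕ → Fin m → Fin m) : Set₁ where
  field
    N        : Set
    _⊕_      : N → N → N
    0ᴺ       : N
    ⊖_       : N → N
    isAb     : IsAbelianGroup _≡_ _⊕_ 0ᴺ ⊖_
    ν        : ℕ
    N↔ν      : N ↔ Fin ν
    a        : N → N
    a-⊕      : ∀ x y → a (x ⊕ y) ≡ a x ⊕ a y
    a-period : ∀ x → iter q a x ≡ x
    ρ        : ℕ
    q-odd    : q ≡ suc (ρ + ρ)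
    2-free   : ∀ x → x ⊕ x ≡ 0ᴺ → x ≡ 0ᴺ
    3-free   : ∀ x → x ⊕ (x ⊕ x) ≡ 0ᴺ → x ≡ 0ᴺ

data Side : Set where
  centre left right : Side

module Units {q m : ℕ} .{{_ : NonZero q}} .{{_ : NonZero m}} {act : ℕ → Fin m → Fin m} (S : Setup q m act) where
  open Setup S public
  open Extension q m act isAb a a-⊕ a-period public
  open Finite N↔ν public using (_≟_)

  Onto : (N → N) → Set
  Onto f = ∀ v → ∃ λ t → f t ≡ v

  onto : ∀ {f} → (∀ x y → f (x ⊕ y) ≡ f x ⊕ f y) → (∀ x → f x ≡ 0ᴺ → x ≡ 0ᴺ) → Onto f
  onto {f} f-⊕ kernel = Finite.endo-surjective N↔ν f λ {x} {y} eq →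
    ⊕-cancelʳ (⊖ y) x y (trans (kernel (x ⊕ (⊖ y)) (trans (f-⊕ x (⊖ y)) (trans (cong₂ _⊕_ eq (hom-⊖ f-⊕ y)) (inverseʳ (f y))))) (sym (inverseʳ y)))

  negate : ∀ {f} → Onto f → Onto (⊖_ ∘ f)
  negate surj v with t , eq ← surj (⊖ v) = t , trans (cong ⊖_ eq) (⊖-involutive v)

  double-onto : Onto (λ t → t ⊕ t)
  double-onto = onto (λ x y → interchange x y x y) 2-free

  triple-onto : Onto (λ t → t ⊕ (t ⊕ t))
  triple-onto = onto (λ x y → trans (cong ((x ⊕ y) ⊕_) (interchange x y x y)) (interchange x y _ _)) 3-free

  iter-neg : ∀ {b u} → (∀ v → b (⊖ v) ≡ ⊖ b v) → b u ≡ ⊖ u → ∀ j → iter (j + j) b u ≡ u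
  iter-neg b-⊖ eq zero = refl
  iter-neg {b} {u} b-⊖ eq (suc j) = trans (cong (λ k → b (iter k b u)) (ℕ.+-suc j j))
    (trans (cong (b ∘ b) (iter-neg b-⊖ eq j)) (trans (cong b eq) (trans (b-⊖ u) (trans (cong ⊖_ eq) (⊖-involutive u)))))

  iter-iter : ∀ {X : Set} (f : X → X) j k x → iter j (iter k f) x ≡ iter (j * k) f x
  iter-iter f zero    k x = refl
  iter-iter f (suc j) k x = trans (cong (iter k f) (iter-iter f j k x)) (iter-+ f k (j * k) x)

  -- From aᵏ u = - u and the oddness of q, u = (aᵏ)^q u = - u.
  shift-kernel : ∀ k u → u ⊕ (a^ k) u ≡ 0ᴺ → u ≡ 0ᴺ
  shift-kernel k u eq = 2-free u (trans (cong (u ⊕_) u≡⊖u) (inverseʳ u))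
    where
    bu : (a^ k) u ≡ ⊖ u
    bu = ⊖-unique u _ eq
    u≡⊖u : u ≡ ⊖ u
    u≡⊖u = trans (sym (iter-fixed a a-period k u)) (trans (cong (λ j → iter j a u) (ℕ.*-comm k q))
      (trans (sym (iter-iter a q k u)) (trans (cong (λ j → iter j (a^ k) u) q-odd)
        (trans (cong (a^ k) (iter-neg (hom-⊖ (a^-⊕ k)) bu ρ)) bu))))

  shift-onto : ∀ k → Onto (λ t → t ⊕ (a^ k) t)
  shift-onto k = onto (λ x y → trans (cong ((x ⊕ y) ⊕_) (a^-⊕ k x y)) (interchange x y _ _)) (shift-kernel k)

  -- The witness applies the k-th power of `a` another q - 1 = 2`ρ` times.
  a^-onto : ∀ k → Onto (a^ k)
  a^-onto k v = (a^ (k * ρ + k * ρ)) v , trans (iter-+ a k _ v) (trans (cong (λ j → iter j a v) eq) (iter-fixed a a-period k v))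
    where
    eq : k + (k * ρ + k * ρ) ≡ k * q
    eq = trans (cong (k +_) (sym (ℕ.*-distribˡ-+ k ρ ρ))) (trans (sym (ℕ.*-suc k (ρ + ρ))) (cong (k *_) (sym q-odd)))

  compose-onto : ∀ {f g} → Onto f → Onto g → Onto (f ∘ g)
  compose-onto {f} f-onto g-onto v with s , refl ← f-onto v with t , refl ← g-onto s = t , refl

  ⊖-0≢ : ∀ {u} → u ≢ 0ᴺ → ⊖ u ≢ 0ᴺ
  ⊖-0≢ {u} u≢0 eq = u≢0 (⊖-injective (trans eq (sym ⊖-0)))

  ⊖-distinct : ∀ {u} → u ≢ 0ᴺ → u ≢ ⊖ u
  ⊖-distinct {u} u≢0 eq = u≢0 (2-free u (trans (cong (u ⊕_) eq) (inverseʳ u)))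

  -- Both cuts inside blocks are made in blocks of the left kind, so `t₁` and `t₂` must lie in the
  -- same half; this is possible because they are not opposite. Of two opposite elements the one
  -- with the smaller `key` goes left, and `t₁`, `t₂` have the two smallest keys.
  module HalfSystem (t₁ t₂ : N) (t₁≢0 : t₁ ≢ 0ᴺ) (t₂≢0 : t₂ ≢ 0ᴺ) (⊖t₂≢t₁ : ⊖ t₂ ≢ t₁) where

    private
      key : N → ℕ
      key u with u ≟ t₁ | u ≟ t₂
      ... | yes _ | _     = 0
      ... | no  _ | yes _ = 1
      ... | no  _ | no  _ = 2 + toℕ (Inverse.to N↔ν u)

      key-injective : ∀ u v → key u ≡ key v → u ≡ v
      key-injective u v eq with u ≟ t₁ | u ≟ t₂ | v ≟ t₁ | v ≟ t₂
      ... | yes p | _     | yes q | _     = trans p (sym q)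
      ... | no  _ | yes p | no  _ | yes q = trans p (sym q)
      ... | no  _ | no  _ | no  _ | no  _ = Finite.to-injective N↔ν (Fin.toℕ-injective (ℕ.suc-injective (ℕ.suc-injective eq)))
      key-injective u v () | yes _ | _     | no _  | yes _
      key-injective u v () | yes _ | _     | no _  | no _
      key-injective u v () | no _  | yes _ | yes _ | _
      key-injective u v () | no _  | no _  | yes _ | _
      key-injective u v () | no _  | yes _ | no _  | no _
      key-injective u v () | no _  | no _  | no _  | yes _

    side : N → Side
    side u with u ≟ 0ᴺ | key u <? key (⊖ u)
    ... | yes _ | _     = centre
    ... | no  _ | yes _ = left
    ... | no  _ | no  _ = right

    side-0 : side 0ᴺ ≡ centre
    side-0 with 0ᴺ ≟ 0ᴺ | key 0ᴺ <? key (⊖ 0ᴺ)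
    ... | yes _ | _ = refl
    ... | no ne | _ = contradiction refl ne

    private
      side-left : ∀ {u} → u ≢ 0ᴺ → key u < key (⊖ u) → side u ≡ left
      side-left {u} u≢0 lt with u ≟ 0ᴺ | key u <? key (⊖ u)
      ... | yes eq | _      = contradiction eq u≢0
      ... | no  _  | yes _  = refl
      ... | no  _  | no  ge = contradiction lt ge

      side-right : ∀ {u} → u ≢ 0ᴺ → ¬ (key u < key (⊖ u)) → side u ≡ right
      side-right {u} u≢0 ge with u ≟ 0ᴺ | key u <? key (⊖ u)
      ... | yes eq | _      = contradiction eq u≢0
      ... | no  _  | yes lt = contradiction lt ge
      ... | no  _  | no  _  = refl

    side-opposite : ∀ u → u ≢ 0ᴺ → (side u ≡ left × side (⊖ u) ≡ right) ⊎ (side u ≡ right × side (⊖ u) ≡ left)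
    side-opposite u u≢0 with ℕ.<-cmp (key u) (key (⊖ u))
    ... | tri< lt _ ge = inj₁ (side-left u≢0 lt , side-right (⊖-0≢ u≢0) (subst (λ v → ¬ (key (⊖ u) < key v)) (sym (⊖-involutive u)) ge))
    ... | tri≈ _ eq _  = contradiction (key-injective _ _ eq) (⊖-distinct u≢0)
    ... | tri> ge _ gt = inj₂ (side-right u≢0 ge , side-left (⊖-0≢ u≢0) (subst (λ v → key (⊖ u) < key v) (sym (⊖-involutive u)) gt))

    side-t₁ : side t₁ ≡ left
    side-t₁ = side-left t₁≢0 key-t₁<
      where
      key-t₁< : key t₁ < key (⊖ t₁)
      key-t₁< with t₁ ≟ t₁ | t₁ ≟ t₂ | (⊖ t₁) ≟ t₁ | (⊖ t₁) ≟ t₂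
      ... | no ne | _ | _      | _     = contradiction refl ne
      ... | yes _ | _ | yes eq | _     = contradiction (sym eq) (⊖-distinct t₁≢0)
      ... | yes _ | _ | no _   | yes _ = s≤s z≤n
      ... | yes _ | _ | no _   | no _  = s≤s z≤n

    side-t₂ : side t₂ ≡ left
    side-t₂ = side-left t₂≢0 key-t₂<
      where
      key-t₂< : key t₂ < key (⊖ t₂)
      key-t₂< with t₂ ≟ t₁ | t₂ ≟ t₂ | (⊖ t₂) ≟ t₁ | (⊖ t₂) ≟ t₂
      ... | _     | no ne | _      | _      = contradiction refl ne
      ... | _     | yes _ | yes eq | _      = contradiction eq ⊖t₂≢t₁
      ... | _     | yes _ | no _   | yes eq = contradiction (sym eq) (⊖-distinct t₂≢0)
      ... | yes _ | yes _ | no _   | no _   = s≤s z≤n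
      ... | no _  | yes _ | no _   | no _   = s≤s (s≤s z≤n)

-- Blocks from an R*-sequencing

data Coefficient : Set where
  pos neg dbl nega : Coefficient

-- The N-part of a step is, up to a power of `a`, the difference of the two coefficients. The
-- allowed differences u + a u, u, - 3u, 2u, - 2u are bijective in u. The coefficient `dbl` corrects
-- the parity: the list of an R*-sequencing has |Q| - 3 elements, an even number, but both its first
-- and its last coefficient are negative.
data Allowed : Coefficient → Coefficient → Set where
  nega-pos : Allowed nega pos
  pos-dbl  : Allowed pos dbl
  dbl-neg  : Allowed dbl neg
  neg-pos  : Allowed neg pos
  pos-neg  : Allowed pos neg

-- An R*-sequencing of Q: the list V with x appended runs once through Q ∖ {1, c}, c commutes with x = c y⁻¹,
-- and its steps together with y and x⁻¹ are all non-identity elements.  Hence between x and y one may visit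
-- either c or 1 without changing the set of steps.  Besides h y = 1, i.e. the element before x is y⁻¹.
record RStar (q m : ℕ) .{{_ : NonZero q}} .{{_ : NonZero m}} (act : ℕ → Fin m → Fin m) : Set where
  open Quotient q m act
  field
    x y c h x⁻¹ : Q
    V         : List (Q × Coefficient)
    V-starts  : Starts (y , nega) V
    V-ends    : Ends (h , neg) V
    V-allowed : ∀ {s s′} → Adj s s′ V → Allowed (proj₂ s) (proj₂ s′)
    deg-x     : deg x ≡ 1
    deg-c     : deg c ≡ 1
    deg-y     : deg y ≡ 0
    deg-1     : deg 1Q ≡ 0
    x∗y       : x ∗ y ≡ c
    x∗x⁻¹     : x ∗ x⁻¹ ≡ 1Q
    c∗x⁻¹     : c ∗ x⁻¹ ≡ y
    h∗y       : h ∗ y ≡ 1Q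
    h∗c       : h ∗ c ≡ x
    1∗y       : 1Q ∗ y ≡ y
    1∗c       : 1Q ∗ c ≡ c
    x∗1       : x ∗ 1Q ≡ x
    c∗1       : c ∗ 1Q ≡ c
    1∗1       : 1Q ∗ 1Q ≡ 1Q
    covers    : ∀ g → g ≡ 1Q ⊎ g ≡ c ⊎ g ≡ x ⊎ ∃ λ k → (g , k) ∈ V
    steps     : ∀ δ → δ ≡ 1Q ⊎ δ ≡ y ⊎ δ ≡ x⁻¹ ⊎ δ ≡ c ⊎ ∃₂ λ s s′ → Adj s s′ V × proj₁ s ∗ δ ≡ proj₁ s′
    size      : 3 + length V ≡ q * m

module RStarSequencing {q m : ℕ} .{{_ : NonZero q}} .{{_ : NonZero m}} {act : ℕ → Fin m → Fin m}
  (S : Setup q m act) (R : RStar q m act) where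
  open Units S
  open RStar R

  ⟦_⟧ : Coefficient → N → N
  ⟦ pos  ⟧ u = u
  ⟦ neg  ⟧ u = ⊖ u
  ⟦ dbl  ⟧ u = u ⊕ u
  ⟦ nega ⟧ u = ⊖ a u

  a-onto : Onto a
  a-onto = a^-onto 1

  coefficient-onto : ∀ k → Onto ⟦ k ⟧
  coefficient-onto pos  v = v , refl
  coefficient-onto neg  v = ⊖ v , ⊖-involutive v
  coefficient-onto dbl  = double-onto
  coefficient-onto nega = negate a-onto

  allowed-onto : ∀ {k k′} → Allowed k k′ → Onto (λ u → ⟦ k′ ⟧ u ⊕ (⊖ ⟦ k ⟧ u))
  allowed-onto nega-pos v with t , eq ← shift-onto 1 v = t , trans (cong (t ⊕_) (⊖-involutive (a t))) eq
  allowed-onto pos-dbl  v = v , cancel-⊖ v v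
  allowed-onto dbl-neg  v with t , eq ← negate triple-onto v =
    t , trans (⊖-⊕ t (t ⊕ t)) eq
  allowed-onto neg-pos  v with t , eq ← double-onto v = t , trans (cong (t ⊕_) (⊖-involutive t)) eq
  allowed-onto pos-neg  v with t , eq ← negate double-onto v = t , trans (⊖-⊕ t t) eq

  module _ (t t⁺ t₁ t₂ : N) (t₁≢0 : t₁ ≢ 0ᴺ) (t₂≢0 : t₂ ≢ 0ᴺ) (⊖t₂≢t₁ : ⊖ t₂ ≢ t₁)
    -- One equation for each cut, from comparing N-parts over the steps `y`, 1 and `c`. The
    -- quotients lost there are (y , - 2a t₂), (1 , 2a t₁) and (c , a (t⁺ + t)).
    (t≡ : t ≡ ⊖ a (t₂ ⊕ t₂)) (t⁺≡ : t⁺ ≡ t₂ ⊕ (t₁ ⊕ t₁)) (t₁≡ : t₁ ≡ t⁺ ⊕ t)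
    (arr : Arranged.Arrangement isAb t t⁺ t₁ t₂) where
    open HalfSystem t₁ t₂ t₁≢0 t₂≢0 ⊖t₂≢t₁

    private
      -- The detours from `x` to `y` through c, c and through 1, 1 take the same quotients: the step
      -- `y` with - 2a u, the step 1 with 2a u and the step `x⁻¹` with - (u + a u). The factor `a`
      -- at 1 and in `nega` makes up for `c` having degree 1 while 1 and `y` have degree 0. For u =
      -- 0 the two visits would coincide, so `c` is visited once and (1 , 0) remains as the extra
      -- point.
      gap : Side → N → List Γ
      gap centre u = pt c u ∷ []
      gap left   u = pt c (⊖ u) ∷ pt c u ∷ []
      gap right  u = pt 1Q (⊖ a u) ∷ pt 1Q (a u) ∷ []

      value : N → Q × Coefficient → Γ
      value u (g , k) = pt g (⟦ k ⟧ u)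

      B : N → List Γ
      B u = pt x u ∷ gap (side u) u ++ map (value u) V

      first last : N → Γ
      first u = pt x u
      last  u = pt h (⊖ u)

      starts : ∀ u → Starts (first u) (B u)
      starts u = _ , refl

      map-Ends : ∀ {X Y : Set} (f : X → Y) {s xs} → Ends s xs → Ends (f s) (map f xs)
      map-Ends f (ys , refl) = map f ys , List.map-++ f ys _

      ends : ∀ u → Ends (last u) (B u)
      ends u = Ends-++ (pt x u ∷ gap (side u) u) (map-Ends (value u) V-ends)

      B≡ : ∀ {u s} → side u ≡ s → B u ≡ pt x u ∷ gap s u ++ map (value u) V
      B≡ {u} eq = cong (λ s → pt x u ∷ gap s u ++ map (value u) V) eq

      y-starts : ∀ u → Starts (pt y (⊖ a u)) (map (value u) V)
      y-starts u with V-starts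
      ... | rest , eq = map (value u) rest , cong (map (value u)) eq

      deg1 : ∀ {g} n → deg g ≡ 1 → (a^ (deg g)) n ≡ a n
      deg1 n eq = cong (λ k → (a^ k) n) eq

      deg0 : ∀ {g} n → deg g ≡ 0 → (a^ (deg g)) n ≡ n
      deg0 n eq = cong (λ k → (a^ k) n) eq

      split₁ : B t₁ ≡ (pt x t₁ ∷ pt c (⊖ t₁) ∷ []) ++ (pt c t₁ ∷ map (value t₁) V)
      split₁ = B≡ side-t₁

      split₂ : B t₂ ≡ (pt x t₂ ∷ []) ++ (pt c (⊖ t₂) ∷ pt c t₂ ∷ map (value t₂) V)
      split₂ = B≡ side-t₂

      -- The quotient of two points determines the step, so it may be replaced by its explicit value.
      transfer : ∀ {p p′ r r′ d} d₀ → p · d₀ ≡ p′ → r · d₀ ≡ r′ → p · d ≡ p′ → r · d ≡ r′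
      transfer {p} {r = r} d₀ eq eq′ eq″ = trans (cong (r ·_) (·-cancelˡ p (trans eq″ (sym eq)))) eq′

      two-⊖⊖ : ∀ u → u ⊕ (⊖ (⊖ u)) ≡ u ⊕ u
      two-⊖⊖ u = cong (u ⊕_) (⊖-involutive u)

      t⁺⊖t₂ : t⁺ ⊕ (⊖ t₂) ≡ t₁ ⊕ t₁
      t⁺⊖t₂ = trans (cong (_⊕ (⊖ t₂)) (trans t⁺≡ (comm t₂ _))) (cancel-⊖ _ t₂)

      cut₁-step : ∀ d → pt c (⊖ t₁) · d ≡ pt c t₁ → pt x t₂ · d ≡ pt x t⁺
      cut₁-step d = transfer (1Q , a (t₁ ⊕ t₁))
        (pt-step c∗1 (trans (deg1 {c} _ deg-c) (cong a (two-⊖⊖ t₁))))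
        (pt-step x∗1 (trans (deg1 {x} _ deg-x) (cong a t⁺⊖t₂)))

      cut₂-step : ∀ d → pt x t₂ · d ≡ pt c (⊖ t₂) → pt h (⊖ t) · d ≡ pt 1Q 0ᴺ
      cut₂-step d = transfer (y , a (⊖ (t₂ ⊕ t₂)))
        (pt-step x∗y (trans (deg1 {c} _ deg-c) (cong a (⊖-⊕ t₂ t₂))))
        (pt-step h∗y (trans (deg0 {1Q} _ deg-1) (trans (identityˡ _) (trans (⊖-involutive t) (trans t≡ (sym (hom-⊖ a-⊕ _)))))))

      cut₃-step : ∀ d → pt h (⊖ t) · d ≡ pt x t⁺ → pt 1Q 0ᴺ · d ≡ pt c t₁
      cut₃-step d = transfer (c , a t₁)
        (pt-step h∗c (trans (deg1 {x} _ deg-x) (cong a (trans (cong (t⁺ ⊕_) (⊖-involutive t)) (sym t₁≡)))))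
        (pt-step 1∗c (trans (deg1 {c} _ deg-c) (cong a (trans (cong (t₁ ⊕_) ⊖-0) (identityʳ t₁)))))

      data View (u : N) : Set where
        zeroᵛ  : u ≡ 0ᴺ → side u ≡ centre → View u
        leftᵛ  : side u ≡ left → side (⊖ u) ≡ right → View u
        rightᵛ : side u ≡ right → side (⊖ u) ≡ left → View u

      view : ∀ u → View u
      view u with u ≟ 0ᴺ
      ... | yes refl = zeroᵛ refl side-0
      ... | no  u≢0 with side-opposite u u≢0
      ...   | inj₁ (l , r) = leftᵛ l r
      ...   | inj₂ (r , l) = rightᵛ r l

      in-B : ∀ {u s g} → side u ≡ s → g ∈ pt x u ∷ gap s u ++ map (value u) V → g ∈ B u
      in-B {g = g} eq = subst (g ∈_) (sym (B≡ eq))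

      adj-B : ∀ {u s p p′} → side u ≡ s → Adj p p′ (pt x u ∷ gap s u ++ map (value u) V) → Adj p p′ (B u)
      adj-B {p = p} {p′} eq = subst (Adj p p′) (sym (B≡ eq))

      in-V : ∀ {u g} → g ∈ map (value u) V → g ∈ B u
      in-V {u} g∈ = there (∈-++⁺ʳ (gap (side u) u) g∈)

      cover : ∀ g → g ≡ pt 1Q 0ᴺ ⊎ ∃ λ u → g ∈ B u
      cover (g , n) with a^-onto (deg g) n
      ... | τ , refl with covers g
      ...   | inj₂ (inj₂ (inj₁ refl)) = inj₂ (τ , here refl)
      ...   | inj₂ (inj₂ (inj₂ (k , k∈))) with w , refl ← coefficient-onto k τ = inj₂ (w , in-V (∈-map⁺ (value w) k∈))
      cover (g , n) | τ , refl | inj₂ (inj₁ refl) with view τ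
      ... | zeroᵛ refl s = inj₂ (τ , in-B s (there (here refl)))
      ... | leftᵛ s _ = inj₂ (τ , in-B s (there (there (here refl))))
      ... | rightᵛ _ s = inj₂ (⊖ τ , in-B s (there (here (cong (pt c) (sym (⊖-involutive τ))))))
      cover (g , n) | τ , refl | inj₁ refl with a-onto τ
      ... | w , refl with view w
      ...   | zeroᵛ refl s = inj₁ (cong (pt 1Q) (hom-0 a-⊕))
      ...   | rightᵛ s _ = inj₂ (w , in-B s (there (there (here refl))))
      ...   | leftᵛ _ s = inj₂ (⊖ w , in-B s (there (here (cong (pt 1Q)
                (sym (trans (cong ⊖_ (hom-⊖ a-⊕ w)) (⊖-involutive (a w))))))))

      BlockStep : Γ → Set
      BlockStep d = ∃ λ u → ∃₂ λ p p′ → Adj p p′ (B u) × p · d ≡ p′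

      Transition : Γ → Set
      Transition d = ∃ λ n → ∀ u u′ → u ⊕ u′ ≡ n → last u · d ≡ first u′

      gap-y : ∀ u xs {p} → Ends p (pt x u ∷ xs) → Adj p (pt y (⊖ a u)) ((pt x u ∷ xs) ++ map (value u) V)
      gap-y u xs e = Adj-join (pt x u ∷ xs) _ e (y-starts u)

      differences : ∀ d → d ≢ 1Γ → BlockStep d ⊎ Transition d
      differences (δ , v) d≢1 with steps δ
      -- The step `c` leads from `h` to `x`, so its quotients come from the junctions, where the
      -- N-part is a (u + u′).
      ... | inj₂ (inj₂ (inj₂ (inj₁ refl))) with n , refl ← a-onto v = inj₂ (n , λ u u′ eq →
              pt-step h∗c (trans (deg1 {x} _ deg-x) (cong a (trans (cong (u′ ⊕_) (⊖-involutive u)) (trans (comm u′ u) eq)))))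
      ... | inj₂ (inj₂ (inj₂ (inj₂ ((g , k) , (g′ , k′) , adj , eq)))) with a^-onto (deg g′) v
      ...   | s , refl with w , refl ← allowed-onto (V-allowed adj) s =
              inj₁ (w , _ , _ , Adj-++ʳ (pt x w ∷ gap (side w) w) (Adj-map (value w) adj) , pt-step eq refl)
      differences (δ , v) d≢1 | inj₁ refl with compose-onto a-onto double-onto v
      ... | w , refl with view w
      ...   | zeroᵛ refl _ = contradiction (cong (1Q ,_) (trans (cong a (identityˡ 0ᴺ)) (hom-0 a-⊕))) d≢1
      ...   | leftᵛ s _ = inj₁ (w , _ , _ , adj-B s (there here) ,
                pt-step c∗1 (trans (deg1 {c} _ deg-c) (cong a (two-⊖⊖ w))))
      ...   | rightᵛ s _ = inj₁ (w , _ , _ , adj-B s (there here) ,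
                pt-step 1∗1 (trans (deg0 {1Q} _ deg-1) (trans (two-⊖⊖ (a w)) (sym (a-⊕ w w)))))
      differences (δ , v) d≢1 | inj₂ (inj₁ refl) with compose-onto a-onto (negate double-onto) v
      ... | w , refl with view w
      ...   | zeroᵛ refl s = inj₁ (w , _ , _ , adj-B s here ,
                pt-step x∗y (trans (deg1 {c} _ deg-c) (cong a (trans (inverseʳ w) (trans (sym ⊖-0) (cong ⊖_ (sym (identityˡ 0ᴺ))))))))
      ...   | leftᵛ s _ = inj₁ (w , _ , _ , adj-B s here ,
                pt-step x∗y (trans (deg1 {c} _ deg-c) (cong a (⊖-⊕ w w))))
      ...   | rightᵛ s _ = inj₁ (w , _ , _ , adj-B s (gap-y w (gap right w) ((pt x w ∷ pt 1Q (⊖ a w) ∷ []) , refl)) ,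
                pt-step 1∗y (trans (deg0 {y} _ deg-y) (trans (⊖-⊕ (a w) (a w)) (trans (cong ⊖_ (sym (a-⊕ w w))) (sym (hom-⊖ a-⊕ _))))))
      differences (δ , v) d≢1 | inj₂ (inj₂ (inj₁ refl)) with negate (shift-onto 1) v
      ... | w , refl with view w
      ...   | zeroᵛ refl s = inj₁ (w , _ , _ , adj-B s (gap-y w (gap centre w) ((pt x w ∷ []) , refl)) ,
                pt-step c∗x⁻¹ (trans (deg0 {y} _ deg-y) (trans (⊖-⊕ (a w) w) (cong ⊖_ (comm (a w) w)))))
      ...   | leftᵛ s _ = inj₁ (w , _ , _ , adj-B s (gap-y w (gap left w) ((pt x w ∷ pt c (⊖ w) ∷ []) , refl)) ,
                pt-step c∗x⁻¹ (trans (deg0 {y} _ deg-y) (trans (⊖-⊕ (a w) w) (cong ⊖_ (comm (a w) w)))))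
      ...   | rightᵛ s _ = inj₁ (w , _ , _ , adj-B s here ,
                pt-step x∗x⁻¹ (trans (deg0 {1Q} _ deg-1) (trans (⊖-⊕ (a w) w) (cong ⊖_ (comm (a w) w)))))

      gap-length : ∀ u → u ≢ 0ᴺ → length (gap (side u) u) ≡ 2
      gap-length u u≢0 with side u | side-opposite u u≢0
      ... | left   | _               = refl
      ... | right  | _               = refl
      ... | centre | inj₁ (() , _)
      ... | centre | inj₂ (() , _)

      B-length : ∀ u → length (B u) ≡ suc (length (gap (side u) u) + length V)
      B-length u = cong suc (trans (List.length-++ (gap (side u) u)) (cong (length (gap (side u) u) +_) (List.length-map (value u) V)))

      size₀ : suc (length (B 0ᴺ)) ≡ q * m
      size₀ = trans (cong suc (trans (B-length 0ᴺ) (cong (λ s → suc (length (gap s 0ᴺ) + length V)) side-0))) size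

      size₊ : ∀ u → u ≢ 0ᴺ → length (B u) ≡ q * m
      size₊ u u≢0 = trans (B-length u) (trans (cong (λ k → suc (k + length V)) (gap-length u u≢0)) size)

    sequenceable : Sequenceable Γ _·_ 1Γ
    sequenceable = Assembly.sequenceable N↔ν B first last (pt 1Q 0ᴺ) starts ends t t⁺ t₁ t₂ arr split₁ split₂
      (pt x t₁ ∷ [] , refl) (_ , refl) ([] , refl) (_ , refl) cut₁-step cut₂-step cut₃-step cover differences
      size₀ (λ u u≢0 → cong₂ _+_ (size₊ u u≢0) (size₊ (⊖ u) (⊖-0≢ u≢0)))

-- The quotient ℤ₃ × ℤ₃

anyAdj? : ∀ {X : Set} {P : X → X → Set} → (∀ a b → Dec (P a b)) → ∀ xs → Dec (∃₂ λ a b → Adj a b xs × P a b)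
anyAdj? P? []           = no λ { (_ , _ , () , _) }
anyAdj? P? (x ∷ [])     = no λ { (_ , _ , there () , _) }
anyAdj? P? (x ∷ y ∷ xs) with P? x y | anyAdj? P? (y ∷ xs)
... | yes p | _                   = yes (x , y , here , p)
... | no _  | yes (a , b , q , p) = yes (a , b , there q , p)
... | no ¬p | no ¬q               = no λ { (_ , _ , here , p) → ¬p p ; (_ , _ , there q , p) → ¬q (_ , _ , q , p) }

anyBool? : ∀ {P : Bool → Set} → (∀ b → Dec (P b)) → Dec (∃ P)
anyBool? P? = map′ (λ { (inj₁ p) → true , p ; (inj₂ p) → false , p }) (λ { (true , p) → inj₁ p ; (false , p) → inj₂ p })
  (P? true ⊎-dec P? false)

alternate : ∀ {X : Set} → Bool → List X → List (X × Bool)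
alternate s []       = []
alternate s (x ∷ xs) = (x , s) ∷ alternate (not s) xs

allPairs? : ∀ {m n} {P : Fin m × Fin n → Set} → (∀ g → Dec (P g)) → Dec (∀ g → P g)
allPairs? P? = map′ (λ f (i , j) → f i j) (λ f i j → f (i , j)) (Fin.all? λ i → Fin.all? λ j → P? (i , j))

-- The quotient ℤ₃ × ℤ₃ has no R*-sequencing.  Instead the blocks of the two halves of N follow two different
-- walks through ℤ₃ × ℤ₃, which together visit every element and take every step twice, with coefficients ±1
-- that either agree in the two walks or are opposite within one of them; the block of 0 is an R-sequencing.
module ThreeThree where

  trivial : ℕ → Fin 3 → Fin 3
  trivial _ c = c

  private
    module G = Quotient 3 3 trivial
    open G

    0′ 1′ 2′ : Fin 3
    0′ = zero
    1′ = suc zero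
    2′ = suc (suc zero)

    walk : Side → List Q
    walk centre = (1′ , 0′) ∷ (2′ , 2′) ∷ (0′ , 2′) ∷ (2′ , 1′) ∷ (2′ , 0′) ∷ (1′ , 1′) ∷ (0′ , 1′) ∷ (1′ , 2′) ∷ []
    walk left   = (1′ , 0′) ∷ (2′ , 2′) ∷ (1′ , 1′) ∷ (0′ , 0′) ∷ (2′ , 0′) ∷ (1′ , 1′) ∷ (0′ , 2′) ∷ (0′ , 1′) ∷ (0′ , 1′) ∷ (1′ , 2′) ∷ []
    walk right  = (1′ , 0′) ∷ (2′ , 1′) ∷ (2′ , 1′) ∷ (0′ , 0′) ∷ (2′ , 0′) ∷ (2′ , 2′) ∷ (0′ , 2′) ∷ (1′ , 2′) ∷ []

    signed : Side → List (Q × Bool)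
    signed s = alternate true (walk s)

    _≟Q_ : DecidableEquality Q
    _≟Q_ = ≡-dec Fin._≟_ Fin._≟_

    open Data.List.Membership.DecPropositional (≡-dec _≟Q_ Bool._≟_) using (_∈?_)

    Step : Side → Q → Bool → Set
    Step s δ b = ∃₂ λ p p′ → Adj p p′ (signed s) × (proj₂ p ≡ b × proj₂ p′ ≡ not b) × proj₁ p ∗ δ ≡ proj₁ p′

    step? : ∀ s δ b → Dec (Step s δ b)
    step? s δ b = anyAdj? (λ p p′ → (proj₂ p Bool.≟ b ×-dec proj₂ p′ Bool.≟ not b) ×-dec (proj₁ p ∗ δ) ≟Q proj₁ p′) (signed s)

    -- A visit with value n is made by the block of n with coefficient + or by that of - n with
    -- coefficient -, and it is unknown which of n, - n is on the left. Each alternative copes with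
    -- this: one coefficient that works on both sides, or both coefficients available on one side.
    Twice : (Side → Bool → Set) → Set
    Twice P = (∃ λ b → P left b × P right b) ⊎ (P left true × P left false) ⊎ (P right true × P right false)

    twice? : ∀ {P : Side → Bool → Set} → (∀ s b → Dec (P s b)) → Dec (Twice P)
    twice? P? = anyBool? (λ b → P? left b ×-dec P? right b) ⊎-dec (P? left true ×-dec P? left false) ⊎-dec
      (P? right true ×-dec P? right false)

    abstract
      visits : ∀ g → Twice (λ s b → (g , b) ∈ signed s) × (g ≡ 1Q ⊎ ∃ λ b → (g , b) ∈ signed centre)
      visits = from-yes (allPairs? λ g → twice? (λ s b → (g , b) ∈? signed s) ×-dec
        (g ≟Q 1Q ⊎-dec anyBool? λ b → (g , b) ∈? signed centre))

      steps : ∀ δ → δ ≡ (0′ , 1′) ⊎ (Twice (λ s b → Step s δ b) × (δ ≡ 1Q ⊎ ∃ λ b → Step centre δ b))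
      steps = from-yes (allPairs? λ δ → δ ≟Q (0′ , 1′) ⊎-dec (twice? (λ s b → step? s δ b) ×-dec
        (δ ≟Q 1Q ⊎-dec anyBool? λ b → step? centre δ b)))

  module _ (S : Setup 3 3 trivial) where
    open Units S hiding (Q; _∗_; 1Q; deg)

    module _ (t t⁺ t₁ t₂ : N) (t₁≢0 : t₁ ≢ 0ᴺ) (t₂≢0 : t₂ ≢ 0ᴺ) (⊖t₂≢t₁ : ⊖ t₂ ≢ t₁)
      (t≡ : t ≡ a t₂ ⊕ t₂) (t⁺≡ : t⁺ ≡ (⊖ t₂) ⊕ ((⊖ t₁) ⊕ (⊖ t₁))) (t₁≡ : t⁺ ⊕ t ≡ ⊖ t₁)
      (arr : Arranged.Arrangement isAb t t⁺ t₁ t₂) where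
      open HalfSystem t₁ t₂ t₁≢0 t₂≢0 ⊖t₂≢t₁

      private
        ⟦_⟧ : Bool → N → N
        ⟦ true  ⟧ u = u
        ⟦ false ⟧ u = ⊖ u

        -- The coordinates are not twisted by powers of `a` here. With coefficients ± u only, a step
        -- of degree k has N-part ± (u + aᵏ u), which is bijective in u for every k.
        value : N → Q × Bool → Γ
        value u (g , b) = g , ⟦ b ⟧ u

        B : N → List Γ
        B u = map (value u) (signed (side u))

        first last : N → Γ
        first u = (1′ , 0′) , u
        last  u = (1′ , 2′) , ⊖ u

        starts : ∀ u → Starts (first u) (B u)
        starts u with side u
        ... | centre = _ , refl
        ... | left   = _ , refl
        ... | right  = _ , refl

        ends : ∀ u → Ends (last u) (B u)
        ends u with side u
        ... | centre = map (value u) (alternate true ((1′ , 0′) ∷ (2′ , 2′) ∷ (0′ , 2′) ∷ (2′ , 1′) ∷ (2′ , 0′) ∷ (1′ , 1′) ∷ (0′ , 1′) ∷ [])) , refl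
        ... | left   = map (value u) (alternate true ((1′ , 0′) ∷ (2′ , 2′) ∷ (1′ , 1′) ∷ (0′ , 0′) ∷ (2′ , 0′) ∷ (1′ , 1′) ∷ (0′ , 2′) ∷ (0′ , 1′) ∷ (0′ , 1′) ∷ [])) , refl
        ... | right  = map (value u) (alternate true ((1′ , 0′) ∷ (2′ , 1′) ∷ (2′ , 1′) ∷ (0′ , 0′) ∷ (2′ , 0′) ∷ (2′ , 2′) ∷ (0′ , 2′) ∷ [])) , refl

        B≡ : ∀ {u s} → side u ≡ s → B u ≡ map (value u) (signed s)
        B≡ {u} eq = cong (λ s → map (value u) (signed s)) eq

        in-B : ∀ {u s p} → side u ≡ s → p ∈ signed s → value u p ∈ B u
        in-B {u} {p = p} eq p∈ = subst (value u p ∈_) (sym (B≡ eq)) (∈-map⁺ (value u) p∈)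

        adj-B : ∀ {u s p p′} → side u ≡ s → Adj p p′ (signed s) → Adj (value u p) (value u p′) (B u)
        adj-B {u} {p = p} {p′} eq adj = subst (Adj (value u p) (value u p′)) (sym (B≡ eq)) (Adj-map (value u) adj)

        double-sign : ∀ b n → ⟦ b ⟧ (⟦ b ⟧ n) ≡ n
        double-sign true  n = refl
        double-sign false n = ⊖-involutive n

        sign-0 : ∀ b → ⟦ b ⟧ 0ᴺ ≡ 0ᴺ
        sign-0 true  = refl
        sign-0 false = ⊖-0

        sign-≢0 : ∀ b {n} → n ≢ 0ᴺ → ⟦ b ⟧ n ≢ 0ᴺ
        sign-≢0 true  n≢0 = n≢0
        sign-≢0 false n≢0 = ⊖-0≢ n≢0

        -- Whatever the coefficients with which the two walks make a visit (or a step), one of the blocks of ± n makes it.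
        realise : ∀ {P : Side → Bool → Set} {n} → n ≢ 0ᴺ → Twice P → ∃ λ b → P (side (⟦ b ⟧ n)) b
        realise {P} {n} n≢0 (inj₁ (b , p , p′)) with side-opposite (⟦ b ⟧ n) (sign-≢0 b n≢0)
        ... | inj₁ (eq , _) = b , subst (λ s → P s b) (sym eq) p
        ... | inj₂ (eq , _) = b , subst (λ s → P s b) (sym eq) p′
        realise {P} {n} n≢0 (inj₂ (inj₁ (p , p′))) with side-opposite n n≢0
        ... | inj₁ (eq , _) = true  , subst (λ s → P s true)  (sym eq) p
        ... | inj₂ (_ , eq) = false , subst (λ s → P s false) (sym eq) p′
        realise {P} {n} n≢0 (inj₂ (inj₂ (p , p′))) with side-opposite n n≢0
        ... | inj₁ (_ , eq) = false , subst (λ s → P s false) (sym eq) p′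
        ... | inj₂ (eq , _) = true  , subst (λ s → P s true)  (sym eq) p

        cover : ∀ g → g ≡ (1Q , 0ᴺ) ⊎ ∃ λ u → g ∈ B u
        cover (g , n) with n ≟ 0ᴺ
        ... | no n≢0 with b , b∈ ← realise {λ s b → (g , b) ∈ signed s} n≢0 (proj₁ (visits g)) =
              inj₂ (⟦ b ⟧ n , subst (_∈ B (⟦ b ⟧ n)) (cong (g ,_) (double-sign b n)) (in-B {p = g , b} refl b∈))
        ... | yes refl with proj₂ (visits g)
        ...   | inj₁ refl = inj₁ refl
        ...   | inj₂ (b , b∈) = inj₂ (0ᴺ , subst (_∈ B 0ᴺ) (cong (g ,_) (sign-0 b)) (in-B {p = g , b} side-0 b∈))

        walk-step : ∀ g δ n {g′ v n′} → g ∗ δ ≡ g′ → (a^ (deg δ)) n ⊕ v ≡ n′ → (g , n) · (δ , v) ≡ (g′ , n′)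
        walk-step _ _ _ = cong₂ _,_

        sign-step : ∀ k b u → (a^ k) (⟦ b ⟧ u) ⊕ (⟦ not b ⟧ u ⊕ (⟦ not b ⟧ ((a^ k) u))) ≡ ⟦ not b ⟧ u
        sign-step k b u = trans (cong (_⊕ (⟦ not b ⟧ u ⊕ ⟦ not b ⟧ ((a^ k) u))) (through b)) (trans (comm _ _) (trans (assoc _ _ _)
          (trans (cong (⟦ not b ⟧ u ⊕_) (cancels b)) (identityʳ _))))
          where
          through : ∀ b → (a^ k) (⟦ b ⟧ u) ≡ ⟦ b ⟧ ((a^ k) u)
          through true  = refl
          through false = hom-⊖ (a^-⊕ k) u
          cancels : ∀ b → ⟦ not b ⟧ ((a^ k) u) ⊕ ⟦ b ⟧ ((a^ k) u) ≡ 0ᴺ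
          cancels true  = inverseˡ _
          cancels false = inverseʳ _

        BlockStep : Γ → Set
        BlockStep d = ∃ λ u → ∃₂ λ p p′ → Adj p p′ (B u) × p · d ≡ p′

        Transition : Γ → Set
        Transition d = ∃ λ n → ∀ u u′ → u ⊕ u′ ≡ n → last u · d ≡ first u′

        block-step : ∀ {u s δ v} b → side u ≡ s → Step s δ b → ⟦ not b ⟧ u ⊕ ⟦ not b ⟧ ((a^ (deg δ)) u) ≡ v → BlockStep (δ , v)
        block-step {u} {δ = δ} b eq ((g , _) , (g′ , _) , adj , (refl , refl) , eq′) refl =
          u , _ , _ , adj-B eq adj , walk-step g δ (⟦ b ⟧ u) eq′ (sign-step (deg δ) b u)

        -- With u = `⟦ b ⟧ w` the N-part of the step does not depend on b, so w can be solved for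
        -- before it is known which coefficient the block of ± w will use.
        sign-shift : ∀ k b w → ⟦ not b ⟧ (⟦ b ⟧ w) ⊕ ⟦ not b ⟧ ((a^ k) (⟦ b ⟧ w)) ≡ ⊖ (w ⊕ (a^ k) w)
        sign-shift k true  w = ⊖-⊕ w _
        sign-shift k false w = trans (cong ((⊖ w) ⊕_) (hom-⊖ (a^-⊕ k) w)) (⊖-⊕ w _)

        differences : ∀ d → d ≢ 1Γ → BlockStep d ⊎ Transition d
        differences (δ , v) d≢1 with steps δ
        ... | inj₁ refl = inj₂ (v , λ u u′ eq → walk-step (1′ , 2′) (0′ , 1′) (⊖ u) refl (trans (cong ((⊖ u) ⊕_) (sym eq))
                (trans (sym (assoc _ u u′)) (trans (cong (_⊕ u′) (inverseˡ u)) (identityˡ u′)))))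
        ... | inj₂ (twice , once) with negate (shift-onto (deg δ)) v
        ...   | w , refl with w ≟ 0ᴺ
        ...     | no w≢0 with b , step ← realise {λ s b → Step s δ b} w≢0 twice = inj₁ (block-step b refl step (sign-shift (deg δ) b w))
        differences (δ , v) d≢1 | inj₂ (twice , once) | w , refl | yes refl with once
        ... | inj₁ refl = contradiction (cong (1Q ,_) (trans (cong ⊖_ (identityˡ 0ᴺ)) ⊖-0)) d≢1
        ... | inj₂ (b , step) = inj₁ (block-step b side-0 step
                (trans (cong (λ u → ⟦ not b ⟧ u ⊕ ⟦ not b ⟧ ((a^ (deg δ)) u)) (sym (sign-0 b))) (sign-shift (deg δ) b 0ᴺ)))

        split₁ : B t₁ ≡ map (value t₁) (alternate true ((1′ , 0′) ∷ (2′ , 2′) ∷ (1′ , 1′) ∷ (0′ , 0′) ∷ (2′ , 0′) ∷ (1′ , 1′) ∷ (0′ , 2′) ∷ []))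
                   ++ map (value t₁) (alternate false ((0′ , 1′) ∷ (0′ , 1′) ∷ (1′ , 2′) ∷ []))
        split₁ = B≡ side-t₁

        split₂ : B t₂ ≡ map (value t₂) (alternate true ((1′ , 0′) ∷ (2′ , 2′) ∷ (1′ , 1′) ∷ (0′ , 0′) ∷ (2′ , 0′) ∷ (1′ , 1′) ∷ []))
                   ++ map (value t₂) (alternate true ((0′ , 2′) ∷ (0′ , 1′) ∷ (0′ , 1′) ∷ (1′ , 2′) ∷ []))
        split₂ = B≡ side-t₂

        transfer : ∀ d p r d₀ {p′ r′} → p · d₀ ≡ p′ → r · d₀ ≡ r′ → p · d ≡ p′ → r · d ≡ r′
        transfer d p r d₀ eq eq′ eq″ = trans (cong (r ·_) (·-cancelˡ p (trans eq″ (sym eq)))) eq′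

        cut₁-step : ∀ d → ((0′ , 2′) , t₁) · d ≡ ((0′ , 1′) , ⊖ t₁) → ((1′ , 1′) , ⊖ t₂) · d ≡ first t⁺
        cut₁-step d = transfer d ((0′ , 2′) , t₁) ((1′ , 1′) , ⊖ t₂) ((0′ , 2′) , (⊖ t₁) ⊕ (⊖ t₁))
          (walk-step (0′ , 2′) (0′ , 2′) t₁ refl (trans (sym (assoc t₁ _ _)) (trans (cong (_⊕ (⊖ t₁)) (inverseʳ t₁)) (identityˡ _))))
          (walk-step (1′ , 1′) (0′ , 2′) (⊖ t₂) refl (sym t⁺≡))

        cut₂-step : ∀ d → ((1′ , 1′) , ⊖ t₂) · d ≡ ((0′ , 2′) , t₂) → last t · d ≡ (1Q , 0ᴺ)
        cut₂-step d = transfer d ((1′ , 1′) , ⊖ t₂) (last t) ((2′ , 1′) , t₂ ⊕ (a^ 2) t₂) (walk-step (1′ , 1′) (2′ , 1′) (⊖ t₂) refl (sign-step 2 false t₂))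
          (walk-step (1′ , 2′) (2′ , 1′) (⊖ t) refl (trans (cong (_⊕ (t₂ ⊕ (a^ 2) t₂)) (trans (hom-⊖ (a^-⊕ 2) t) (cong ⊖_ a²t))) (inverseˡ _)))
          where
          -- The second cut demands a² t = t₂ + a² t₂. Applying `a` and using a³ = 1 gives t = a t₂
          -- + t₂, the form in which `t` is prescribed.
          a²t : (a^ 2) t ≡ t₂ ⊕ (a^ 2) t₂
          a²t = trans (cong (a^ 2) t≡) (trans (a^-⊕ 2 (a t₂) t₂) (cong (_⊕ (a^ 2) t₂) (a-period t₂)))

        cut₃-step : ∀ d → last t · d ≡ first t⁺ → (1Q , 0ᴺ) · d ≡ ((0′ , 1′) , ⊖ t₁)
        cut₃-step d = transfer d (last t) (1Q , 0ᴺ) ((0′ , 1′) , ⊖ t₁)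
          (walk-step (1′ , 2′) (0′ , 1′) (⊖ t) refl (trans (cong ((⊖ t) ⊕_) (trans (sym t₁≡) (comm t⁺ t)))
            (trans (sym (assoc _ t t⁺)) (trans (cong (_⊕ t⁺) (inverseˡ t)) (identityˡ t⁺)))))
          (walk-step 1Q (0′ , 1′) 0ᴺ refl (identityˡ _))

        B-length : ∀ {u s} → side u ≡ s → length (B u) ≡ length (signed s)
        B-length {u} {s} eq = trans (cong length (B≡ eq)) (List.length-map (value u) (signed s))

        sizes : ∀ u → u ≢ 0ᴺ → length (B u) + length (B (⊖ u)) ≡ 18
        sizes u u≢0 with side-opposite u u≢0
        ... | inj₁ (l , r) = cong₂ _+_ (B-length l) (B-length r)
        ... | inj₂ (r , l) = cong₂ _+_ (B-length r) (B-length l)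

      sequenceable : Sequenceable Γ _·_ 1Γ
      sequenceable = Assembly.sequenceable N↔ν B first last (1Q , 0ᴺ) starts ends t t⁺ t₁ t₂ arr split₁ split₂
        (map (value t₁) (alternate true ((1′ , 0′) ∷ (2′ , 2′) ∷ (1′ , 1′) ∷ (0′ , 0′) ∷ (2′ , 0′) ∷ (1′ , 1′) ∷ [])) , refl) (_ , refl)
        (map (value t₂) (alternate true ((1′ , 0′) ∷ (2′ , 2′) ∷ (1′ , 1′) ∷ (0′ , 0′) ∷ (2′ , 0′) ∷ [])) , refl) (_ , refl)
        cut₁-step cut₂-step cut₃-step cover differences (cong suc (B-length side-0)) sizes

-- Coefficients along a walk, and R*-sequencings of order 27

module Coefficients {X : Set} where

  negative positive : List X → List (X × Coefficient)
  negative []       = []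
  negative (g ∷ gs) = (g , neg) ∷ positive gs
  positive []       = []
  positive (g ∷ gs) = (g , pos) ∷ negative gs

  weighted : X → X → X → List X → List (X × Coefficient)
  weighted y g g′ gs = (y , nega) ∷ (g , pos) ∷ (g′ , dbl) ∷ negative gs

  negative-allowed : ∀ gs {s s′} → Adj s s′ (negative gs) → Allowed (proj₂ s) (proj₂ s′)
  positive-allowed : ∀ gs {s s′} → Adj s s′ (positive gs) → Allowed (proj₂ s) (proj₂ s′)
  negative-allowed (_ ∷ _ ∷ _)  here      = neg-pos
  negative-allowed (_ ∷ gs)     (there p) = positive-allowed gs p
  positive-allowed (_ ∷ _ ∷ _)  here      = pos-neg
  positive-allowed (_ ∷ gs)     (there p) = negative-allowed gs p

  weighted-allowed : ∀ {y g g′} gs {s s′} → Adj s s′ (weighted y g g′ gs) → Allowed (proj₂ s) (proj₂ s′)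
  weighted-allowed gs here = nega-pos
  weighted-allowed gs (there here) = pos-dbl
  weighted-allowed (_ ∷ _) (there (there here)) = dbl-neg
  weighted-allowed gs (there (there (there p))) = negative-allowed gs p

  negative-support : ∀ gs → map proj₁ (negative gs) ≡ gs
  positive-support : ∀ gs → map proj₁ (positive gs) ≡ gs
  negative-support []       = refl
  negative-support (g ∷ gs) = cong (g ∷_) (positive-support gs)
  positive-support []       = refl
  positive-support (g ∷ gs) = cong (g ∷_) (negative-support gs)

  weighted-support : ∀ y g g′ gs → map proj₁ (weighted y g g′ gs) ≡ y ∷ g ∷ g′ ∷ gs
  weighted-support y g g′ gs = cong (λ l → y ∷ g ∷ g′ ∷ l) (negative-support gs)

final : ∀ {X : Set} → X → List X → X
final x []       = x
final x (y ∷ ys) = final y ys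

final-Ends : ∀ {X : Set} (x : X) xs → Ends (final x xs) (x ∷ xs)
final-Ends x []       = [] , refl
final-Ends x (y ∷ ys) = Ends-++ [ x ] (final-Ends y ys)

module _ {X Y : Set} (f : X → Y) where

  Adj-map⁻ : ∀ xs {a b} → Adj a b (map f xs) → ∃₂ λ s s′ → Adj s s′ xs × f s ≡ a × f s′ ≡ b
  Adj-map⁻ (x ∷ y ∷ xs) here = x , y , here , refl , refl
  Adj-map⁻ (x ∷ xs) (there p) with s , s′ , q , e , e′ ← Adj-map⁻ xs p = s , s′ , there q , e , e′

module Weighted {q m : ℕ} .{{_ : NonZero q}} .{{_ : NonZero m}} (act : ℕ → Fin m → Fin m) where
  open Quotient q m act
  open Coefficients {Q}

  module _ {y g g′ : Q} {gs : List Q} where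

    weighted-covers : ∀ {k} → k ∈ y ∷ g ∷ g′ ∷ gs → ∃ λ w → (k , w) ∈ weighted y g g′ gs
    weighted-covers {k} k∈ with ∈-map⁻ proj₁ (subst (k ∈_) (sym (weighted-support y g g′ gs)) k∈)
    ... | (_ , w) , k∈′ , refl = w , k∈′

    weighted-steps : ∀ {δ} → (∃₂ λ k k′ → Adj k k′ (y ∷ g ∷ g′ ∷ gs) × k ∗ δ ≡ k′) →
      ∃₂ λ s s′ → Adj s s′ (weighted y g g′ gs) × proj₁ s ∗ δ ≡ proj₁ s′
    weighted-steps (k , k′ , adj , eq)
      with s , s′ , adj′ , refl , refl ← Adj-map⁻ proj₁ (weighted y g g′ gs) (subst (Adj k k′) (sym (weighted-support y g g′ gs)) adj)
      = s , s′ , adj′ , eq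

-- R*-sequencings of ℤ₃ ⋉ ℤ₉, found by computer search, for the three automorphisms of ℤ₉ of order dividing 3.
module TwentySeven where

  multiplied : ℕ → ℕ → Fin 9 → Fin 9
  multiplied r k c = iter k (λ d → (r * toℕ d) mod 9) c

  private
    element : ℕ → ℕ → Fin 3 × Fin 9
    element u c = u mod 3 , c mod 9

    _≟Q_ : DecidableEquality (Fin 3 × Fin 9)
    _≟Q_ = ≡-dec Fin._≟_ Fin._≟_

    open Data.List.Membership.DecPropositional _≟Q_ using (_∈?_)

    decode : List (ℕ × ℕ) → List (Fin 3 × Fin 9)
    decode = map (λ (u , c) → element u c)

    covers? : ∀ c x (L : List (Fin 3 × Fin 9)) → Dec (∀ g → g ≡ element 0 0 ⊎ g ≡ c ⊎ g ≡ x ⊎ g ∈ L)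
    covers? c x L = allPairs? λ g → g ≟Q element 0 0 ⊎-dec (g ≟Q c ⊎-dec (g ≟Q x ⊎-dec g ∈? L))

    steps? : ∀ act y x⁻¹ c L → let open Quotient 3 9 act in
      Dec (∀ δ → δ ≡ element 0 0 ⊎ δ ≡ y ⊎ δ ≡ x⁻¹ ⊎ δ ≡ c ⊎ ∃₂ λ k k′ → Adj k k′ L × k ∗ δ ≡ k′)
    steps? act y x⁻¹ c L = allPairs? λ δ → δ ≟Q element 0 0 ⊎-dec (δ ≟Q y ⊎-dec (δ ≟Q x⁻¹ ⊎-dec (δ ≟Q c ⊎-dec
      anyAdj? (λ k k′ → (k ∗ δ) ≟Q k′) L)))
      where open Quotient 3 9 act

    tail₁ tail₄ tail₇ : List (Fin 3 × Fin 9)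
    tail₁ = decode ((0 , 5) ∷ (1 , 2) ∷ (0 , 4) ∷ (1 , 3) ∷ (0 , 6) ∷ (1 , 4) ∷ (2 , 0) ∷ (1 , 5) ∷ (2 , 7) ∷ (1 , 6) ∷ (0 , 7) ∷
      (2 , 5) ∷ (2 , 2) ∷ (1 , 8) ∷ (2 , 3) ∷ (1 , 7) ∷ (2 , 1) ∷ (2 , 6) ∷ (2 , 4) ∷ (2 , 8) ∷ (0 , 8) ∷ [])
    tail₄ = decode ((1 , 0) ∷ (0 , 1) ∷ (2 , 5) ∷ (0 , 4) ∷ (0 , 5) ∷ (2 , 4) ∷ (2 , 1) ∷ (0 , 8) ∷ (1 , 3) ∷ (0 , 2) ∷ (2 , 8) ∷
      (1 , 8) ∷ (2 , 6) ∷ (2 , 2) ∷ (1 , 7) ∷ (2 , 0) ∷ (2 , 7) ∷ (1 , 4) ∷ (1 , 6) ∷ (2 , 3) ∷ (0 , 6) ∷ [])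
    tail₇ = decode ((0 , 4) ∷ (0 , 8) ∷ (0 , 5) ∷ (1 , 0) ∷ (2 , 0) ∷ (0 , 7) ∷ (2 , 1) ∷ (1 , 1) ∷ (2 , 3) ∷ (1 , 6) ∷ (2 , 8) ∷
      (1 , 4) ∷ (2 , 5) ∷ (2 , 4) ∷ (1 , 2) ∷ (2 , 2) ∷ (2 , 7) ∷ (1 , 3) ∷ (2 , 6) ∷ (1 , 7) ∷ (0 , 6) ∷ [])

    build : ∀ act x y c h x⁻¹ g g′ gs → let open Quotient 3 9 act in
      (deg x ≡ 1) → (deg c ≡ 1) → (deg y ≡ 0) → (x ∗ y ≡ c) → (x ∗ x⁻¹ ≡ 1Q) → (c ∗ x⁻¹ ≡ y) → (h ∗ y ≡ 1Q) → (h ∗ c ≡ x) →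
      (1Q ∗ y ≡ y) → (1Q ∗ c ≡ c) → (x ∗ 1Q ≡ x) → (c ∗ 1Q ≡ c) → (1Q ∗ 1Q ≡ 1Q) → Ends (h , neg) (Coefficients.weighted y g g′ gs) →
      length (Coefficients.weighted y g g′ gs) ≡ 24 →
      True (covers? c x (y ∷ g ∷ g′ ∷ gs)) → True (steps? act y x⁻¹ c (y ∷ g ∷ g′ ∷ gs)) → RStar 3 9 act
    build act x y c h x⁻¹ g g′ gs d₁ d₂ d₃ e₁ e₂ e₃ e₄ e₅ e₆ e₇ e₈ e₉ e₁₀ ends size covers steps = record
      { x = x ; y = y ; c = c ; h = h ; x⁻¹ = x⁻¹ ; V = Coefficients.weighted y g g′ gs
      ; V-starts = _ , refl ; V-ends = ends ; V-allowed = Coefficients.weighted-allowed gs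
      ; deg-x = d₁ ; deg-c = d₂ ; deg-y = d₃ ; deg-1 = refl
      ; x∗y = e₁ ; x∗x⁻¹ = e₂ ; c∗x⁻¹ = e₃ ; h∗y = e₄ ; h∗c = e₅
      ; 1∗y = e₆ ; 1∗c = e₇ ; x∗1 = e₈ ; c∗1 = e₉ ; 1∗1 = e₁₀
      ; covers = λ k → reCover (toWitness covers k) ; steps = λ δ → reStep (toWitness steps δ) ; size = cong (3 +_) size }
      where
      open Quotient 3 9 act
      open Coefficients {Q}
      open Weighted {3} {9} act
      reCover : ∀ {k} → k ≡ 1Q ⊎ k ≡ c ⊎ k ≡ x ⊎ k ∈ y ∷ g ∷ g′ ∷ gs → k ≡ 1Q ⊎ k ≡ c ⊎ k ≡ x ⊎ ∃ λ w → (k , w) ∈ weighted y g g′ gs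
      reCover (inj₁ eq)                      = inj₁ eq
      reCover (inj₂ (inj₁ eq))               = inj₂ (inj₁ eq)
      reCover (inj₂ (inj₂ (inj₁ eq)))        = inj₂ (inj₂ (inj₁ eq))
      reCover (inj₂ (inj₂ (inj₂ k∈)))        = inj₂ (inj₂ (inj₂ (weighted-covers k∈)))
      reStep : ∀ {δ} → δ ≡ 1Q ⊎ δ ≡ y ⊎ δ ≡ x⁻¹ ⊎ δ ≡ c ⊎ (∃₂ λ k k′ → Adj k k′ (y ∷ g ∷ g′ ∷ gs) × k ∗ δ ≡ k′) →
        δ ≡ 1Q ⊎ δ ≡ y ⊎ δ ≡ x⁻¹ ⊎ δ ≡ c ⊎ ∃₂ λ s s′ → Adj s s′ (weighted y g g′ gs) × proj₁ s ∗ δ ≡ proj₁ s′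
      reStep (inj₁ eq)                       = inj₁ eq
      reStep (inj₂ (inj₁ eq))                = inj₂ (inj₁ eq)
      reStep (inj₂ (inj₂ (inj₁ eq)))         = inj₂ (inj₂ (inj₁ eq))
      reStep (inj₂ (inj₂ (inj₂ (inj₁ eq))))  = inj₂ (inj₂ (inj₂ (inj₁ eq)))
      reStep (inj₂ (inj₂ (inj₂ (inj₂ step)))) = inj₂ (inj₂ (inj₂ (inj₂ (weighted-steps step))))

  abstract
    rstar₁ : RStar 3 9 (multiplied 1)
    rstar₁ = build (multiplied 1) (element 1 0) (element 0 1) (element 1 1) (element 0 8) (element 2 0)
      (element 0 3) (element 0 2) tail₁ refl refl refl refl refl refl refl refl refl refl refl refl refl (final-Ends _ _) refl tt tt

    rstar₄ : RStar 3 9 (multiplied 4)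
    rstar₄ = build (multiplied 4) (element 1 2) (element 0 3) (element 1 5) (element 0 6) (element 2 4)
      (element 0 7) (element 1 1) tail₄ refl refl refl refl refl refl refl refl refl refl refl refl refl (final-Ends _ _) refl tt tt

    rstar₇ : RStar 3 9 (multiplied 7)
    rstar₇ = build (multiplied 7) (element 1 5) (element 0 3) (element 1 8) (element 0 6) (element 2 7)
      (element 0 1) (element 0 2) tail₇ refl refl refl refl refl refl refl refl refl refl refl refl refl (final-Ends _ _) refl tt tt

-- R*-sequencings of cyclic groups of order 3k

-- The cyclic group of odd order n = 2h + 1 with h = s + r, s ≤ r ≤ s + 1, has the R-sequencing
--   M, M+1, M-1, M+2, …, M+s, M-s, r, -(r-1), r-1, …, 2, -1, 1      (M = h + 1).
-- For n = 3k, k = 2κ + 1, it contains the consecutive elements M+κ = -k, M-κ = k+1, M+κ+1 = 2k+1, M-κ-1 = k,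
-- which play the roles of h = y⁻¹, x, c and y.
module Zigzag (κ c s r : ℕ) (s≡ : s ≡ suc κ + c) (sum≡ : s + r ≡ suc (κ + κ + κ)) (0<r : 0 < r)
  (balance : r ≡ s ⊎ r ≡ suc s) where

  h M n : ℕ
  h = s + r
  M = suc h
  n = suc (h + h)

  zig : ℕ → ℕ → List ℕ
  zig zero      i = []
  zig (suc cnt) i = (M ∸ i) ∷ (M + suc i) ∷ zig cnt (suc i)

  down : ℕ → List ℕ
  down zero          = []
  down (suc zero)    = 1 ∷ []
  down (suc (suc j)) = suc (suc j) ∷ (n ∸ suc j) ∷ down (suc j)

  -- The R-sequencing read cyclically from y = M-κ-1 round to M+κ, hence with the initial zigzag at
  -- the end. Leaving out `x` and `c` loses the moves from h to x, from x to c and from c to y, with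
  -- differences `c`, `y` and `x⁻¹`.
  body : List ℕ
  body = zig c (suc κ) ++ (M ∸ s) ∷ down r ++ zig κ 0

  0<κ : 0 < κ
  0<κ = ℕ.n≢0⇒n>0 λ κ≡0 → bad r 0<r (trans (cong (_+ r) (sym (trans s≡ (cong (λ k → suc k + c) κ≡0))))
    (trans sum≡ (cong (λ k → suc (k + k + k)) κ≡0)))
    where
    bad : ∀ r → 0 < r → suc c + r ≢ 1
    bad (suc r) _ e with () ← trans (sym (ℕ.+-suc c r)) (ℕ.suc-injective e)

  private
    M∸-+ : ∀ {i} → i ≤ s → (M ∸ i) + i ≡ M
    M∸-+ i≤s = ℕ.m∸n+n≡m (ℕ.≤-trans i≤s (ℕ.≤-trans (ℕ.m≤m+n s r) (ℕ.n≤1+n h)))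

    zig-∈ˡ : ∀ cnt {i₀ i} → i₀ ≤ i → i < i₀ + cnt → (M ∸ i) ∈ zig cnt i₀
    zig-∈ˡ zero {i₀} le lt = contradiction (subst (_ <_) (ℕ.+-identityʳ i₀) lt) (ℕ.≤⇒≯ le)
    zig-∈ˡ (suc cnt) {i₀} {i} le lt with ℕ.m≤n⇒m<n∨m≡n le
    ... | inj₂ refl = here refl
    ... | inj₁ i₀<i = there (there (zig-∈ˡ cnt i₀<i (subst (i <_) (ℕ.+-suc i₀ cnt) lt)))

    zig-∈ʳ : ∀ cnt {i₀ i} → i₀ ≤ i → i < i₀ + cnt → (M + suc i) ∈ zig cnt i₀
    zig-∈ʳ zero {i₀} le lt = contradiction (subst (_ <_) (ℕ.+-identityʳ i₀) lt) (ℕ.≤⇒≯ le)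
    zig-∈ʳ (suc cnt) {i₀} {i} le lt with ℕ.m≤n⇒m<n∨m≡n le
    ... | inj₂ refl = there (here refl)
    ... | inj₁ i₀<i = there (there (zig-∈ʳ cnt i₀<i (subst (i <_) (ℕ.+-suc i₀ cnt) lt)))

    zig-up : ∀ cnt {i₀ i} → i₀ ≤ i → i < i₀ + cnt → Adj (M ∸ i) (M + suc i) (zig cnt i₀)
    zig-up zero {i₀} le lt = contradiction (subst (_ <_) (ℕ.+-identityʳ i₀) lt) (ℕ.≤⇒≯ le)
    zig-up (suc cnt) {i₀} {i} le lt with ℕ.m≤n⇒m<n∨m≡n le
    ... | inj₂ refl = here
    ... | inj₁ i₀<i = there (there (zig-up cnt i₀<i (subst (i <_) (ℕ.+-suc i₀ cnt) lt)))

    zig-down : ∀ cnt {i₀ i rest} → i₀ ≤ i → i < i₀ + cnt →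
      Adj (M + suc i) (M ∸ suc i) (zig cnt i₀ ++ (M ∸ (i₀ + cnt)) ∷ rest)
    zig-down zero {i₀} le lt = contradiction (subst (_ <_) (ℕ.+-identityʳ i₀) lt) (ℕ.≤⇒≯ le)
    zig-down (suc cnt) {i₀} {i} {rest} le lt with ℕ.m≤n⇒m<n∨m≡n le
    zig-down (suc zero) {i₀} {rest = rest} le lt | inj₂ refl =
      there (subst (λ j → Adj (M + suc i₀) (M ∸ suc i₀) ((M + suc i₀) ∷ (M ∸ j) ∷ rest)) (ℕ.+-comm 1 i₀) here)
    zig-down (suc (suc cnt)) le lt | inj₂ refl = there here
    ... | inj₁ i₀<i = there (there (subst (λ j → Adj (M + suc i) (M ∸ suc i) (zig cnt (suc i₀) ++ (M ∸ j) ∷ rest))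
            (sym (ℕ.+-suc i₀ cnt)) (zig-down cnt i₀<i (subst (i <_) (ℕ.+-suc i₀ cnt) lt))))

    zig-down′ : ∀ cnt {i₀ i} → i₀ ≤ i → suc i < i₀ + cnt → Adj (M + suc i) (M ∸ suc i) (zig cnt i₀)
    zig-down′ zero {i₀} le lt = contradiction (subst (_ <_) (ℕ.+-identityʳ i₀) lt) (ℕ.≤⇒≯ (ℕ.m≤n⇒m≤1+n le))
    zig-down′ (suc cnt) {i₀} {i} le lt with ℕ.m≤n⇒m<n∨m≡n le
    zig-down′ (suc zero) {i₀} le lt | inj₂ refl = contradiction (subst (suc i₀ <_) (ℕ.+-comm i₀ 1) lt) (ℕ.<-irrefl refl)
    zig-down′ (suc (suc cnt)) le lt | inj₂ refl = there here
    ... | inj₁ i₀<i = there (there (zig-down′ cnt i₀<i (subst (suc i <_) (ℕ.+-suc i₀ cnt) lt)))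

    down-∈′ : ∀ j {i} → 0 < i → i ≤ suc j → i ∈ down (suc j)
    down-∈′ zero 0<i i≤1 = here (ℕ.≤-antisym i≤1 0<i)
    down-∈′ (suc j) 0<i i≤ with ℕ.m≤n⇒m<n∨m≡n i≤
    ... | inj₂ refl = here refl
    ... | inj₁ (s≤s i≤j) = there (there (down-∈′ j 0<i i≤j))

    down-n∸′ : ∀ j {i} → 0 < i → i ≤ j → Adj (suc i) (n ∸ i) (down (suc j))
    down-n∸′ zero 0<i i≤0 = contradiction 0<i (ℕ.≤⇒≯ i≤0)
    down-n∸′ (suc j) 0<i i≤ with ℕ.m≤n⇒m<n∨m≡n i≤
    ... | inj₂ refl = here
    ... | inj₁ (s≤s i≤j) = there (there (down-n∸′ j 0<i i≤j))

    down-i′ : ∀ j {i} → 0 < i → i ≤ j → Adj (n ∸ i) i (down (suc j))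
    down-i′ zero 0<i i≤0 = contradiction 0<i (ℕ.≤⇒≯ i≤0)
    down-i′ (suc j) 0<i i≤ with ℕ.m≤n⇒m<n∨m≡n i≤
    ... | inj₁ (s≤s i≤j) = there (there (down-i′ j 0<i i≤j))
    down-i′ (suc zero) 0<i i≤ | inj₂ refl = there here
    down-i′ (suc (suc j)) 0<i i≤ | inj₂ refl = there here

    down-∈ : ∀ j {i} → 0 < i → i ≤ j → i ∈ down j
    down-∈ zero    0<i i≤0 = contradiction 0<i (ℕ.≤⇒≯ i≤0)
    down-∈ (suc j)         = down-∈′ j

    down-n∸ : ∀ j {i} → 0 < i → i < j → Adj (suc i) (n ∸ i) (down j)
    down-n∸ (suc j) 0<i (s≤s i≤j) = down-n∸′ j 0<i i≤j

    down-i : ∀ j {i} → 0 < i → i < j → Adj (n ∸ i) i (down j)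
    down-i (suc j) 0<i (s≤s i≤j) = down-i′ j 0<i i≤j

    down-starts : ∀ j → 0 < j → Starts j (down j)
    down-starts (suc zero)    _ = _ , refl
    down-starts (suc (suc j)) _ = _ , refl

    down-ends : ∀ j → 0 < j → Ends 1 (down j)
    down-ends (suc zero)    _ = [] , refl
    down-ends (suc (suc j)) _ = Ends-++ (suc (suc j) ∷ (n ∸ suc j) ∷ []) (down-ends (suc j) (s≤s z≤n))

    in-zig₁ : ∀ {a b} → Adj a b (zig c (suc κ) ++ (M ∸ (suc κ + c)) ∷ down r ++ zig κ 0) → Adj a b body
    in-zig₁ = subst (λ j → Adj _ _ (zig c (suc κ) ++ (M ∸ j) ∷ down r ++ zig κ 0)) (sym s≡)

    in-down : ∀ {a b} → Adj a b (down r) → Adj a b body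
    in-down p = Adj-++ʳ (zig c (suc κ)) (there (Adj-++ˡ p))

    in-zig₂ : ∀ {a b} → Adj a b (zig κ 0) → Adj a b body
    in-zig₂ p = Adj-++ʳ (zig c (suc κ)) (there (Adj-++ʳ (down r) p))

  -- d is congruent to the difference of two neighbours of the list.
  Neighbours : ℕ → Set
  Neighbours d = ∃₂ λ a b → Adj a b body × (a + d ≡ b ⊎ a + d ≡ b + n)

  data Difference (d : ℕ) : Set where
    neighbours : Neighbours d → Difference d
    is-y       : d ≡ suc (κ + κ) → Difference d
    is-c       : d + (κ + κ) ≡ n → Difference d
    is-x⁻¹     : d + (suc κ + suc κ) ≡ n → Difference d

  private
    -- The zigzag rises from M - e to M + e + 1. At e = `κ` this is the omitted move from `x` to
    -- `c`.
    odd-up : ∀ e → e < s → Difference (suc (e + e))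
    odd-up e e<s with ℕ.<-cmp e κ
    ... | tri< e<κ _ _ = neighbours (_ , _ , in-zig₂ (zig-up κ z≤n e<κ) , inj₁ (advance (ℕ.<⇒≤ e<s)))
      where
      advance : e ≤ s → (M ∸ e) + suc (e + e) ≡ M + suc e
      advance e≤s = trans (rearrange (M ∸ e) e) (cong (_+ suc e) (M∸-+ e≤s))
        where
        rearrange : ∀ a e → a + suc (e + e) ≡ (a + e) + suc e
        rearrange = solve-∀
    ... | tri≈ _ refl _ = is-y refl
    ... | tri> _ _ κ<e = neighbours (_ , _ , Adj-++ˡ (zig-up c κ<e (subst (e <_) s≡ e<s)) , inj₁ (advance (ℕ.<⇒≤ e<s)))
      where
      advance : e ≤ s → (M ∸ e) + suc (e + e) ≡ M + suc e
      advance e≤s = trans (rearrange (M ∸ e) e) (cong (_+ suc e) (M∸-+ e≤s))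
        where
        rearrange : ∀ a e → a + suc (e + e) ≡ (a + e) + suc e
        rearrange = solve-∀

    -- The zigzag falls from M + i to M - i. The falls at i = `κ` and i = `κ` + 1 are the omitted
    -- moves into `x` and out of `c`.
    odd-down : ∀ {d} i → 0 < i → i ≤ s → d + (i + i) ≡ n → Difference d
    odd-down {d} (suc i) _ i<s eq with ℕ.<-cmp (suc i) κ
    ... | tri< i<κ _ _ = neighbours (_ , _ , in-zig₂ (zig-down′ κ z≤n i<κ) , inj₂ (retreat i<s))
      where
      rearrange : ∀ a d i → (a + suc i) + suc i + d ≡ a + (d + (suc i + suc i))
      rearrange = solve-∀
      retreat : suc i ≤ s → M + suc i + d ≡ (M ∸ suc i) + n
      retreat le = trans (cong (λ k → k + suc i + d) (sym (M∸-+ le))) (trans (rearrange (M ∸ suc i) d i) (cong ((M ∸ suc i) +_) eq))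
    ... | tri≈ _ refl _ = is-c eq
    ... | tri> _ _ (s≤s κ≤i) with ℕ.m≤n⇒m<n∨m≡n κ≤i
    ...   | inj₂ refl = is-x⁻¹ eq
    ...   | inj₁ κ<i = neighbours (_ , _ , in-zig₁ (zig-down c κ<i (subst (i <_) s≡ i<s)) , inj₂ (retreat i<s))
      where
      rearrange : ∀ a d i → (a + suc i) + suc i + d ≡ a + (d + (suc i + suc i))
      rearrange = solve-∀
      retreat : suc i ≤ s → M + suc i + d ≡ (M ∸ suc i) + n
      retreat le = trans (cong (λ k → k + suc i + d) (sym (M∸-+ le))) (trans (rearrange (M ∸ suc i) d i) (cong ((M ∸ suc i) +_) eq))

    r≤n : ∀ {i} → i < r → i ≤ n
    r≤n i<r = ℕ.≤-trans (ℕ.<⇒≤ i<r) (ℕ.≤-trans (ℕ.m≤n+m r s) (ℕ.≤-trans (ℕ.m≤m+n h h) (ℕ.n≤1+n _)))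

    even-small : ∀ e → 0 < e → e < r → Difference (e + e)
    even-small e 0<e e<r = neighbours (_ , _ , in-down (down-i r 0<e e<r) , inj₂ (trans (sym (ℕ.+-assoc (n ∸ e) e e))
      (trans (cong (_+ e) (ℕ.m∸n+n≡m (r≤n e<r))) (ℕ.+-comm n e))))

    even-large : ∀ {d} i → 0 < i → i < r → d + suc (i + i) ≡ n → Difference d
    even-large {d} i 0<i i<r eq = neighbours (_ , _ , in-down (down-n∸ r 0<i i<r) , inj₁ (ℕ.+-cancelʳ-≡ i _ _
      (trans (trans (rearrange i d) eq) (sym (ℕ.m∸n+n≡m (r≤n i<r))))))
      where
      rearrange : ∀ i d → suc i + d + i ≡ d + suc (i + i)
      rearrange = solve-∀

    h-step : Difference h
    h-step = neighbours (1 , M , Adj-++ʳ (zig c (suc κ)) (there (Adj-join (down r) (zig κ 0) (down-ends r 0<r) (zig-starts κ 0<κ))) , inj₁ refl)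
      where
      zig-starts : ∀ cnt → 0 < cnt → Starts M (zig cnt 0)
      zig-starts (suc cnt) _ = _ , refl

    M∸s : M ∸ s ≡ suc r
    M∸s = trans (cong (_∸ s) (cong suc (ℕ.+-comm s r))) (ℕ.m+n∸n≡m (suc r) s)

    minus-one : Difference (h + h)
    minus-one = neighbours (M ∸ s , r , Adj-++ʳ (zig c (suc κ)) (Adj-join ((M ∸ s) ∷ []) _ ([] , refl) (Starts-++ _ (down-starts r 0<r))) ,
      inj₂ (trans (cong (_+ (h + h)) M∸s) (sym (ℕ.+-suc r (h + h)))))

    halves-< : ∀ {a b} → a + a < b + b → a < b
    halves-< {a} {b} lt = ℕ.≰⇒> λ b≤a → ℕ.≤⇒≯ (ℕ.+-mono-≤ b≤a b≤a) lt

    -- The part `down` yields 2e for e < r and for s < e < h, and 2h = -1 is the move into it. A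
    -- value with r ≤ e ≤ s is left over only if r = s; it is then 2s = h, which is the move from 1
    -- back to M.
    even-case : ∀ e → 0 < e → e ≤ h → Difference (e + e)
    even-case e 0<e e≤h with e <? r
    ... | yes e<r = even-small e 0<e e<r
    ... | no e≮r with ℕ.m≤n⇒m<n∨m≡n e≤h
    ...   | inj₂ refl = minus-one
    ...   | inj₁ e<h with s <? e
    ...     | yes s<e = even-large (h ∸ e) (ℕ.m<n⇒0<n∸m e<h)
                (ℕ.+-cancelˡ-< e _ _ (subst (_< e + r) (sym (ℕ.m+[n∸m]≡n e≤h)) (ℕ.+-monoˡ-< r s<e)))
                (trans (rearrange e (h ∸ e)) (cong (λ k → suc (k + k)) (ℕ.m+[n∸m]≡n e≤h)))
      where
      rearrange : ∀ e i → e + e + suc (i + i) ≡ suc ((e + i) + (e + i))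
      rearrange = solve-∀
    ...     | no s≮e = [ (λ r≡s → let s≡e = ℕ.≤-antisym (subst (_≤ e) r≡s (ℕ.≮⇒≥ e≮r)) (ℕ.≮⇒≥ s≮e) in
                               subst Difference (cong₂ _+_ s≡e (trans r≡s s≡e)) h-step)
                         , (λ r≡1+s → contradiction (ℕ.≮⇒≥ e≮r) (ℕ.<⇒≱ (subst (e <_) (sym r≡1+s) (s≤s (ℕ.≮⇒≥ s≮e))))) ]′ balance

    -- The rises give e < s and the falls give e ≥ r. A value in between is left over only if r = s
    -- + 1; it is then 2s + 1 = h, again the move from 1 to M. This is the purpose of `balance`.
    odd-case : ∀ e → e < h → Difference (suc (e + e))
    odd-case e e<h with e <? s
    ... | yes e<s = odd-up e e<s
    ... | no e≮s with e <? r
    ...   | no e≮r = odd-down (h ∸ e) (ℕ.m<n⇒0<n∸m e<h)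
              (ℕ.+-cancelʳ-≤ e _ _ (subst (_≤ s + e) (sym (ℕ.m∸n+n≡m (ℕ.<⇒≤ e<h))) (ℕ.+-monoʳ-≤ s (ℕ.≮⇒≥ e≮r))))
              (cong suc (trans (rearrange e (h ∸ e)) (cong (λ k → k + k) (ℕ.m+[n∸m]≡n (ℕ.<⇒≤ e<h)))))
      where
      rearrange : ∀ e i → e + e + (i + i) ≡ (e + i) + (e + i)
      rearrange = solve-∀
    ...   | yes e<r = [ (λ r≡s → contradiction (subst (e <_) r≡s e<r) e≮s)
                      , (λ r≡1+s → subst Difference (trans (cong (s +_) r≡1+s) (trans (ℕ.+-suc s s) (cong (λ k → suc (k + k))
                          (ℕ.≤-antisym (ℕ.≮⇒≥ e≮s) (ℕ.≤-pred (subst (e <_) r≡1+s e<r)))))) h-step) ]′ balance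

  differences : ∀ d → 0 < d → d < n → Difference d
  differences d 0<d d<n with parity d
  ... | zero  , inj₁ refl = contradiction 0<d (ℕ.<-irrefl refl)
  ... | e@(suc _) , inj₁ refl = even-case e (s≤s z≤n) (ℕ.≮⇒≥ λ h<e → ℕ.≤⇒≯ (ℕ.≤-pred d<n) (ℕ.+-mono-< h<e h<e))
  ... | e , inj₂ refl = odd-case e (halves-< (ℕ.≤-pred d<n))

  data Position (i : ℕ) : Set where
    in-body : i ∈ body → Position i
    is-0    : i ≡ 0 → Position i
    is-c    : i ≡ M + suc κ → Position i
    is-x    : i + κ ≡ M → Position i

  private
    below : ∀ j → 0 < j → j ≤ s → Position (M ∸ j)
    below j 0<j j≤s with ℕ.<-cmp j κ
    ... | tri< j<κ _ _ = in-body (∈-++⁺ʳ (zig c (suc κ)) (there (∈-++⁺ʳ (down r) (zig-∈ˡ κ z≤n j<κ))))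
    ... | tri≈ _ refl _ = is-x (M∸-+ j≤s)
    ... | tri> _ _ κ<j with ℕ.m≤n⇒m<n∨m≡n j≤s
    ...   | inj₂ refl = in-body (∈-++⁺ʳ (zig c (suc κ)) (here refl))
    ...   | inj₁ j<s  = in-body (∈-++⁺ˡ (zig-∈ˡ c κ<j (subst (j <_) s≡ j<s)))

    above : ∀ j → j < s → Position (M + suc j)
    above j j<s with ℕ.<-cmp j κ
    ... | tri< j<κ _ _ = in-body (∈-++⁺ʳ (zig c (suc κ)) (there (∈-++⁺ʳ (down r) (zig-∈ʳ κ z≤n j<κ))))
    ... | tri≈ _ refl _ = is-c refl
    ... | tri> _ _ κ<j = in-body (∈-++⁺ˡ (zig-∈ʳ c κ<j (subst (j <_) s≡ j<s)))

  -- Residues up to r and residues above M + s lie in `down`, as j and as - j. The others are within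
  -- distance s of M and belong to the zigzag, whose two omitted members are `x` and `c`.
  positions : ∀ i → i < n → Position i
  positions zero _ = is-0 refl
  positions i@(suc _) i<n with i ≤? r
  ... | yes i≤r = in-body (∈-++⁺ʳ (zig c (suc κ)) (there (∈-++⁺ˡ (down-∈ r (s≤s z≤n) i≤r))))
  ... | no i≰r with ℕ.<-cmp i M
  ...   | tri≈ _ refl _ = in-body (∈-++⁺ʳ (zig c (suc κ)) (there (∈-++⁺ʳ (down r) (M∈ κ 0<κ))))
    where
    M∈ : ∀ cnt → 0 < cnt → M ∈ zig cnt 0
    M∈ (suc _) _ = here refl
  ...   | tri< i<M _ _ = subst Position (ℕ.m∸[m∸n]≡n (ℕ.<⇒≤ i<M)) (below (M ∸ i) (ℕ.m<n⇒0<n∸m i<M)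
            (ℕ.+-cancelʳ-≤ i _ _ (subst (_≤ s + i) (sym (ℕ.m∸n+n≡m (ℕ.<⇒≤ i<M)))
              (subst (_≤ s + i) (ℕ.+-suc s r) (ℕ.+-monoʳ-≤ s (ℕ.≰⇒> i≰r))))))
  ...   | tri> _ _ M<i with i ∸ suc M | ℕ.m+[n∸m]≡n M<i
  ...     | j | M+j with j <? s
  ...       | yes j<s = subst Position (trans (ℕ.+-suc M j) M+j) (above j j<s)
  ...       | no j≮s = in-body (∈-++⁺ʳ (zig c (suc κ)) (there (∈-++⁺ˡ (subst (_∈ down r) (ℕ.m∸[m∸n]≡n (ℕ.<⇒≤ i<n))
                (Adj-∈ˡ (down-i r (ℕ.m<n⇒0<n∸m i<n) n∸i<r))))))
    where
    n∸i<r : n ∸ i < r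
    n∸i<r = ℕ.+-cancelʳ-< i _ _ (subst (_< r + i) (sym (ℕ.m∸n+n≡m (ℕ.<⇒≤ i<n)))
      (subst (λ k → n < r + k) M+j (subst (n <_) (rearrange r h j) (s≤s (s≤s (ℕ.≤-trans (ℕ.≤-reflexive (ℕ.+-comm h h))
        (ℕ.≤-trans (ℕ.+-monoʳ-≤ h (ℕ.≤-trans (ℕ.≤-reflexive (ℕ.+-comm s r)) (ℕ.+-monoʳ-≤ r (ℕ.≮⇒≥ j≮s)))) ℕ.≤-refl)))))))
      where
      rearrange : ∀ r h j → suc (suc (h + (r + j))) ≡ r + suc (suc (h + j))
      rearrange = solve-∀

module Family (q m : ℕ) .{{_ : NonZero q}} .{{_ : NonZero m}} (coprime : Coprime q m) (κ c s r : ℕ)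
  (s≡ : s ≡ suc κ + c) (sum≡ : s + r ≡ suc (κ + κ + κ)) (0<r : 0 < r) (balance : r ≡ s ⊎ r ≡ suc s)
  (1<q : 1 < q) (q∣k : q ∣ suc (κ + κ)) (qm≡ : q * m ≡ 3 * suc (κ + κ)) where

  open Zigzag κ c s r s≡ sum≡ 0<r balance
  open Quotient q m (λ _ d → d)
  open Weighted {q} {m} (λ _ d → d)
  open Coefficients {Q}
  private
    module Rq = Residues q
    module Rm = Residues m

    k : ℕ
    k = suc (κ + κ)

    M≡ : M ≡ suc (suc (κ + κ + κ))
    M≡ = cong suc sum≡

    n≡qm : n ≡ q * m
    n≡qm = trans (cong (λ j → suc (j + j)) sum≡) (trans (triple κ) (sym qm≡))
      where
      triple : ∀ κ → suc (suc (κ + κ + κ) + suc (κ + κ + κ)) ≡ 3 * suc (κ + κ)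
      triple = solve-∀

    -- The Chinese remainder map. Since `q` divides `k`, the element y = k gets degree 0, while x =
    -- k + 1 and c = 2k + 1 get degree 1.
    ψ : ℕ → Q
    ψ i = Rq.red i , Rm.red i

    ψ-∗ : ∀ i j → ψ i ∗ ψ j ≡ ψ (i + j)
    ψ-∗ i j = cong₂ _,_ (Rq.red-+ i j) (Rm.red-+ i j)

    ψ-n : ∀ i → ψ (i + n) ≡ ψ i
    ψ-n i = cong₂ _,_
      (Rq.red-cong (trans (cong (λ j → (i + j) % q) (trans n≡qm (ℕ.*-comm q m))) (DM.[m+kn]%n≡m%n i m q)))
      (Rm.red-cong (trans (cong (λ j → (i + j) % m) n≡qm) (DM.[m+kn]%n≡m%n i q m)))

    ψ-sum : ∀ {i j l} → i + j ≡ l → ψ i ∗ ψ j ≡ ψ l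
    ψ-sum {i} {j} eq = trans (ψ-∗ i j) (cong ψ eq)

    ψ-sum-n : ∀ {i j l} → i + j ≡ l + n → ψ i ∗ ψ j ≡ ψ l
    ψ-sum-n {i} {j} {l} eq = trans (ψ-sum eq) (ψ-n l)

    %-∣ : ∀ {d i j} .{{_ : NonZero d}} → i ≤ j → i % d ≡ j % d → d ∣ (j ∸ i)
    %-∣ {d} {i} {j} i≤j eq = m%n≡0⇒n∣m (j ∸ i) d (residue (j ∸ i) (trans (cong (_% d) (ℕ.m+[n∸m]≡n i≤j)) (sym eq)))
      where
      residue : ∀ l → (i + l) % d ≡ i % d → l % d ≡ 0
      residue l e = n∣m⇒m%n≡0 l d (∣m+n∣m⇒∣n (m%n≡0⇒n∣m _ d whole) (n∣m*n (i DM./ d)))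
        where
        q₁ q₂ : ℕ
        q₁ = i DM./ d
        q₂ = (i + l) DM./ d
        aligned : q₁ * d + l ≡ q₂ * d
        aligned = ℕ.+-cancelˡ-≡ (i % d) _ _ (trans (sym (ℕ.+-assoc (i % d) (q₁ * d) l)) (trans (cong (_+ l) (sym (DM.m≡m%n+[m/n]*n i d)))
          (trans (DM.m≡m%n+[m/n]*n (i + l) d) (cong (_+ q₂ * d) e))))
        whole : (q₁ * d + l) % d ≡ 0
        whole = trans (cong (_% d) aligned) (DM.m*n%n≡0 q₂ d)

    ψ-injective-≤ : ∀ {i j} → i ≤ j → j < n → ψ i ≡ ψ j → i ≡ j
    ψ-injective-≤ {i} {j} i≤j j<n eq = ℕ.≤-antisym i≤j (ℕ.m∸n≡0⇒m≤n j∸i≡0)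
      where
      residues : ∀ {d} .{{_ : NonZero d}} → Residues.red d i ≡ Residues.red d j → i % d ≡ j % d
      residues {d} e = trans (sym (Residues.toℕ-red d i)) (trans (cong toℕ e) (Residues.toℕ-red d j))
      q∣ : q ∣ (j ∸ i)
      q∣ = %-∣ i≤j (residues (cong proj₁ eq))
      m∣ : m ∣ (j ∸ i)
      m∣ = %-∣ i≤j (residues (cong proj₂ eq))
      qm∣ : (q * m) ∣ (j ∸ i)
      qm∣ with divides m′ eq′ ← m∣ with divides l eq″ ← coprime-divisor {q} {m} coprime (subst (q ∣_) (trans eq′ (ℕ.*-comm m′ m)) q∣)
        = divides l (trans eq′ (trans (cong (_* m) eq″) (ℕ.*-assoc l q m)))
      j∸i≡0 : j ∸ i ≡ 0
      j∸i≡0 with j ∸ i | qm∣ | ℕ.m∸n≤m j i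
      ... | zero  | _   | _  = refl
      ... | suc d | dv | le = contradiction (ℕ.≤-trans (∣⇒≤ dv) le) (ℕ.<⇒≱ (subst (j <_) n≡qm j<n))

    Q↔ : Q ↔ Fin (q * m)
    Q↔ = ↔-sym Fin.*↔×

    bound : ∀ (i : Fin (q * m)) → toℕ i < n
    bound i = subst (toℕ i <_) (sym n≡qm) (Fin.toℕ<n i)

    index : Fin (q * m) → Fin (q * m)
    index i = Inverse.to Q↔ (ψ (toℕ i))

    index-injective : Injective _≡_ _≡_ index
    index-injective {i} {j} eq with ℕ.≤-total (toℕ i) (toℕ j) | Finite.to-injective Q↔ {ψ (toℕ i)} {ψ (toℕ j)} eq
    ... | inj₁ i≤j | e = Fin.toℕ-injective (ψ-injective-≤ i≤j (bound j) e)
    ... | inj₂ j≤i | e = Fin.toℕ-injective (sym (ψ-injective-≤ j≤i (bound i) (sym e)))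

    ψ-onto : ∀ g → ∃ λ i → i < n × ψ i ≡ g
    ψ-onto g with i , eq ← injective⇒surjective index index-injective (Inverse.to Q↔ g) =
      toℕ i , bound i , Finite.to-injective Q↔ eq

    M∸suc-κ : M ∸ suc κ ≡ k
    M∸suc-κ = trans (cong (_∸ suc κ) M≡) (ℕ.m+n∸n≡m (suc (κ + κ)) κ)

    body-starts : Starts k body
    body-starts = go c s≡
      where
      go : ∀ c → s ≡ suc κ + c → Starts k (zig c (suc κ) ++ (M ∸ s) ∷ down r ++ zig κ 0)
      go zero    eq = _ , cong (_∷ down r ++ zig κ 0) (trans (cong (M ∸_) (trans eq (ℕ.+-identityʳ (suc κ)))) M∸suc-κ)
      go (suc c) eq = _ , cong (_∷ ((M + suc (suc κ)) ∷ zig c (suc (suc κ)) ++ (M ∸ s) ∷ down r ++ zig κ 0)) M∸suc-κ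

    zig-ends : ∀ cnt i → 0 < cnt → Ends (M + (i + cnt)) (zig cnt i)
    zig-ends (suc zero) i _ = _ ∷ [] , cong (λ j → (M ∸ i) ∷ (M + j) ∷ []) (ℕ.+-comm 1 i)
    zig-ends (suc (suc cnt)) i _ = Ends-++ ((M ∸ i) ∷ (M + suc i) ∷ [])
      (subst (λ j → Ends (M + j) (zig (suc cnt) (suc i))) (sym (ℕ.+-suc i (suc cnt))) (zig-ends (suc cnt) (suc i) (s≤s z≤n)))

    body-ends : Ends (M + κ) body
    body-ends = Ends-++ (zig c (suc κ)) (Ends-++ ((M ∸ s) ∷ down r) (zig-ends κ 0 0<κ))

    zig-length : ∀ cnt i → length (zig cnt i) ≡ cnt + cnt
    zig-length zero      i = refl
    zig-length (suc cnt) i = cong suc (trans (cong suc (zig-length cnt (suc i))) (sym (ℕ.+-suc cnt cnt)))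

    down-length : ∀ j → 0 < j → suc (length (down j)) ≡ j + j
    down-length (suc zero)    _ = refl
    down-length (suc (suc j)) _ = trans (cong (2 +_) (down-length (suc j) (s≤s z≤n))) (cong suc (sym (ℕ.+-suc (suc j) (suc j))))

    body-length : 3 + length body ≡ n
    body-length = trans (cong (3 +_) (trans (List.length-++ (zig c (suc κ))) (cong₂ _+_ (zig-length c (suc κ))
        (trans (cong suc (List.length-++ (down r))) (cong₂ _+_ (down-length r 0<r) (zig-length κ 0))))))
      (trans (collect c r κ) (cong (λ j → suc ((j + r) + (j + r))) (sym s≡)))
      where
      collect : ∀ c r κ → 3 + ((c + c) + ((r + r) + (κ + κ))) ≡ suc (((suc κ + c) + r) + ((suc κ + c) + r))
      collect = solve-∀

    split-three : ∀ {X : Set} {y : X} {L} → Starts y L → 3 ≤ length L → ∃ λ g → ∃₂ λ g′ gs → L ≡ y ∷ g ∷ g′ ∷ gs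
    split-three ([]         , refl) (s≤s ())
    split-three (_ ∷ []     , refl) (s≤s (s≤s ()))
    split-three (g ∷ g′ ∷ gs , refl) _ = g , g′ , gs , refl

    map-Starts : ∀ {y L} → Starts y L → Starts (ψ y) (map ψ L)
    map-Starts (ys , refl) = map ψ ys , refl

    map-Ends : ∀ {y L} → Ends y L → Ends (ψ y) (map ψ L)
    map-Ends (ys , refl) = map ψ ys , List.map-++ ψ ys _

    long : 3 ≤ length (map ψ body)
    long = subst (3 ≤_) (sym (List.length-map ψ body)) (ℕ.+-cancelˡ-≤ 3 _ _ (subst (6 ≤_) (sym body-length)
      (subst (λ j → 6 ≤ suc (j + j)) (sym sum≡) (s≤s (ℕ.+-mono-≤ {2} {suc (κ + κ + κ)} {3} (s≤s (ℕ.≤-trans 0<κ (ℕ.m≤n+m κ (κ + κ))))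
        (s≤s (ℕ.+-mono-≤ {1} {κ + κ} (ℕ.≤-trans 0<κ (ℕ.m≤m+n κ κ)) 0<κ)))))))

    abstract
      decomposition : ∃ λ g → ∃₂ λ g′ gs → map ψ body ≡ ψ k ∷ g ∷ g′ ∷ gs
      decomposition = split-three (map-Starts body-starts) long

    g g′ : Q
    g  = proj₁ decomposition
    g′ = proj₁ (proj₂ decomposition)
    gs : List Q
    gs = proj₁ (proj₂ (proj₂ decomposition))
    shape : map ψ body ≡ ψ k ∷ g ∷ g′ ∷ gs
    shape = proj₂ (proj₂ (proj₂ decomposition))

    gs-length : 6 + length gs ≡ n
    gs-length = trans (cong (λ L → 3 + length L) (sym shape)) (trans (cong (3 +_) (List.length-map ψ body)) body-length)

    negative-Ends : ∀ {h′} ys {j} → length ys ≡ j + j → Ends (h′ , neg) (negative (ys ∷ʳ h′))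
    negative-Ends []           _ = [] , refl
    negative-Ends (_ ∷ [])     {suc j} eq with () ← trans (ℕ.suc-injective eq) (ℕ.+-suc j j)
    negative-Ends (w ∷ w′ ∷ ys) {suc j} eq = Ends-++ ((w , neg) ∷ (w′ , pos) ∷ [])
      (negative-Ends ys {j} (ℕ.suc-injective (ℕ.suc-injective (trans eq (cong suc (ℕ.+-suc j j))))))

    tail-Ends : ∀ {X : Set} {h′ y y₁ y₂ : X} {L} → 0 < length L → Ends h′ (y ∷ y₁ ∷ y₂ ∷ L) → Ends h′ L
    tail-Ends {y = y} {y₁} {y₂} {L = _ ∷ _} _ es = suffix-Ends (y ∷ y₁ ∷ y₂ ∷ []) es (_ , refl)

    gs-Ends : Ends (ψ (M + κ)) gs
    gs-Ends = tail-Ends (ℕ.+-cancelˡ-< 6 _ _ (subst (6 <_) (sym gs-length) (subst (λ j → 6 < suc (j + j)) (sym sum≡) big)))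
      (subst (Ends (ψ (M + κ))) shape (map-Ends body-ends))
      where
      big : 6 < suc (suc (κ + κ + κ) + suc (κ + κ + κ))
      big = s≤s (ℕ.+-mono-≤ {3} {suc (κ + κ + κ)} {3} three three)
        where
        three : 3 ≤ suc (κ + κ + κ)
        three = s≤s (ℕ.+-mono-≤ {1} {κ + κ} (ℕ.≤-trans 0<κ (ℕ.m≤m+n κ κ)) 0<κ)

    V : List (Q × Coefficient)
    V = weighted (ψ k) g g′ gs

    -- As `n` is odd, so is the length of `gs`; therefore the alternation that starts with `neg`
    -- after `dbl` also ends with `neg`.
    V-ends : Ends (ψ (M + κ) , neg) V
    V-ends with ys , eq ← gs-Ends with parity (length ys)
    ... | j , inj₁ e = Ends-++ ((ψ k , nega) ∷ (g , pos) ∷ (g′ , dbl) ∷ [])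
          (subst (λ L → Ends (ψ (M + κ) , neg) (negative L)) (sym eq) (negative-Ends ys {j} e))
    ... | j , inj₂ e = contradiction (ℕ.suc-injective (trans (sym gs-length) (cong (6 +_)
            (trans (cong length eq) (trans (List.length-++ ys) (trans (ℕ.+-comm (length ys) 1) (cong suc e)))))))
            (λ e′ → double≢odd h (3 + j) (trans e′ (eight j)))
      where
      eight : ∀ j → 7 + (j + j) ≡ suc ((3 + j) + (3 + j))
      eight = solve-∀

    cℕ : ℕ
    cℕ = suc (k + k)

    cℕ≡ : M + suc κ ≡ cℕ
    cℕ≡ = trans (cong (_+ suc κ) M≡) (eq κ)
      where
      eq : ∀ κ → suc (suc (κ + κ + κ)) + suc κ ≡ suc (suc (κ + κ) + suc (κ + κ))
      eq = solve-∀

    n≡ : n ≡ suc (suc (κ + κ + κ) + suc (κ + κ + κ))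
    n≡ = cong (λ j → suc (j + j)) sum≡

    inverse : ℕ
    inverse = suc (κ + κ + κ + κ)

    ψ-covers : ∀ i → i < n → ψ i ≡ 1Q ⊎ ψ i ≡ ψ cℕ ⊎ ψ i ≡ ψ (suc k) ⊎ ∃ λ w → (ψ i , w) ∈ V
    ψ-covers i i<n with positions i i<n
    ... | in-body i∈ = inj₂ (inj₂ (inj₂ (weighted-covers (subst (ψ i ∈_) shape (∈-map⁺ ψ i∈)))))
    ... | is-0 refl  = inj₁ refl
    ... | is-c refl  = inj₂ (inj₁ (cong ψ cℕ≡))
    ... | is-x eq    = inj₂ (inj₂ (inj₁ (cong ψ (ℕ.+-cancelʳ-≡ κ i (suc k) (trans eq M≡)))))

    ψ-steps : ∀ d → d < n → ψ d ≡ 1Q ⊎ ψ d ≡ ψ k ⊎ ψ d ≡ ψ inverse ⊎ ψ d ≡ ψ cℕ ⊎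
      ∃₂ λ s s′ → Adj s s′ V × proj₁ s ∗ ψ d ≡ proj₁ s′
    ψ-steps zero _ = inj₁ refl
    ψ-steps d@(suc _) d<n with differences d (s≤s z≤n) d<n
    ... | is-y refl = inj₂ (inj₁ refl)
    ... | is-c eq   = inj₂ (inj₂ (inj₂ (inj₁ (cong ψ (ℕ.+-cancelʳ-≡ (κ + κ) d cℕ (trans eq (trans n≡ (rearrange κ))))))))
      where
      rearrange : ∀ κ → suc (suc (κ + κ + κ) + suc (κ + κ + κ)) ≡ suc (suc (κ + κ) + suc (κ + κ)) + (κ + κ)
      rearrange = solve-∀
    ... | is-x⁻¹ eq = inj₂ (inj₂ (inj₁ (cong ψ (ℕ.+-cancelʳ-≡ (suc κ + suc κ) d inverse (trans eq (trans n≡ (rearrange κ)))))))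
      where
      rearrange : ∀ κ → suc (suc (κ + κ + κ) + suc (κ + κ + κ)) ≡ suc (κ + κ + κ + κ) + (suc κ + suc κ)
      rearrange = solve-∀
    ... | neighbours (a , b , adj , sum) = inj₂ (inj₂ (inj₂ (inj₂ (weighted-steps
            (ψ a , ψ b , subst (Adj (ψ a) (ψ b)) shape (Adj-map ψ adj) , [ ψ-sum , ψ-sum-n ]′ sum)))))

    k%q : k % q ≡ 0
    k%q = n∣m⇒m%n≡0 k q q∣k

    degree : ∀ i → deg (ψ (i + k)) ≡ i % q
    degree i = trans (Rq.toℕ-red (i + k)) (trans (DM.%-distribˡ-+ i k q)
      (trans (cong (λ j → (i % q + j) % q) k%q) (trans (cong (_% q) (ℕ.+-identityʳ (i % q))) (DM.m%n%n≡m%n i q))))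

  rstar : RStar q m (λ _ d → d)
  rstar = record
    { x = ψ (suc k) ; y = ψ k ; c = ψ cℕ ; h = ψ (M + κ) ; x⁻¹ = ψ inverse ; V = V
    ; V-starts = _ , refl ; V-ends = V-ends ; V-allowed = weighted-allowed gs
    ; deg-x = trans (degree 1) (DM.m<n⇒m%n≡m 1<q)
    ; deg-c = trans (degree (suc k)) (trans (sym (Rq.toℕ-red (suc k))) (trans (degree 1) (DM.m<n⇒m%n≡m 1<q)))
    ; deg-y = trans (degree 0) (DM.m*n%n≡0 0 q)
    ; deg-1 = trans (Rq.toℕ-red 0) (DM.m*n%n≡0 0 q)
    ; x∗y = ψ-sum refl
    ; x∗x⁻¹ = ψ-sum-n {l = 0} (trans (e₁ κ) (sym n≡))
    ; c∗x⁻¹ = ψ-sum-n (trans (e₂ κ) (cong (k +_) (sym n≡)))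
    ; h∗y = ψ-sum-n {l = 0} (trans (cong (λ j → j + κ + k) M≡) (trans (e₃ κ) (sym n≡)))
    ; h∗c = ψ-sum-n (trans (cong (λ j → j + κ + cℕ) M≡) (trans (e₄ κ) (cong (suc k +_) (sym n≡))))
    ; 1∗y = ψ-sum refl ; 1∗c = ψ-sum refl
    ; x∗1 = ψ-sum (ℕ.+-identityʳ _) ; c∗1 = ψ-sum (ℕ.+-identityʳ _) ; 1∗1 = ψ-sum {0} {0} refl
    ; covers = covers ; steps = steps
    ; size = trans (cong (3 +_) (trans (sym (List.length-map proj₁ V)) (trans (cong length (weighted-support (ψ k) g g′ gs))
        (trans (cong length (sym shape)) (List.length-map ψ body))))) (trans body-length n≡qm) }
    where
    covers : ∀ g → g ≡ 1Q ⊎ g ≡ ψ cℕ ⊎ g ≡ ψ (suc k) ⊎ ∃ λ w → (g , w) ∈ V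
    covers g with i , i<n , refl ← ψ-onto g = ψ-covers i i<n
    steps : ∀ δ → δ ≡ 1Q ⊎ δ ≡ ψ k ⊎ δ ≡ ψ inverse ⊎ δ ≡ ψ cℕ ⊎ ∃₂ λ s s′ → Adj s s′ V × proj₁ s ∗ δ ≡ proj₁ s′
    steps δ with d , d<n , refl ← ψ-onto δ = ψ-steps d d<n
    e₁ : ∀ κ → suc (suc (κ + κ)) + suc (κ + κ + κ + κ) ≡ suc (suc (κ + κ + κ) + suc (κ + κ + κ))
    e₁ = solve-∀
    e₂ : ∀ κ → suc (suc (κ + κ) + suc (κ + κ)) + suc (κ + κ + κ + κ) ≡ suc (κ + κ) + suc (suc (κ + κ + κ) + suc (κ + κ + κ))
    e₂ = solve-∀
    e₃ : ∀ κ → suc (suc (κ + κ + κ)) + κ + suc (κ + κ) ≡ suc (suc (κ + κ + κ) + suc (κ + κ + κ))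
    e₃ = solve-∀
    e₄ : ∀ κ → suc (suc (κ + κ + κ)) + κ + suc (suc (κ + κ) + suc (κ + κ)) ≡ suc (suc (κ + κ)) + suc (suc (κ + κ + κ) + suc (κ + κ + κ))
    e₄ = solve-∀

-- Here `s` is half of 3κ + 1, rounded down. It has to exceed `κ` so that the zigzag reaches `c` and
-- y; for even `κ` the bound 2 ≤ κ ensures this.
family : ∀ q m .{{_ : NonZero q}} .{{_ : NonZero m}} → Coprime q m → ∀ κ → 2 ≤ κ → 1 < q → q ∣ suc (κ + κ) →
  q * m ≡ 3 * suc (κ + κ) → RStar q m (λ _ d → d)
family q m coprime κ 2≤κ 1<q q∣k qm≡ with parity (suc (κ + κ + κ))
... | i , inj₁ eq = Family.rstar q m coprime κ (i ∸ suc κ) i i (sym (ℕ.m+[n∸m]≡n κ<i)) (sym eq) (ℕ.≤-trans (s≤s z≤n) κ<i) (inj₁ refl) 1<q q∣k qm≡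
  where
  κ<i : κ < i
  κ<i = ℕ.≰⇒> λ i≤κ → ℕ.<⇒≱ (s≤s (ℕ.m≤m+n (κ + κ) κ)) (subst (_≤ κ + κ) (sym eq) (ℕ.+-mono-≤ i≤κ i≤κ))
... | i , inj₂ eq = Family.rstar q m coprime κ (i ∸ suc κ) i (suc i) (sym (ℕ.m+[n∸m]≡n κ<i)) (trans (ℕ.+-suc i i) (sym eq)) (s≤s z≤n) (inj₂ refl) 1<q q∣k qm≡
  where
  κ<i : κ < i
  κ<i = ℕ.≰⇒> λ i≤κ → ℕ.<⇒≱ (ℕ.≤-trans (ℕ.≤-reflexive (ℕ.+-comm 2 (κ + κ))) (ℕ.+-monoʳ-≤ (κ + κ) 2≤κ))
    (ℕ.≤-trans (ℕ.≤-reflexive (ℕ.suc-injective eq)) (ℕ.≤-trans (ℕ.+-mono-≤ i≤κ i≤κ) (ℕ.n≤1+n _)))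

-- Products, exponents and integer multiples

×-isAbelianGroup : ∀ {X Y : Set} {_+ˣ_ : X → X → X} {0ˣ : X} {⊖ˣ_ : X → X} {_+ʸ_ : Y → Y → Y} {0ʸ : Y} {⊖ʸ_ : Y → Y} →
  IsAbelianGroup _≡_ _+ˣ_ 0ˣ ⊖ˣ_ → IsAbelianGroup _≡_ _+ʸ_ 0ʸ ⊖ʸ_ →
  IsAbelianGroup _≡_ (λ (a , b) (c , d) → (a +ˣ c) , (b +ʸ d)) (0ˣ , 0ʸ) (λ (a , b) → (⊖ˣ a) , (⊖ʸ b))
×-isAbelianGroup isX isY = record
  { isGroup = record
    { isMonoid = record
      { isSemigroup = record
        { isMagma = record { isEquivalence = isEquivalence ; ∙-cong = λ { refl refl → refl } }
        ; assoc = λ _ _ _ → cong₂ _,_ (X.assoc _ _ _) (Y.assoc _ _ _) }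
      ; identity = (λ _ → cong₂ _,_ (X.identityˡ _) (Y.identityˡ _)) , (λ _ → cong₂ _,_ (X.identityʳ _) (Y.identityʳ _)) }
    ; inverse = (λ _ → cong₂ _,_ (X.inverseˡ _) (Y.inverseˡ _)) , (λ _ → cong₂ _,_ (X.inverseʳ _) (Y.inverseʳ _))
    ; ⁻¹-cong = λ { refl → refl } }
  ; comm = λ _ _ → cong₂ _,_ (X.comm _ _) (Y.comm _ _) }
  where
  module X = Abelian isX
  module Y = Abelian isY

module Exponents {N : Set} {_⊕_ : N → N → N} {0ᴺ : N} {⊖_ : N → N} (isAb : IsAbelianGroup _≡_ _⊕_ 0ᴺ ⊖_) where
  open Abelian isAb

  -- The sum of all elements does not change when x is added to each of them.
  lagrange : ∀ {ν} → N ↔ Fin ν → ∀ x → ν • x ≡ 0ᴺ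
  lagrange {ν} N↔ν x = ⊕-cancelʳ (total all) (ν • x) 0ᴺ (trans (trans (cong (λ k → (k • x) ⊕ total all) (sym length-all))
    (trans (sym (total-shift all)) (total-↭ (same-elements (Unique.map⁺ (⊕-cancelˡ x _ _) all-unique) all-unique shifted-complete all-complete))))
    (sym (identityˡ (total all))))
    where
    open Inverse N↔ν using (from; strictlyInverseˡ; strictlyInverseʳ)
    all : List N
    all = map from (allFin ν)
    from-injective : ∀ {i j} → from i ≡ from j → i ≡ j
    from-injective {i} {j} eq = trans (sym (strictlyInverseˡ i)) (trans (cong (Inverse.to N↔ν) eq) (strictlyInverseˡ j))
    all-unique : Unique all
    all-unique = Unique.map⁺ from-injective (Unique.allFin⁺ ν)
    all-complete : ∀ y → y ∈ all
    all-complete y = subst (_∈ all) (strictlyInverseʳ y) (∈-map⁺ from (∈-allFin (Inverse.to N↔ν y)))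
    shifted-complete : ∀ y → y ∈ map (x ⊕_) all
    shifted-complete y = subst (_∈ map (x ⊕_) all)
      (trans (comm x _) (trans (assoc y _ x) (trans (cong (y ⊕_) (inverseˡ x)) (identityʳ y)))) (∈-map⁺ (x ⊕_) (all-complete (y ⊕ (⊖ x))))
    length-all : length all ≡ ν
    length-all = Counting.complete-length N↔ν all-unique all-complete
    total : List N → N
    total = foldr _⊕_ 0ᴺ
    total-shift : ∀ ys → total (map (x ⊕_) ys) ≡ (length ys • x) ⊕ total ys
    total-shift []       = sym (identityˡ 0ᴺ)
    total-shift (y ∷ ys) = trans (cong ((x ⊕ y) ⊕_) (total-shift ys)) (interchange x y _ _)
    total-↭ : ∀ {ys zs} → ys ↭ zs → total ys ≡ total zs
    total-↭ Perm.refl = refl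
    total-↭ (Perm.prep y p) = cong (y ⊕_) (total-↭ p)
    total-↭ (Perm.swap y z p) = trans (sym (assoc y z _)) (trans (cong₂ _⊕_ (comm y z) (total-↭ p)) (assoc z y _))
    total-↭ (Perm.trans p p′) = trans (total-↭ p) (total-↭ p′)

  multiple-0 : ∀ k {j x} → j • x ≡ 0ᴺ → (k * j) • x ≡ 0ᴺ
  multiple-0 k {j} {x} eq = trans (sym (•-assoc x k j)) (trans (cong (k •_) eq) (•-0 k))

  coprime-0 : ∀ {j k x} → Coprime j k → j • x ≡ 0ᴺ → k • x ≡ 0ᴺ → x ≡ 0ᴺ
  coprime-0 {j} {k} {x} co jx kx with coprime-Bézout co
  ... | Bézout.+- a b eq = trans (sym (identityʳ x)) (trans (cong (x ⊕_) (sym (multiple-0 b kx))) (trans (cong (_• x) eq) (multiple-0 a jx)))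
  ... | Bézout.-+ a b eq = trans (sym (identityʳ x)) (trans (cong (x ⊕_) (sym (multiple-0 a jx))) (trans (cong (_• x) eq) (multiple-0 b kx)))

  -- Integer multiples turn relations between combinations of two elements into polynomial
  -- identities over ℤ and divisibility by p, where determinants can be eliminated by a ring solver.
  zmul : ℤ → N → N
  zmul (ℤ.+ k)    x = k • x
  zmul -[1+ k ] x = ⊖ (suc k • x)

  zmul-⊖ : ∀ j k x → zmul (j ℤ.⊖ k) x ≡ (j • x) ⊕ (⊖ (k • x))
  zmul-⊖ zero    zero    x = sym (inverseʳ 0ᴺ)
  zmul-⊖ zero    (suc k) x = sym (identityˡ _)
  zmul-⊖ (suc j) zero    x = sym (trans (cong ((suc j • x) ⊕_) ⊖-0) (identityʳ _))
  zmul-⊖ (suc j) (suc k) x = trans (cong (λ z → zmul z x) (ℤ.[1+m]⊖[1+n]≡m⊖n j k)) (trans (zmul-⊖ j k x) (sym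
    (trans (cong ((x ⊕ (j • x)) ⊕_) (sym (⊖-⊕ x (k • x)))) (trans (interchange x _ (⊖ x) _)
      (trans (cong (_⊕ ((j • x) ⊕ (⊖ (k • x)))) (inverseʳ x)) (identityˡ _))))))

  zmul-+ : ∀ i j x → zmul (i ℤ.+ j) x ≡ zmul i x ⊕ zmul j x
  zmul-+ (ℤ.+ i)    (ℤ.+ j)    x = •-+ x i j
  zmul-+ (ℤ.+ i)    -[1+ j ] x = zmul-⊖ i (suc j) x
  zmul-+ -[1+ i ] (ℤ.+ j)    x = trans (zmul-⊖ j (suc i) x) (comm _ _)
  zmul-+ -[1+ i ] -[1+ j ] x = trans (cong (λ k → ⊖ (suc k • x)) (sym (ℕ.+-suc i j)))
    (trans (cong ⊖_ (•-+ x (suc i) (suc j))) (sym (⊖-⊕ (suc i • x) (suc j • x))))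

  zmul-neg : ∀ i x → zmul (ℤ.- i) x ≡ ⊖ zmul i x
  zmul-neg i x = ⊖-unique (zmul i x) (zmul (ℤ.- i) x) (trans (sym (zmul-+ i (ℤ.- i) x)) (cong (λ z → zmul z x) (ℤ.+-inverseʳ i)))

  zmul-• : ∀ k i x → zmul (ℤ.+ k ℤ.* i) x ≡ k • zmul i x
  zmul-• zero    i x = cong (λ z → zmul z x) (ℤ.*-zeroˡ i)
  zmul-• (suc k) i x = trans (cong (λ z → zmul z x) (ℤ.suc-* (ℤ.+ k) i)) (trans (zmul-+ i (ℤ.+ k ℤ.* i) x) (cong (zmul i x ⊕_) (zmul-• k i x)))

  zmul-∣ : ∀ {d} i {x} → d ∣ ∣ i ∣ → d • x ≡ 0ᴺ → zmul i x ≡ 0ᴺ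
  zmul-∣ (ℤ.+ i)    {x} (divides k eq) dx = trans (cong (_• x) eq) (multiple-0 k dx)
  zmul-∣ -[1+ i ] {x} (divides k eq) dx = trans (cong (λ j → ⊖ (j • x)) eq) (trans (cong ⊖_ (multiple-0 k dx)) ⊖-0)

  zmul-0 : ∀ i → zmul i 0ᴺ ≡ 0ᴺ
  zmul-0 (ℤ.+ i)    = •-0 i
  zmul-0 -[1+ i ] = trans (cong ⊖_ (•-0 (suc i))) ⊖-0

  zmul-0⁻ : ∀ i {x} → zmul i x ≡ 0ᴺ → ∣ i ∣ • x ≡ 0ᴺ
  zmul-0⁻ (ℤ.+ i)    eq = eq
  zmul-0⁻ -[1+ i ] eq = ⊖-injective (trans eq (sym ⊖-0))

module Homomorphism {N M : Set} {_⊕_ : N → N → N} {0ᴺ : N} {⊖_ : N → N} {_⊞_ : M → M → M} {0ᴹ : M} {⊟_ : M → M}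
  (isN : IsAbelianGroup _≡_ _⊕_ 0ᴺ ⊖_) (isM : IsAbelianGroup _≡_ _⊞_ 0ᴹ ⊟_) (f : N → M)
  (f-⊕ : ∀ x y → f (x ⊕ y) ≡ f x ⊞ f y) where
  private
    module N = Abelian isN
    module M = Abelian isM

  hom-0 : f 0ᴺ ≡ 0ᴹ
  hom-0 = M.⊕-cancelˡ (f 0ᴺ) _ _ (trans (sym (f-⊕ 0ᴺ 0ᴺ)) (trans (cong f (N.identityˡ 0ᴺ)) (sym (M.identityʳ _))))

  hom-⊖ : ∀ x → f (⊖ x) ≡ ⊟ f x
  hom-⊖ x = M.⊖-unique (f x) (f (⊖ x)) (trans (sym (f-⊕ x (⊖ x))) (trans (cong f (N.inverseʳ x)) hom-0))

  hom-• : ∀ k x → f (k N.• x) ≡ k M.• f x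
  hom-• zero    x = hom-0
  hom-• (suc k) x = trans (f-⊕ x _) (cong (f x ⊞_) (hom-• k x))

  hom-zmul : ∀ i x → f (Exponents.zmul isN i x) ≡ Exponents.zmul isM i (f x)
  hom-zmul (ℤ.+ k)    x = hom-• k x
  hom-zmul -[1+ k ] x = trans (hom-⊖ _) (cong ⊟_ (hom-• (suc k) x))

module OddOrder {N : Set} {_⊕_ : N → N → N} {0ᴺ : N} {⊖_ : N → N} (isAb : IsAbelianGroup _≡_ _⊕_ 0ᴺ ⊖_)
  {ν : ℕ} (exponent : ∀ x → Abelian._•_ isAb ν x ≡ 0ᴺ) (2∤ν : ¬ (2 ∣ ν)) (3∤ν : ¬ (3 ∣ ν)) where
  open Abelian isAb
  open Exponents isAb

  private
    prime-coprime : ∀ {d} → Prime d → ¬ (d ∣ ν) → Coprime d ν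
    prime-coprime {d} d-prime d∤ν (i∣d , i∣ν) with prime⇒irreducible d-prime i∣d
    ... | inj₁ i≡1 = i≡1
    ... | inj₂ refl = contradiction i∣ν d∤ν

  two-free : Prime 2 → ∀ x → x ⊕ x ≡ 0ᴺ → x ≡ 0ᴺ
  two-free p₂ x eq = coprime-0 (prime-coprime p₂ 2∤ν) (trans (two-• x) eq) (exponent x)

  three-free : Prime 3 → ∀ x → x ⊕ (x ⊕ x) ≡ 0ᴺ → x ≡ 0ᴺ
  three-free p₃ x eq = coprime-0 (prime-coprime p₃ 3∤ν) (trans (cong (x ⊕_) (two-• x)) eq) (exponent x)

∣-small : ∀ {p i} → p ∣ i → i < p → i ≡ 0
∣-small {i = zero}  _   _   = refl
∣-small {i = suc i} p∣i i<p = contradiction i<p (ℕ.≤⇒≯ (∣⇒≤ p∣i))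

Prime⇒1< : ∀ {p} → Prime p → 1 < p
Prime⇒1< {zero}        p-prime = contradiction p-prime ¬prime[0]
Prime⇒1< {suc zero}    p-prime = contradiction p-prime ¬prime[1]
Prime⇒1< {suc (suc _)} _       = s≤s (s≤s z≤n)

carrier↔ : (B : FinAbGroup) → FinAbGroup.Carrier B ↔ Fin (FinAbGroup.order B)
carrier↔ B = mk↔ₛ′ (proj₁ ∘ onto) enum (λ i → proj₁ enum-bijective (proj₂ (onto (enum i)) refl)) (λ b → proj₂ (onto b) refl)
  where
  open FinAbGroup B
  onto : ∀ b → ∃ λ i → ∀ {j} → j ≡ i → enum j ≡ b
  onto = proj₂ enum-bijective

-- Two independent directions modulo p

-- N has a quotient V of order p² , and v , w ∈ N of order p map to a basis of it.
module Plane {N : Set} {_⊕_ : N → N → N} {0ᴺ : N} {⊖_ : N → N} (isN : IsAbelianGroup _≡_ _⊕_ 0ᴺ ⊖_)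
  {V : Set} {_⊞_ : V → V → V} {0ⱽ : V} {⊟_ : V → V} (isV : IsAbelianGroup _≡_ _⊞_ 0ⱽ ⊟_)
  (π : N → V) (π-⊕ : ∀ x y → π (x ⊕ y) ≡ π x ⊞ π y) {ν : ℕ} (N↔ν : N ↔ Fin ν)
  (p : ℕ) .{{_ : NonZero p}} (p-prime : Prime p) (V↔ : V ↔ (Fin p × Fin p))
  (kernel : List N) (kernel-sound : ∀ {n} → n ∈ kernel → π n ≡ 0ⱽ) (kernel-complete : ∀ n → π n ≡ 0ⱽ → n ∈ kernel)
  (v w : N) (v-torsion : Abelian._•_ isN p v ≡ 0ᴺ) (w-torsion : Abelian._•_ isN p w ≡ 0ᴺ)
  (independent : ∀ i j → π (Exponents.zmul isN i v ⊕ Exponents.zmul isN j w) ≡ 0ⱽ → (ℤ.+ p ℤ∣.∣ i) × (ℤ.+ p ℤ∣.∣ j)) where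

  open Abelian isN
  open Exponents isN
  private
    module V = Abelian isV
    module Π = Homomorphism isN isV π π-⊕

  lin : ℤ → ℤ → N
  lin i j = zmul i v ⊕ zmul j w

  lin-⊕ : ∀ i j i′ j′ → lin i j ⊕ lin i′ j′ ≡ lin (i ℤ.+ i′) (j ℤ.+ j′)
  lin-⊕ i j i′ j′ = trans (interchange (zmul i v) _ _ _) (sym (cong₂ _⊕_ (zmul-+ i i′ v) (zmul-+ j j′ w)))

  lin-⊖ : ∀ i j → ⊖ lin i j ≡ lin (ℤ.- i) (ℤ.- j)
  lin-⊖ i j = trans (sym (⊖-⊕ (zmul i v) (zmul j w))) (sym (cong₂ _⊕_ (zmul-neg i v) (zmul-neg j w)))

  lin-• : ∀ k i j → k • lin i j ≡ lin (ℤ.+ k ℤ.* i) (ℤ.+ k ℤ.* j)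
  lin-• k i j = trans (•-⊕ (zmul i v) (zmul j w) k) (sym (cong₂ _⊕_ (zmul-• k i v) (zmul-• k j w)))

  lin-torsion : ∀ i j → p • lin i j ≡ 0ᴺ
  lin-torsion i j = trans (lin-• p i j) (trans (cong₂ _⊕_ (trans (zmul-• p i v) (torsion i v-torsion)) (trans (zmul-• p j w) (torsion j w-torsion))) (identityˡ 0ᴺ))
    where
    torsion : ∀ i {x} → p • x ≡ 0ᴺ → p • zmul i x ≡ 0ᴺ
    torsion i {x} eq = trans (sym (zmul-• p i x)) (zmul-∣ (ℤ.+ p ℤ.* i) (divides ∣ i ∣ (trans (ℤ.abs-* (ℤ.+ p) i) (ℕ.*-comm p ∣ i ∣))) eq)

  lin-zero : ∀ {i j} → lin i j ≡ 0ᴺ → (ℤ.+ p ℤ∣.∣ i) × (ℤ.+ p ℤ∣.∣ j)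
  lin-zero {i} {j} eq = independent i j (trans (cong π eq) Π.hom-0)

  lin-injective : ∀ {i j i′ j′} → lin i j ≡ lin i′ j′ → (ℤ.+ p ℤ∣.∣ (i ℤ.- i′)) × (ℤ.+ p ℤ∣.∣ (j ℤ.- j′))
  lin-injective {i} {j} {i′} {j′} eq = lin-zero (trans (sym (lin-⊕ i j (ℤ.- i′) (ℤ.- j′)))
    (trans (cong₂ _⊕_ eq (sym (lin-⊖ i′ j′))) (inverseʳ (lin i′ j′))))

  module Arrange (κ′ : ℕ) (p≡ : suc (suc κ′ + suc κ′) ≡ p) (ε : ℕ) (exponent : ∀ a → suc (ε + ε) • a ≡ 0ᴺ) where
    private
      open Finite N↔ν using (_≟_)
      open Harmonious isN _≟_ ε

      κ k : ℕ
      κ = suc κ′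
      k = suc (κ + κ)

      InKernel : N → Set
      InKernel n = π n ≡ 0ⱽ

      -- The kernel of `π` is the bottom layer, below the directions `y` and `x`. The predicate
      -- `InKernel` keeps the constructed list from leaving it, so membership in the list
      -- characterises the kernel.
      base : ∃ λ L → IsHarmonious L × (∀ {a} → a ∈ kernel → a ∈ L) × (∀ {a} → a ∈ L → InKernel a)
      base = subgroup exponent InKernel (λ {a} {b} e e′ → trans (π-⊕ a b) (trans (cong₂ _⊞_ e e′) (V.identityˡ 0ⱽ))) Π.hom-0 kernel kernel-sound

      L : List N
      L = 0ᴺ ∷ IsHarmonious.tail (proj₁ (proj₂ base))

      L≡ : proj₁ base ≡ L
      L≡ = IsHarmonious.head (proj₁ (proj₂ base))

      H : IsHarmonious L
      H = subst IsHarmonious L≡ (proj₁ (proj₂ base))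

      L-sound : ∀ {a} → a ∈ L → InKernel a
      L-sound {a} a∈ = proj₂ (proj₂ (proj₂ base)) (subst (a ∈_) (sym L≡) a∈)

      L-complete : ∀ n → InKernel n → n ∈ L
      L-complete n e = subst (n ∈_) L≡ (proj₁ (proj₂ (proj₂ base)) (kernel-complete n e))

      k-lin : ∀ i j → k • lin i j ≡ 0ᴺ
      k-lin i j = trans (cong (_• lin i j) p≡) (lin-torsion i j)

    module _ (x₁ x₂ y₁ y₂ : ℤ) (p∤D : ¬ (p ∣ ∣ x₁ ℤ.* y₂ ℤ.- x₂ ℤ.* y₁ ∣)) where
      private
        x y : N
        x = lin x₁ x₂
        y = lin y₁ y₂

        D : ℤ
        D = x₁ ℤ.* y₂ ℤ.- x₂ ℤ.* y₁

        from-D : ∀ i → i < p → ℤ.+ p ℤ∣.∣ (ℤ.+ i ℤ.* D) → i ≡ 0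
        from-D i i<p p∣ = [ (λ p∣i → ∣-small p∣i i<p) , (λ p∣D → contradiction p∣D p∤D) ]′
          (euclidsLemma i ∣ D ∣ p-prime (subst (p ∣_) (ℤ.abs-* (ℤ.+ i) D) (ℤ∣.∣⇒∣ᵤ p∣)))

        -- Cramer's rule: p divides both coordinates of ix - jy, and eliminating j shows that it
        -- divides iD.
        x-determinant : ∀ i j → π ((i • x) ⊕ (⊖ (j • y))) ≡ 0ⱽ → i < p → i ≡ 0
        x-determinant i j eq i<p = from-D i i<p (subst (ℤ.+ p ℤ∣.∣_) (eliminate (ℤ.+ i) (ℤ.+ j) x₁ x₂ y₁ y₂)
          (ℤ∣.∣m∣n⇒∣m-n (ℤ∣.∣m⇒∣m*n y₂ (proj₁ parts)) (ℤ∣.∣m⇒∣m*n y₁ (proj₂ parts))))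
          where
          combine : (i • x) ⊕ (⊖ (j • y)) ≡ lin (ℤ.+ i ℤ.* x₁ ℤ.+ (ℤ.- (ℤ.+ j ℤ.* y₁))) (ℤ.+ i ℤ.* x₂ ℤ.+ (ℤ.- (ℤ.+ j ℤ.* y₂)))
          combine = trans (cong₂ _⊕_ (lin-• i x₁ x₂) (trans (cong ⊖_ (lin-• j y₁ y₂)) (lin-⊖ (ℤ.+ j ℤ.* y₁) (ℤ.+ j ℤ.* y₂)))) (lin-⊕ (ℤ.+ i ℤ.* x₁) (ℤ.+ i ℤ.* x₂) (ℤ.- (ℤ.+ j ℤ.* y₁)) (ℤ.- (ℤ.+ j ℤ.* y₂)))
          parts : (ℤ.+ p ℤ∣.∣ (ℤ.+ i ℤ.* x₁ ℤ.+ (ℤ.- (ℤ.+ j ℤ.* y₁)))) × (ℤ.+ p ℤ∣.∣ (ℤ.+ i ℤ.* x₂ ℤ.+ (ℤ.- (ℤ.+ j ℤ.* y₂))))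
          parts = independent _ _ (trans (cong π (sym combine)) eq)
          eliminate : ∀ i j x₁ x₂ y₁ y₂ → (i ℤ.* x₁ ℤ.+ (ℤ.- (j ℤ.* y₁))) ℤ.* y₂ ℤ.- (i ℤ.* x₂ ℤ.+ (ℤ.- (j ℤ.* y₂))) ℤ.* y₁ ≡ i ℤ.* (x₁ ℤ.* y₂ ℤ.- x₂ ℤ.* y₁)
          eliminate = ℤSolver.solve-∀

        y-determinant : ∀ j → π (j • y) ≡ 0ⱽ → j < p → j ≡ 0
        y-determinant j eq j<p = from-D j j<p (subst (ℤ.+ p ℤ∣.∣_) (eliminate (ℤ.+ j) x₁ x₂ y₁ y₂)
          (ℤ∣.∣m∣n⇒∣m-n (ℤ∣.∣m⇒∣m*n x₁ (proj₂ parts)) (ℤ∣.∣m⇒∣m*n x₂ (proj₁ parts))))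
          where
          parts : (ℤ.+ p ℤ∣.∣ (ℤ.+ j ℤ.* y₁)) × (ℤ.+ p ℤ∣.∣ (ℤ.+ j ℤ.* y₂))
          parts = independent _ _ (trans (cong π (sym (lin-• j y₁ y₂))) eq)
          eliminate : ∀ j x₁ x₂ y₁ y₂ → (j ℤ.* y₂) ℤ.* x₁ ℤ.- (j ℤ.* y₁) ℤ.* x₂ ≡ j ℤ.* (x₁ ℤ.* y₂ ℤ.- x₂ ℤ.* y₁)
          eliminate = ℤSolver.solve-∀

        <k⇒<p : ∀ {i} → i < k → i < p
        <k⇒<p {i} = subst (i <_) p≡

        y-minimal : ∀ j → 0 < j → j < k → (j • y) ∉ L
        y-minimal j 0<j j<k j∈ = contradiction 0<j (ℕ.≤⇒≯ (ℕ.≤-reflexive (y-determinant j (L-sound j∈) (<k⇒<p j<k))))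

        zero∈L : 0ᴺ ∈ L
        zero∈L = here refl

        py∈ : (k • y) ∈ L
        py∈ = subst (_∈ L) (sym (k-lin y₁ y₂)) zero∈L

        L′ : List N
        L′ = extend exponent k y L

        H′ : IsHarmonious L′
        H′ = extend-harmonious exponent H y κ py∈ y-minimal

        px∈ : (k • x) ∈ L′
        px∈ = subst (_∈ L′) (sym (k-lin x₁ x₂)) (IsHarmonious.zero∈ H′)

        x-minimal : ∀ i → 0 < i → i < k → (i • x) ∉ L′
        x-minimal i 0<i i<k i∈ with b , j , b∈ , _ , eq ← ∈-extend⁻ exponent H y κ py∈ y-minimal i∈ =
          contradiction 0<i (ℕ.≤⇒≯ (ℕ.≤-reflexive (x-determinant i j
            (trans (cong π (trans (cong (_⊕ (⊖ (j • y))) eq) (cancel-⊖ b (j • y)))) (L-sound b∈)) (<k⇒<p i<k))))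

        span : Fin p × Fin p → N
        span (i , j) = (toℕ i • x) ⊕ (toℕ j • y)

        toℕ<k : ∀ (i : Fin p) → toℕ i < k
        toℕ<k i = subst (toℕ i <_) (sym p≡) (Fin.toℕ<n i)

        rotate : ∀ a b c → (a ⊕ b) ⊕ c ≡ a ⊕ (c ⊕ b)
        rotate a b c = trans (assoc a b c) (cong (a ⊕_) (comm b c))

        π-difference : ∀ {a b} → π a ≡ π b → π (a ⊕ (⊖ b)) ≡ 0ⱽ
        π-difference {a} {b} eq = trans (π-⊕ a (⊖ b)) (trans (cong₂ _⊞_ eq (Π.hom-⊖ b)) (V.inverseʳ (π b)))

        restore : ∀ a b → (a ⊕ (⊖ b)) ⊕ b ≡ a
        restore a b = trans (assoc a _ b) (trans (cong (a ⊕_) (inverseˡ b)) (identityʳ a))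

        span-injective : ∀ {g g′} → π (span g) ≡ π (span g′) → g ≡ g′
        span-injective {i , j} {i′ , j′} eq = cong₂ _,_ (Fin.toℕ-injective (proj₁ outer)) (Fin.toℕ-injective (proj₁ inner))
          where
          h : N
          h = span (i , j) ⊕ (⊖ span (i′ , j′))
          h∈ : h ∈ L
          h∈ = L-complete h (π-difference eq)
          equal : (0ᴺ ⊕ (toℕ j • y)) ⊕ (toℕ i • x) ≡ (h ⊕ (toℕ j′ • y)) ⊕ (toℕ i′ • x)
          equal = trans (trans (rotate 0ᴺ _ _) (identityˡ _)) (sym (trans (rotate h _ _) (restore (span (i , j)) (span (i′ , j′)))))
          member : ∀ {a} (j : Fin p) → a ∈ L → (a ⊕ (toℕ j • y)) ∈ L′
          member j a∈ = ∈-extend⁺ exponent H y κ py∈ y-minimal (toℕ j) a∈ (toℕ<k j)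
          outer : toℕ i ≡ toℕ i′ × 0ᴺ ⊕ (toℕ j • y) ≡ h ⊕ (toℕ j′ • y)
          outer = extend-coordinates exponent H′ x κ px∈ x-minimal (member j zero∈L) (member j′ h∈) (toℕ<k i) (toℕ<k i′) equal
          inner : toℕ j ≡ toℕ j′ × 0ᴺ ≡ h
          inner = extend-coordinates exponent H y κ py∈ y-minimal zero∈L h∈ (toℕ<k j) (toℕ<k j′) (proj₂ outer)

        coordinates : Fin p × Fin p → Fin p × Fin p
        coordinates g = Inverse.to V↔ (π (span g))

        V-injective : ∀ {a b} → Inverse.to V↔ a ≡ Inverse.to V↔ b → a ≡ b
        V-injective {a} {b} eq = trans (sym (Inverse.strictlyInverseʳ V↔ a)) (trans (cong (Inverse.from V↔) eq) (Inverse.strictlyInverseʳ V↔ b))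

        -- The p² combinations of x and y are distinct modulo the kernel, so they represent all p²
        -- classes; `u` differs from one of them by an element of `L`.
        full : ∀ u → u ∈ extend exponent k x L′
        full u = subst (_∈ extend exponent k x L′) (trans (rotate (u ⊕ (⊖ span g)) _ _) (restore u (span g)))
          (∈-extend⁺ exponent H′ x κ px∈ x-minimal (toℕ (proj₁ g))
            (∈-extend⁺ exponent H y κ py∈ y-minimal (toℕ (proj₂ g)) (L-complete _ (π-difference (sym π-span))) (toℕ<k (proj₂ g))) (toℕ<k (proj₁ g)))
          where
          preimage : ∃ λ g → coordinates g ≡ Inverse.to V↔ (π u)
          preimage = Finite.endo-surjective (↔-sym (Fin.*↔× {p} {p})) coordinates (λ eq → span-injective (V-injective eq)) (Inverse.to V↔ (π u))
          g : Fin p × Fin p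
          g = proj₁ preimage
          π-span : π (span g) ≡ π u
          π-span = V-injective (proj₂ preimage)

      arrange : ∀ (t t⁺ t₁ t₂ : N) → t⁺ ⊕ (⊖ t) ≡ x → t₁ ⊕ (⊖ t) ≡ y → t₂ ≢ t₁ → (∀ i → t₂ ≢ t ⊕ (i • x)) →
        Arranged.Arrangement isN t t⁺ t₁ t₂
      arrange t t⁺ t₁ t₂ x≡ y≡ = Arranged.arrangement isN _≟_ ε exponent H κ′ t t⁺ t₁ t₂ x y x≡ y≡ py∈ y-minimal px∈ x-minimal full

-- The action on the cyclic factor ℤₘ

iter-cong : ∀ {X : Set} {f g : X → X} → (∀ x → f x ≡ g x) → ∀ k x → iter k f x ≡ iter k g x
iter-cong eq zero    x = refl
iter-cong {g = g} eq (suc k) x = trans (eq _) (cong g (iter-cong eq k x))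

module Split {N : Set} {_⊕_ : N → N → N} {0ᴺ : N} {⊖_ : N → N} (isN : IsAbelianGroup _≡_ _⊕_ 0ᴺ ⊖_)
  {C : Set} {_⊞_ : C → C → C} {0ᶜ : C} {⊟_ : C → C} (isC : IsAbelianGroup _≡_ _⊞_ 0ᶜ ⊟_)
  {ν m : ℕ} (coprime : Coprime ν m)
  (N-exponent : ∀ n → Abelian._•_ isN ν n ≡ 0ᴺ) (C-exponent : ∀ c → Abelian._•_ isC m c ≡ 0ᶜ)
  (α : N × C → N × C)
  (α-+ : ∀ n c n′ c′ → α (n ⊕ n′ , c ⊞ c′) ≡ (proj₁ (α (n , c)) ⊕ proj₁ (α (n′ , c′)) , proj₂ (α (n , c)) ⊞ proj₂ (α (n′ , c′)))) where
  private
    module N = Abelian isN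
    module C = Abelian isC

    from-N : ∀ n n′ → α (n ⊕ n′ , 0ᶜ) ≡ (proj₁ (α (n , 0ᶜ)) ⊕ proj₁ (α (n′ , 0ᶜ)) , proj₂ (α (n , 0ᶜ)) ⊞ proj₂ (α (n′ , 0ᶜ)))
    from-N n n′ = trans (cong (λ c → α (n ⊕ n′ , c)) (sym (C.identityˡ 0ᶜ))) (α-+ n 0ᶜ n′ 0ᶜ)

    from-C : ∀ c c′ → α (0ᴺ , c ⊞ c′) ≡ (proj₁ (α (0ᴺ , c)) ⊕ proj₁ (α (0ᴺ , c′)) , proj₂ (α (0ᴺ , c)) ⊞ proj₂ (α (0ᴺ , c′)))
    from-C c c′ = trans (cong (λ n → α (n , c ⊞ c′)) (sym (N.identityˡ 0ᴺ))) (α-+ 0ᴺ c 0ᴺ c′)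

  αᴺ : N → N
  αᴺ n = proj₁ (α (n , 0ᶜ))

  κ : C → C
  κ c = proj₂ (α (0ᴺ , c))

  αᴺ-⊕ : ∀ n n′ → αᴺ (n ⊕ n′) ≡ αᴺ n ⊕ αᴺ n′
  αᴺ-⊕ n n′ = cong proj₁ (from-N n n′)

  κ-⊞ : ∀ c c′ → κ (c ⊞ c′) ≡ κ c ⊞ κ c′
  κ-⊞ c c′ = cong proj₂ (from-C c c′)

  private
    module N→C = Homomorphism isN isC (λ n → proj₂ (α (n , 0ᶜ))) (λ n n′ → cong proj₂ (from-N n n′))
    module C→N = Homomorphism isC isN (λ c → proj₁ (α (0ᴺ , c))) (λ c c′ → cong proj₁ (from-C c c′))

    coprime′ : Coprime m ν
    coprime′ (d∣m , d∣ν) = coprime (d∣ν , d∣m)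

  -- The image is annihilated by the coprime numbers `ν` and `m`.
  no-N→C : ∀ n → proj₂ (α (n , 0ᶜ)) ≡ 0ᶜ
  no-N→C n = Exponents.coprime-0 isC coprime
    (trans (sym (N→C.hom-• ν n)) (trans (cong (λ k → proj₂ (α (k , 0ᶜ))) (N-exponent n)) N→C.hom-0)) (C-exponent _)

  no-C→N : ∀ c → proj₁ (α (0ᴺ , c)) ≡ 0ᴺ
  no-C→N c = Exponents.coprime-0 isN coprime′
    (trans (sym (C→N.hom-• m c)) (trans (cong (λ k → proj₁ (α (0ᴺ , k))) (C-exponent c)) C→N.hom-0)) (N-exponent _)

  split : ∀ n c → α (n , c) ≡ (αᴺ n , κ c)
  split n c = trans (cong₂ (λ i j → α (i , j)) (sym (N.identityʳ n)) (sym (C.identityˡ c))) (trans (α-+ n 0ᶜ 0ᴺ c)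
    (cong₂ _,_ (trans (cong (αᴺ n ⊕_) (no-C→N c)) (N.identityʳ _)) (trans (cong (_⊞ κ c) (no-N→C n)) (C.identityˡ _))))

module CyclicAutomorphism (m : ℕ) .{{_ : NonZero m}} (κ : Fin m → Fin m)
  (κ-+ : ∀ c c′ → κ (Zmod._+ₙ_ m c c′) ≡ Zmod._+ₙ_ m (κ c) (κ c′)) where
  open Residues m
  open Zmod m using (1ₙ)

  multiplication : ∀ c → κ c ≡ (toℕ (κ 1ₙ) * toℕ c) mod m
  multiplication c = trans (cong κ (trans (sym (red-toℕ c)) (trans (cong red (sym (ℕ.*-identityʳ (toℕ c)))) (sym (•-red (toℕ c) 1)))))
    (trans (H.hom-• (toℕ c) 1ₙ) (trans (cong (A._•_ (toℕ c)) (sym (red-toℕ (κ 1ₙ)))) (trans (•-red (toℕ c) (toℕ (κ 1ₙ)))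
      (cong red (ℕ.*-comm (toℕ c) (toℕ (κ 1ₙ)))))))
    where
    module A = Abelian isAbelianGroup
    module H = Homomorphism isAbelianGroup isAbelianGroup κ κ-+

multiply : ∀ m .{{_ : NonZero m}} → ℕ → Fin m → Fin m
multiply m r c = (r * toℕ c) mod m

module _ (m : ℕ) .{{_ : NonZero m}} where
  open Residues m

  iter-multiply : ∀ r k c → iter k (multiply m r) c ≡ red (r ^ k * toℕ c)
  iter-multiply r zero    c = sym (trans (cong red (ℕ.+-identityʳ (toℕ c))) (red-toℕ c))
  iter-multiply r (suc k) c = trans (cong (multiply m r) (iter-multiply r k c)) (red-cong
    (trans (cong (λ j → (r * j) % m) (toℕ-red (r ^ k * toℕ c))) (trans (DM.%-distribˡ-* r _ m)
      (trans (cong (λ j → ((r % m) * j) % m) (DM.m%n%n≡m%n (r ^ k * toℕ c) m))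
        (trans (sym (DM.%-distribˡ-* r (r ^ k * toℕ c) m)) (cong (_% m) (sym (ℕ.*-assoc r (r ^ k) (toℕ c)))))))))

  iter-multiply-% : ∀ r k c {s} → r ^ k % m ≡ s % m → iter k (multiply m r) c ≡ red (s * toℕ c)
  iter-multiply-% r k c {s} eq = trans (iter-multiply r k c) (red-cong (trans (DM.%-distribˡ-* (r ^ k) (toℕ c) m)
    (trans (cong (λ j → (j * (toℕ c % m)) % m) eq) (sym (DM.%-distribˡ-* s (toℕ c) m)))))

-- If κ has order dividing d and q = e d + 1 then κ = κ^q.
period-one : ∀ {X : Set} {κ : X → X} {q} d e → (∀ c → iter d κ c ≡ c) → q ≡ suc (e * d) → (∀ c → iter q κ c ≡ c) → ∀ c → κ c ≡ c
period-one {κ = κ} d e period refl κ^q c = trans (cong κ (sym (iter-fixed κ period e c))) (κ^q c)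

-- The multipliers 1 and 2 have square 1 modulo 3, so the odd power κ^q equals κ. The multiplier 0
-- is impossible, since κ^q would then vanish.
trivial-on-3 : ∀ (κ : Fin 3 → Fin 3) → (∀ c c′ → κ (Zmod._+ₙ_ 3 c c′) ≡ Zmod._+ₙ_ 3 (κ c) (κ c′)) →
  ∀ ρ → (∀ c → iter (suc (ρ + ρ)) κ c ≡ c) → ∀ c → κ c ≡ c
trivial-on-3 κ κ-+ ρ κ^q = by-cases (κ (Zmod.1ₙ 3)) refl
  where
  as : ∀ {i} → κ (Zmod.1ₙ 3) ≡ i → ∀ c → κ c ≡ multiply 3 (toℕ i) c
  as refl = CyclicAutomorphism.multiplication 3 κ κ-+
  doubling : ρ + ρ ≡ ρ * 2
  doubling = trans (cong (ρ +_) (sym (ℕ.+-identityʳ ρ))) (ℕ.*-comm 2 ρ)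
  involution : ∀ {i} → κ (Zmod.1ₙ 3) ≡ i → (∀ c → iter 2 (multiply 3 (toℕ i)) c ≡ c) → ∀ c → κ c ≡ c
  involution e two = period-one 2 ρ (λ c → trans (iter-cong (as e) 2 c) (two c)) (cong suc doubling) κ^q
  by-cases : ∀ i → κ (Zmod.1ₙ 3) ≡ i → ∀ c → κ c ≡ c
  by-cases zero e with () ← trans (sym (as e _)) (κ^q (suc zero))
  by-cases (suc zero) e = involution e λ { zero → refl ; (suc zero) → refl ; (suc (suc zero)) → refl }
  by-cases (suc (suc zero)) e = involution e λ { zero → refl ; (suc zero) → refl ; (suc (suc zero)) → refl }

module AutomorphismOf9 (κ : Fin 9 → Fin 9) (κ-+ : ∀ c c′ → κ (Zmod._+ₙ_ 9 c c′) ≡ Zmod._+ₙ_ 9 (κ c) (κ c′)) where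

  private
    as : ∀ {i} → κ (Zmod.1ₙ 9) ≡ i → ∀ c → κ c ≡ multiply 9 (toℕ i) c
    as refl = CyclicAutomorphism.multiplication 9 κ κ-+

    abstract
      -- Units modulo 9 have order dividing 6, and multiples of 3 have square 0. The latter cannot
      -- have a power that is the identity, and for the former an exponent ± 1 modulo 6 forces
      -- triviality.
      unit-or-nilpotent : ∀ (i : Fin 9) → toℕ i ^ 6 % 9 ≡ 1 ⊎ toℕ i ^ 2 % 9 ≡ 0
      unit-or-nilpotent = from-yes (Fin.all? λ (i : Fin 9) → (toℕ i ^ 6 % 9 ℕ.≟ 1) ⊎-dec (toℕ i ^ 2 % 9 ℕ.≟ 0))

      cubes : ∀ (i : Fin 9) → toℕ i ^ 3 % 9 ≡ 1 → toℕ i ≡ 1 ⊎ toℕ i ≡ 4 ⊎ toℕ i ≡ 7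
      cubes = from-yes (Fin.all? λ (i : Fin 9) → (toℕ i ^ 3 % 9 ℕ.≟ 1) →-dec
        ((toℕ i ℕ.≟ 1) ⊎-dec ((toℕ i ℕ.≟ 4) ⊎-dec (toℕ i ℕ.≟ 7))))

    r : ℕ
    r = toℕ (κ (Zmod.1ₙ 9))

    power : ∀ k c {s} → r ^ k % 9 ≡ s % 9 → iter k κ c ≡ (s * toℕ c) mod 9
    power k c {s} eq = trans (iter-cong (as refl) k c) (iter-multiply-% 9 r k c {s} eq)

    unit : ∀ k → r ^ k % 9 ≡ 1 → ∀ c → iter k κ c ≡ c
    unit k eq c = trans (power k c {1} eq) (trans (cong (_mod 9) (ℕ.+-identityʳ (toℕ c))) (Residues.red-toℕ 9 c))

    nilpotent : r ^ 2 % 9 ≡ 0 → ∀ c → iter 2 κ c ≡ zero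
    nilpotent eq c = power 2 c {0} eq

    one : ∀ k → iter k κ (suc zero) ≡ suc zero → r ^ k % 9 ≡ 1
    one k eq = trans (cong (_% 9) (sym (ℕ.*-identityʳ (r ^ k)))) (trans (sym (Residues.toℕ-red 9 (r ^ k * 1)))
      (cong toℕ (trans (sym (trans (iter-cong (as refl) k (suc zero)) (iter-multiply 9 r k (suc zero)))) eq)))

  order-three : (∀ c → iter 3 κ c ≡ c) →
    ∃ λ r → (r ≡ 1 ⊎ r ≡ 4 ⊎ r ≡ 7) × (∀ c → κ c ≡ multiply 9 r c)
  order-three κ³ = r , cubes (κ (Zmod.1ₙ 9)) (one 3 (κ³ (suc zero))) , as refl

  private
    not-nilpotent : r ^ 2 % 9 ≡ 0 → ∀ k → ¬ (∀ c → iter (suc (suc k)) κ c ≡ c)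
    not-nilpotent nil k period = contradiction (trans (sym (nilpotent nil (iter k κ (suc zero)))) (period (suc zero))) λ ()

    order-6e+1 : ∀ e → (∀ c → iter (suc (e * 6)) κ c ≡ c) → ∀ c → κ c ≡ c
    order-6e+1 zero    period = period
    order-6e+1 (suc e) period = [ (λ six → period-one {q = suc (suc e * 6)} 6 (suc e) (unit 6 six) refl period)
      , (λ nil → contradiction period (not-nilpotent nil (5 + e * 6))) ]′ (unit-or-nilpotent (κ (Zmod.1ₙ 9)))

    order-6e+5 : ∀ e → (∀ c → iter (5 + e * 6) κ c ≡ c) → ∀ c → κ c ≡ c
    order-6e+5 e period = [ (λ six c → trans (cong κ (sym (five six c))) (unit 6 six c))
      , (λ nil → contradiction period (not-nilpotent nil (3 + e * 6))) ]′ (unit-or-nilpotent (κ (Zmod.1ₙ 9)))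
      where
      five : r ^ 6 % 9 ≡ 1 → ∀ c → iter 5 κ c ≡ c
      five six c = trans (cong (iter 5 κ) (sym (iter-fixed κ (unit 6 six) e c))) (trans (iter-+ κ 5 (e * 6) c) (period c))

  coprime-order : ∀ {q} e → (q ≡ suc (e * 6) ⊎ q ≡ 5 + e * 6) → (∀ c → iter q κ c ≡ c) → ∀ c → κ c ≡ c
  coprime-order e (inj₁ eq) period = order-6e+1 e λ c → trans (cong (λ k → iter k κ c) (sym eq)) (period c)
  coprime-order e (inj₂ eq) period = order-6e+5 e λ c → trans (cong (λ k → iter k κ c) (sym eq)) (period c)

-- Linear algebra over ℤₚ

module ResidueRing (n : ℕ) .{{_ : NonZero n}} where
  open Residues n public
  open Zmod n hiding (_-ₙ_)

  *ₙ-comm : ∀ i j → i *ₙ j ≡ j *ₙ i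
  *ₙ-comm i j = cong red (ℕ.*-comm (toℕ i) (toℕ j))

  *ₙ-zeroˡ : ∀ i → 0ₙ *ₙ i ≡ 0ₙ
  *ₙ-zeroˡ i = trans (cong (0ₙ *ₙ_) (sym (red-toℕ i))) (red-* 0 (toℕ i))

  *ₙ-identityˡ : ∀ i → 1ₙ *ₙ i ≡ i
  *ₙ-identityˡ i = trans (cong (1ₙ *ₙ_) (sym (red-toℕ i))) (trans (red-* 1 (toℕ i)) (trans (cong red (ℕ.*-identityˡ (toℕ i))) (red-toℕ i)))

  *ₙ-distribˡ : ∀ i j k → i *ₙ (j +ₙ k) ≡ (i *ₙ j) +ₙ (i *ₙ k)
  *ₙ-distribˡ i j k = trans (cong (_*ₙ (j +ₙ k)) (sym (red-toℕ i))) (trans (red-* (toℕ i) (toℕ j + toℕ k))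
    (trans (cong red (ℕ.*-distribˡ-+ (toℕ i) (toℕ j) (toℕ k))) (sym (red-+ (toℕ i * toℕ j) (toℕ i * toℕ k)))))

  red-0⁻ : ∀ {k} → red k ≡ 0ₙ → n ∣ k
  red-0⁻ {k} eq = m%n≡0⇒n∣m k n (trans (sym (toℕ-red k)) (trans (cong toℕ eq) (trans (toℕ-red 0) (DM.m*n%n≡0 0 n))))

  1≢0 : 1 < n → 1ₙ ≢ 0ₙ
  1≢0 1<n eq = contradiction (∣⇒≤ (red-0⁻ {1} eq)) (ℕ.<⇒≱ 1<n)

  toℕ-0⁻ : ∀ {i} → n ∣ toℕ i → i ≡ 0ₙ
  toℕ-0⁻ {i} n∣i = Fin.toℕ-injective (trans (∣-small n∣i (Fin.toℕ<n i)) (sym (trans (toℕ-red 0) (DM.m*n%n≡0 0 n))))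

-- If (1 , 0) is an eigenvector, the matrix is triangular; with distinct diagonal entries it is diagonalisable,
-- and with equal ones it is scalar, because its q-th power is the identity and p ∤ q.
module Eigenvector (p m : ℕ) .{{_ : NonZero p}} .{{_ : NonZero m}} (B : FinAbGroup) (p-prime : Prime p) where
  open ResidueRing p
  open Zmod p
  open Ambient p m B using (Vp; Mat2; mat; _·M_; det; diag; matrixOf; Diagonalisable)

  private
    isV = ×-isAbelianGroup isAbelianGroup isAbelianGroup
    module F = Abelian isAbelianGroup
    module V = Abelian isV
    module X = Homomorphism isV isAbelianGroup proj₁ (λ _ _ → refl)
    module Y = Homomorphism isV isAbelianGroup proj₂ (λ _ _ → refl)

    mat-cong : ∀ {a b c d a′ b′ c′ d′} → a ≡ a′ → b ≡ b′ → c ≡ c′ → d ≡ d′ → mat a b c d ≡ mat a′ b′ c′ d′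
    mat-cong refl refl refl refl = refl

    add-zeroˡ : ∀ {i j} → i ≡ 0ₙ → i +ₙ j ≡ j
    add-zeroˡ refl = F.identityˡ _

    add-zeroʳ : ∀ {i j} → j ≡ 0ₙ → i +ₙ j ≡ i
    add-zeroʳ refl = F.identityʳ _

    zero-mul : ∀ i → 0ₙ *ₙ i ≡ 0ₙ
    zero-mul = *ₙ-zeroˡ

    mul-zero : ∀ i → i *ₙ 0ₙ ≡ 0ₙ
    mul-zero i = trans (*ₙ-comm i 0ₙ) (*ₙ-zeroˡ i)

    mul-one : ∀ i → i *ₙ 1ₙ ≡ i
    mul-one i = trans (*ₙ-comm i 1ₙ) (*ₙ-identityˡ i)

    neg-zero : -ₙ 0ₙ ≡ 0ₙ
    neg-zero = F.⊖-0

    -- The columns (1 , 0) and (b , d - l) are eigenvectors for `l` and `d`, and their determinant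
    -- is d - l.
    distinct : ∀ l b d → l ≢ d → Diagonalisable (mat l b 0ₙ d)
    distinct l b d l≢d = mat 1ₙ b 0ₙ (d -ₙ l) , det≢0 , l , d , mat-cong
      (trans (add-zeroʳ (mul-zero b)) (trans (mul-one l) (sym (trans (add-zeroʳ (mul-zero b)) (*ₙ-identityˡ l)))))
      (trans (trans (cong (_+ₙ (b *ₙ (d -ₙ l))) (*ₙ-comm l b)) (trans (sym (*ₙ-distribˡ b l (d -ₙ l))) (cong (b *ₙ_) l+[d-l])))
        (sym (add-zeroˡ (mul-zero 1ₙ))))
      (trans (trans (add-zeroʳ (mul-zero d)) (zero-mul 1ₙ)) (sym (trans (add-zeroʳ (mul-zero (d -ₙ l))) (zero-mul l))))
      (trans (add-zeroˡ (zero-mul b)) (trans (*ₙ-comm d (d -ₙ l)) (sym (add-zeroˡ (zero-mul 0ₙ)))))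
      where
      l+[d-l] : l +ₙ (d -ₙ l) ≡ d
      l+[d-l] = trans (F.comm l _) (trans (F.assoc d _ l) (trans (cong (d +ₙ_) (F.inverseˡ l)) (F.identityʳ d)))
      det≢0 : det (mat 1ₙ b 0ₙ (d -ₙ l)) ≢ 0ₙ
      det≢0 eq = l≢d (trans (sym (F.identityʳ l)) (trans (cong (l +ₙ_) (sym d-l≡0)) l+[d-l]))
        where
        d-l≡0 : d -ₙ l ≡ 0ₙ
        d-l≡0 = trans (sym (trans (add-zeroʳ (trans (cong -ₙ_ (mul-zero b)) neg-zero)) (*ₙ-identityˡ _))) eq

    scalar : ∀ l → Diagonalisable (mat l 0ₙ 0ₙ l)
    scalar l = mat 1ₙ 0ₙ 0ₙ 1ₙ , det≢0 , l , l , mat-cong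
      (trans (add-zeroʳ (zero-mul 0ₙ)) (trans (mul-one l) (sym (trans (add-zeroʳ (zero-mul 0ₙ)) (*ₙ-identityˡ l)))))
      (trans (trans (add-zeroʳ (zero-mul 1ₙ)) (mul-zero l)) (sym (trans (add-zeroʳ (zero-mul l)) (mul-zero 1ₙ))))
      (trans (trans (add-zeroʳ (mul-zero l)) (zero-mul 1ₙ)) (sym (trans (add-zeroʳ (mul-zero 1ₙ)) (zero-mul l))))
      (trans (add-zeroˡ (zero-mul 0ₙ)) (trans (mul-one l) (sym (trans (add-zeroˡ (zero-mul 0ₙ)) (*ₙ-identityˡ l)))))
      where
      det≢0 : det (mat 1ₙ 0ₙ 0ₙ 1ₙ) ≢ 0ₙ
      det≢0 eq = 1≢0 (Prime⇒1< p-prime) (trans (sym (trans (add-zeroʳ (trans (cong -ₙ_ (zero-mul 0ₙ)) neg-zero)) (*ₙ-identityˡ 1ₙ))) eq)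

  module _ (f : Vp → Vp)
    (f-+ : ∀ i j i′ j′ → f (i +ₙ i′ , j +ₙ j′) ≡ (proj₁ (f (i , j)) +ₙ proj₁ (f (i′ , j′)) , proj₂ (f (i , j)) +ₙ proj₂ (f (i′ , j′))))
    {q′ : ℕ} (period : ∀ x → iter (suc q′) f x ≡ x) (p∤q : ¬ (p ∣ suc q′)) where

    private
      module H = Homomorphism isV isV f (λ (i , j) (i′ , j′) → f-+ i j i′ j′)

      •-point : ∀ k i j → k V.• (i , j) ≡ (red (k * toℕ i) , red (k * toℕ j))
      •-point k i j = cong₂ _,_
        (trans (X.hom-• k (i , j)) (trans (cong (k F.•_) (sym (red-toℕ i))) (•-red k (toℕ i))))
        (trans (Y.hom-• k (i , j)) (trans (cong (k F.•_) (sym (red-toℕ j))) (•-red k (toℕ j))))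

      f-• : ∀ k i j → f (k V.• (i , j)) ≡ (red (k * toℕ (proj₁ (f (i , j)))) , red (k * toℕ (proj₂ (f (i , j)))))
      f-• k i j = trans (H.hom-• k (i , j)) (•-point k _ _)

      axis₁ : ∀ k → (red k , 0ₙ) ≡ k V.• (1ₙ , 0ₙ)
      axis₁ k = cong₂ _,_ (sym (trans (X.hom-• k (1ₙ , 0ₙ)) (trans (•-red k 1) (cong red (ℕ.*-identityʳ k)))))
        (sym (trans (Y.hom-• k (1ₙ , 0ₙ)) (F.•-0 k)))

      axis₂ : ∀ k → (0ₙ , red k) ≡ k V.• (0ₙ , 1ₙ)
      axis₂ k = cong₂ _,_ (sym (trans (X.hom-• k (0ₙ , 1ₙ)) (F.•-0 k)))
        (sym (trans (Y.hom-• k (0ₙ , 1ₙ)) (trans (•-red k 1) (cong red (ℕ.*-identityʳ k)))))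

    module _ (l b : Fin p) (f-e₁ : f (1ₙ , 0ₙ) ≡ (l , 0ₙ)) (f-e₂ : f (0ₙ , 1ₙ) ≡ (b , l)) where
      private
        lℕ bℕ : ℕ
        lℕ = toℕ l
        bℕ = toℕ b

        triangular : ∀ x y → f (red x , red y) ≡ (red (x * lℕ + y * bℕ) , red (y * lℕ))
        triangular x y = trans (cong f (cong₂ _,_ (sym (F.identityʳ (red x))) (sym (F.identityˡ (red y))))) (trans (f-+ (red x) 0ₙ 0ₙ (red y))
          (cong₂ _,_
            (trans (cong₂ (λ g h → proj₁ g +ₙ proj₁ h) column₁ column₂) (red-+ (x * lℕ) (y * bℕ)))
            (trans (cong₂ (λ g h → proj₂ g +ₙ proj₂ h) column₁ column₂) (F.identityˡ _))))
          where
          column₁ : f (red x , 0ₙ) ≡ (red (x * lℕ) , 0ₙ)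
          column₁ = trans (cong f (axis₁ x)) (trans (f-• x 1ₙ 0ₙ) (cong₂ _,_ (cong (λ g → red (x * toℕ (proj₁ g))) f-e₁)
            (trans (cong (λ g → red (x * toℕ (proj₂ g))) f-e₁) (trans (cong (λ k → red (x * k)) (trans (toℕ-red 0) (DM.m*n%n≡0 0 p))) (cong red (ℕ.*-zeroʳ x))))))
          column₂ : f (0ₙ , red y) ≡ (red (y * bℕ) , red (y * lℕ))
          column₂ = trans (cong f (axis₂ y)) (trans (f-• y 0ₙ 1ₙ) (cong (λ g → (red (y * toℕ (proj₁ g)) , red (y * toℕ (proj₂ g)))) f-e₂))

        corner : ℕ → ℕ
        corner zero    = 0
        corner (suc j) = corner j * lℕ + lℕ ^ j * bℕ

        powers : ∀ j → iter j f (0ₙ , 1ₙ) ≡ (red (corner j) , red (lℕ ^ j))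
        powers zero    = refl
        powers (suc j) = trans (cong f (powers j)) (trans (triangular (corner j) (lℕ ^ j)) (cong (λ k → red (corner (suc j)) , red k) (ℕ.*-comm (lℕ ^ j) lℕ)))

        -- The corner of the j-th power of a triangular matrix with equal diagonal entries l and
        -- corner b is j b l^(j-1). The extra factor l on both sides avoids the exponent j - 1.
        corner-formula : ∀ j → corner j * lℕ ≡ j * (bℕ * lℕ ^ j)
        corner-formula zero    = refl
        corner-formula (suc j) = trans (cong (λ k → (k + lℕ ^ j * bℕ) * lℕ) (corner-formula j)) (collect j bℕ (lℕ ^ j) lℕ)
          where
          collect : ∀ j b e l → (j * (b * e) + e * b) * l ≡ suc j * (b * (l * e))
          collect = solve-∀

        p∣corner : p ∣ corner (suc q′)
        p∣corner = red-0⁻ (cong proj₁ (trans (sym (powers (suc q′))) (period (0ₙ , 1ₙ))))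

        p∣power : ∀ j → p ∣ lℕ ^ j → p ∣ lℕ
        p∣power zero    p∣1 = contradiction (∣⇒≤ p∣1) (ℕ.<⇒≱ (Prime⇒1< p-prime))
        p∣power (suc j) p∣  = [ id , p∣power j ]′ (euclidsLemma lℕ (lℕ ^ j) p-prime p∣)

        p∤l : ¬ (p ∣ lℕ)
        p∤l p∣l = 1≢0 (Prime⇒1< p-prime) (cong proj₁ (trans (sym (period (1ₙ , 0ₙ))) (trans (shift q′ (1ₙ , 0ₙ)) (trans (cong (iter q′ f) f-e₁≡0) (fixed q′)))))
          where
          shift : ∀ j x → iter (suc j) f x ≡ iter j f (f x)
          shift zero    x = refl
          shift (suc j) x = cong f (shift j x)
          f-e₁≡0 : f (1ₙ , 0ₙ) ≡ (0ₙ , 0ₙ)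
          f-e₁≡0 = trans f-e₁ (cong (_, 0ₙ) (toℕ-0⁻ p∣l))
          fixed : ∀ j → iter j f (0ₙ , 0ₙ) ≡ (0ₙ , 0ₙ)
          fixed zero    = refl
          fixed (suc j) = trans (cong f (fixed j)) H.hom-0

      -- The q-th power fixes (0 , 1), so p divides its corner and hence q b l^q; but p divides
      -- neither q nor l.
      b≡0 : b ≡ 0ₙ
      b≡0 with euclidsLemma (suc q′) (bℕ * lℕ ^ suc q′) p-prime (subst (p ∣_) (corner-formula (suc q′)) (∣-trans p∣corner (m∣m*n lℕ)))
      ... | inj₁ p∣q = contradiction p∣q p∤q
      ... | inj₂ p∣β with euclidsLemma bℕ (lℕ ^ suc q′) p-prime p∣β
      ...   | inj₁ p∣b = toℕ-0⁻ p∣b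
      ...   | inj₂ p∣l = contradiction (p∣power (suc q′) p∣l) p∤l

    not-eigenvector : ¬ Diagonalisable (matrixOf f) → proj₂ (f (1ₙ , 0ₙ)) ≢ 0ₙ
    not-eigenvector not-diagonalisable eq = cases (f (1ₙ , 0ₙ)) (f (0ₙ , 1ₙ)) refl refl eq not-diagonalisable
      where
      cases : ∀ g h → f (1ₙ , 0ₙ) ≡ g → f (0ₙ , 1ₙ) ≡ h → proj₂ g ≡ 0ₙ → ¬ ¬ Diagonalisable (mat (proj₁ g) (proj₁ h) (proj₂ g) (proj₂ h))
      cases (l , _) (b , d) f-e₁ f-e₂ refl not-diagonalisable with l Fin.≟ d
      ... | no l≢d = not-diagonalisable (distinct l b d l≢d)
      ... | yes refl = not-diagonalisable (subst (λ b → Diagonalisable (mat l b 0ₙ l)) (sym (b≡0 l b f-e₁ f-e₂)) (scalar l))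

∣-of-multiple : ∀ {d} i → ℤ.+ d ℤ∣.∣ i → d ∣ ∣ i ∣
∣-of-multiple _ = ℤ∣.∣⇒∣ᵤ

-- Choice of the cuts

-- The relations between the cuts t, t⁺, t₁, t₂ are linear; these integer combinations of v and a v solve them.
module Cuts {q m : ℕ} .{{_ : NonZero q}} .{{_ : NonZero m}} {act : ℕ → Fin m → Fin m} (S : Setup q m act)
  {V : Set} {_⊞_ : V → V → V} {0ⱽ : V} {⊟_ : V → V} (isV : IsAbelianGroup _≡_ _⊞_ 0ⱽ ⊟_)
  (π : Setup.N S → V) (π-⊕ : ∀ x y → π (Setup._⊕_ S x y) ≡ π x ⊞ π y)
  (p : ℕ) .{{_ : NonZero p}} (p-prime : Prime p) (5≤p : 5 ≤ p) (V↔ : V ↔ (Fin p × Fin p))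
  (kernel : List (Setup.N S)) (kernel-sound : ∀ {n} → n ∈ kernel → π n ≡ 0ⱽ) (kernel-complete : ∀ n → π n ≡ 0ⱽ → n ∈ kernel)
  (v : Setup.N S) (v-torsion : Abelian._•_ (Setup.isAb S) p v ≡ Setup.0ᴺ S)
  (independent : ∀ i j → π (Setup._⊕_ S (Exponents.zmul (Setup.isAb S) i v) (Exponents.zmul (Setup.isAb S) j (Setup.a S v))) ≡ 0ⱽ →
    (ℤ.+ p ℤ∣.∣ i) × (ℤ.+ p ℤ∣.∣ j))
  (κ′ : ℕ) (p≡ : suc (suc κ′ + suc κ′) ≡ p)
  (ε : ℕ) (exponent : ∀ n → Abelian._•_ (Setup.isAb S) (suc (ε + ε)) n ≡ Setup.0ᴺ S) where

  open Setup S
  private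
    module A = Abelian isAb
    module Hom = Homomorphism isAb isAb a a-⊕

    av-torsion : p A.• a v ≡ 0ᴺ
    av-torsion = trans (sym (Hom.hom-• p v)) (trans (cong a v-torsion) Hom.hom-0)

    module P = Plane isAb isV π π-⊕ N↔ν p p-prime V↔ kernel kernel-sound kernel-complete v (a v) v-torsion av-torsion independent
    open P using (lin; lin-⊕; lin-⊖; lin-•; lin-zero; lin-injective)
    open P.Arrange κ′ p≡ ε exponent using (arrange)

    p∤ : ∀ {d} .{{_ : NonZero d}} → d < 5 → ¬ (p ∣ d)
    p∤ d<5 p∣d = ℕ.<⇒≱ (ℕ.<-≤-trans d<5 5≤p) (∣⇒≤ p∣d)

    p∤8 : ¬ (p ∣ 8)
    p∤8 p∣8 = [ p∤ {2} (s≤s (s≤s (s≤s z≤n))) , p∤ {4} (s≤s (s≤s (s≤s (s≤s (s≤s z≤n))))) ]′ (euclidsLemma 2 4 p-prime p∣8)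

    p∤1 : ¬ (p ∣ 1)
    p∤1 = p∤ (s≤s (s≤s z≤n))

    p∤2 : ¬ (p ∣ 2)
    p∤2 = p∤ (s≤s (s≤s (s≤s z≤n)))

    p∤3 : ¬ (p ∣ 3)
    p∤3 = p∤ (s≤s (s≤s (s≤s (s≤s z≤n))))

    a-lin : ∀ i → a (lin i (ℤ.+ 0)) ≡ lin (ℤ.+ 0) i
    a-lin i = trans (cong a (A.identityʳ (zmul i v))) (trans (Hom.hom-zmul i v) (sym (A.identityˡ (zmul i (a v)))))
      where open Exponents isAb using (zmul)

    -- On the line, e - s would be a multiple of x modulo p, and the determinant of e - s and x
    -- would be divisible by p.
    off-line : ∀ e₁ e₂ s₁ s₂ x₁ x₂ → ¬ (p ∣ ∣ (e₁ ℤ.- s₁) ℤ.* x₂ ℤ.- (e₂ ℤ.- s₂) ℤ.* x₁ ∣) → ∀ i → lin e₁ e₂ ≢ lin s₁ s₂ ⊕ (i A.• lin x₁ x₂)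
    off-line e₁ e₂ s₁ s₂ x₁ x₂ p∤ i eq = p∤ (∣-of-multiple ((e₁ ℤ.- s₁) ℤ.* x₂ ℤ.- (e₂ ℤ.- s₂) ℤ.* x₁) (subst (ℤ.+ p ℤ∣.∣_) (eliminate (ℤ.+ i) e₁ e₂ s₁ s₂ x₁ x₂)
      (ℤ∣.∣m∣n⇒∣m-n (ℤ∣.∣m⇒∣m*n x₂ (proj₁ parts)) (ℤ∣.∣m⇒∣m*n x₁ (proj₂ parts)))))
      where
      parts : (ℤ.+ p ℤ∣.∣ (e₁ ℤ.- (s₁ ℤ.+ ℤ.+ i ℤ.* x₁))) × (ℤ.+ p ℤ∣.∣ (e₂ ℤ.- (s₂ ℤ.+ ℤ.+ i ℤ.* x₂)))
      parts = lin-injective {e₁} {e₂} {s₁ ℤ.+ ℤ.+ i ℤ.* x₁} {s₂ ℤ.+ ℤ.+ i ℤ.* x₂}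
        (trans eq (trans (cong (lin s₁ s₂ ⊕_) (lin-• i x₁ x₂)) (lin-⊕ s₁ s₂ (ℤ.+ i ℤ.* x₁) (ℤ.+ i ℤ.* x₂))))
      eliminate : ∀ i e₁ e₂ s₁ s₂ x₁ x₂ → (e₁ ℤ.- (s₁ ℤ.+ i ℤ.* x₁)) ℤ.* x₂ ℤ.- (e₂ ℤ.- (s₂ ℤ.+ i ℤ.* x₂)) ℤ.* x₁ ≡ (e₁ ℤ.- s₁) ℤ.* x₂ ℤ.- (e₂ ℤ.- s₂) ℤ.* x₁
      eliminate = ℤSolver.solve-∀

    minus : ∀ i j i′ j′ → lin i j ⊕ (⊖ lin i′ j′) ≡ lin (i ℤ.- i′) (j ℤ.- j′)
    minus i j i′ j′ = trans (cong (lin i j ⊕_) (lin-⊖ i′ j′)) (lin-⊕ i j (ℤ.- i′) (ℤ.- j′))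

    separated : ∀ i j i′ j′ → (¬ (p ∣ ∣ i ℤ.- i′ ∣)) ⊎ (¬ (p ∣ ∣ j ℤ.- j′ ∣)) → lin i j ≢ lin i′ j′
    separated i j i′ j′ (inj₁ p∤i) eq = p∤i (∣-of-multiple (i ℤ.- i′) (proj₁ (lin-injective {i} {j} {i′} {j′} eq)))
    separated i j i′ j′ (inj₂ p∤j) eq = p∤j (∣-of-multiple (j ℤ.- j′) (proj₂ (lin-injective {i} {j} {i′} {j′} eq)))

    0≡lin : 0ᴺ ≡ lin (ℤ.+ 0) (ℤ.+ 0)
    0≡lin = sym (A.identityˡ 0ᴺ)

    nonzero : ∀ i j → (¬ (p ∣ ∣ i ℤ.- ℤ.+ 0 ∣)) ⊎ (¬ (p ∣ ∣ j ℤ.- ℤ.+ 0 ∣)) → lin i j ≢ 0ᴺ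
    nonzero i j p∤ eq = separated i j (ℤ.+ 0) (ℤ.+ 0) p∤ (trans eq 0≡lin)

  -- Elimination from the three equations gives t₁ = 2a t₂ - t₂. With t₂ = v the directions are x =
  -- - v + 6a v and y = - v + 4a v, of determinant 2, and t₂ - t = v + 2a v has determinant 8 with
  -- x.
  rstar : RStar q m act → Sequenceable (Units.Γ S) (Units._·_ S) (Units.1Γ S)
  rstar R = RStarSequencing.sequenceable S R t t⁺ t₁ t₂
    (nonzero ℤ.-1ℤ (ℤ.+ 2) (inj₂ p∤2)) (nonzero (ℤ.+ 1) (ℤ.+ 0) (inj₁ p∤1))
    (λ eq → separated ℤ.-1ℤ (ℤ.+ 0) ℤ.-1ℤ (ℤ.+ 2) (inj₂ p∤2) (trans (sym (lin-⊖ (ℤ.+ 1) (ℤ.+ 0))) eq))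
    (sym (trans (cong (⊖_ ∘ a) (lin-⊕ (ℤ.+ 1) (ℤ.+ 0) (ℤ.+ 1) (ℤ.+ 0))) (trans (cong ⊖_ (a-lin (ℤ.+ 2))) (lin-⊖ (ℤ.+ 0) (ℤ.+ 2)))))
    (sym (trans (cong (t₂ ⊕_) (lin-⊕ ℤ.-1ℤ (ℤ.+ 2) ℤ.-1ℤ (ℤ.+ 2))) (lin-⊕ (ℤ.+ 1) (ℤ.+ 0) (ℤ.- ℤ.+ 2) (ℤ.+ 4))))
    (sym (lin-⊕ ℤ.-1ℤ (ℤ.+ 4) (ℤ.+ 0) (ℤ.- ℤ.+ 2)))
    (arrange ℤ.-1ℤ (ℤ.+ 6) ℤ.-1ℤ (ℤ.+ 4) p∤2 t t⁺ t₁ t₂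
      (minus ℤ.-1ℤ (ℤ.+ 4) (ℤ.+ 0) (ℤ.- ℤ.+ 2)) (minus ℤ.-1ℤ (ℤ.+ 2) (ℤ.+ 0) (ℤ.- ℤ.+ 2))
      (separated (ℤ.+ 1) (ℤ.+ 0) ℤ.-1ℤ (ℤ.+ 2) (inj₁ p∤2))
      (off-line (ℤ.+ 1) (ℤ.+ 0) (ℤ.+ 0) (ℤ.- ℤ.+ 2) ℤ.-1ℤ (ℤ.+ 6) p∤8))
    where
    t t⁺ t₁ t₂ : N
    t = lin (ℤ.+ 0) (ℤ.- ℤ.+ 2)
    t⁺ = lin ℤ.-1ℤ (ℤ.+ 4)
    t₁ = lin ℤ.-1ℤ (ℤ.+ 2)
    t₂ = lin (ℤ.+ 1) (ℤ.+ 0)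

  -- Here elimination gives t₁ = a t₂. With t₂ = v the directions are x = - 2v - 3a v and y = - v,
  -- of determinant - 3, and t₂ - t = - a v has determinant - 2 with x. The continuation `build`
  -- keeps `q` and `m` general at this point, although the walks live over ℤ₃ × ℤ₃.
  three-three : ∀ {X : Set} → (∀ t t⁺ t₁ t₂ → t₁ ≢ 0ᴺ → t₂ ≢ 0ᴺ → (⊖ t₂) ≢ t₁ → t ≡ a t₂ ⊕ t₂ →
    t⁺ ≡ (⊖ t₂) ⊕ ((⊖ t₁) ⊕ (⊖ t₁)) → t⁺ ⊕ t ≡ ⊖ t₁ → Arranged.Arrangement isAb t t⁺ t₁ t₂ → X) → X
  three-three build = build t t⁺ t₁ t₂
    (nonzero (ℤ.+ 0) (ℤ.+ 1) (inj₂ p∤1)) (nonzero (ℤ.+ 1) (ℤ.+ 0) (inj₁ p∤1))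
    (λ eq → separated ℤ.-1ℤ (ℤ.+ 0) (ℤ.+ 0) (ℤ.+ 1) (inj₁ p∤1) (trans (sym (lin-⊖ (ℤ.+ 1) (ℤ.+ 0))) eq))
    (sym (trans (cong (_⊕ t₂) (a-lin (ℤ.+ 1))) (lin-⊕ (ℤ.+ 0) (ℤ.+ 1) (ℤ.+ 1) (ℤ.+ 0))))
    (sym (trans (cong₂ (λ x y → x ⊕ (y ⊕ y)) (lin-⊖ (ℤ.+ 1) (ℤ.+ 0)) (lin-⊖ (ℤ.+ 0) (ℤ.+ 1)))
      (trans (cong (lin ℤ.-1ℤ (ℤ.+ 0) ⊕_) (lin-⊕ (ℤ.+ 0) ℤ.-1ℤ (ℤ.+ 0) ℤ.-1ℤ)) (lin-⊕ ℤ.-1ℤ (ℤ.+ 0) (ℤ.+ 0) (ℤ.- ℤ.+ 2)))))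
    (trans (lin-⊕ ℤ.-1ℤ (ℤ.- ℤ.+ 2) (ℤ.+ 1) (ℤ.+ 1)) (sym (lin-⊖ (ℤ.+ 0) (ℤ.+ 1))))
    (arrange (ℤ.- ℤ.+ 2) (ℤ.- ℤ.+ 3) ℤ.-1ℤ (ℤ.+ 0) p∤3 t t⁺ t₁ t₂
      (minus ℤ.-1ℤ (ℤ.- ℤ.+ 2) (ℤ.+ 1) (ℤ.+ 1)) (minus (ℤ.+ 0) (ℤ.+ 1) (ℤ.+ 1) (ℤ.+ 1))
      (separated (ℤ.+ 1) (ℤ.+ 0) (ℤ.+ 0) (ℤ.+ 1) (inj₁ p∤1))
      (off-line (ℤ.+ 1) (ℤ.+ 0) (ℤ.+ 1) (ℤ.+ 1) (ℤ.- ℤ.+ 2) (ℤ.- ℤ.+ 3) p∤2))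
    where
    t t⁺ t₁ t₂ : N
    t = lin (ℤ.+ 1) (ℤ.+ 1)
    t⁺ = lin ℤ.-1ℤ (ℤ.- ℤ.+ 2)
    t₁ = lin (ℤ.+ 0) (ℤ.+ 1)
    t₂ = lin (ℤ.+ 1) (ℤ.+ 0)

-- Back to the semidirect product of the theorem

transport : ∀ {X Y : Set} {_·_ : X → X → X} {1ˣ : X} {_⋆_ : Y → Y → Y} {1ʸ : Y} (X↔Y : X ↔ Y) →
  (∀ x y → Inverse.to X↔Y (x · y) ≡ Inverse.to X↔Y x ⋆ Inverse.to X↔Y y) → Inverse.to X↔Y 1ˣ ≡ 1ʸ →
  Sequenceable X _·_ 1ˣ → Sequenceable Y _⋆_ 1ʸ
transport {1ˣ = 1ˣ} {1ʸ = 1ʸ} X↔Y to-· to-1 (m , a , (a-injective , a-surjective) , d , step , d-injective , d≢1 , d-onto) =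
  m , to ∘ a , ((λ eq → a-injective (to-injective eq)) , onto) , to ∘ d ,
  (λ i → trans (cong to (step i)) (to-· _ _)) , (λ eq → d-injective (to-injective eq)) ,
  (λ i eq → d≢1 i (to-injective (trans eq (sym to-1)))) ,
  (λ y y≢1 → let i , eq = d-onto (from y) (λ eq → y≢1 (trans (sym (strictlyInverseˡ y)) (trans (cong to eq) to-1))) in
    i , trans (cong to eq) (strictlyInverseˡ y))
  where
  open Inverse X↔Y
  to-injective : ∀ {x y} → to x ≡ to y → x ≡ y
  to-injective {x} {y} eq = trans (sym (strictlyInverseʳ x)) (trans (cong from eq) (strictlyInverseʳ y))
  onto : ∀ y → ∃ λ i → ∀ {j} → j ≡ i → to (a j) ≡ y
  onto y = let i , eq = a-surjective (from y) in i , λ { refl → trans (cong to (eq refl)) (strictlyInverseˡ y) }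

odd-half : ∀ {n} → ¬ (2 ∣ n) → ∃ λ i → n ≡ suc (i + i)
odd-half {n} 2∤n with parity n
... | i , inj₁ refl = contradiction (divides i (trans (cong (i +_) (sym (ℕ.+-identityʳ i))) (ℕ.*-comm 2 i))) 2∤n
... | i , inj₂ eq   = i , eq

prime-≢⇒∤ : ∀ {d n} → Prime d → Prime n → n ≢ d → ¬ (d ∣ n)
prime-≢⇒∤ d-prime n-prime n≢d d∣n with prime⇒irreducible n-prime d∣n
... | inj₁ refl = ¬prime[1] d-prime
... | inj₂ eq = n≢d (sym eq)

∤-p²n : ∀ {d p n} → Prime d → Prime p → p ≢ d → ¬ (d ∣ n) → ¬ (d ∣ p * p * n)
∤-p²n {d} {p} {n} d-prime p-prime p≢d d∤n =
  [ [ d∤p , d∤p ]′ ∘ euclidsLemma p p d-prime , d∤n ]′ ∘ euclidsLemma (p * p) n d-prime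
  where
  d∤p : ¬ (d ∣ p)
  d∤p = prime-≢⇒∤ d-prime p-prime p≢d

∤⇒coprime : ∀ {d n} → Prime d → ¬ (d ∣ n) → Coprime n d
∤⇒coprime d-prime d∤n (i∣n , i∣d) with prime⇒irreducible d-prime i∣d
... | inj₁ i≡1 = i≡1
... | inj₂ refl = contradiction i∣n d∤n

coprime-square : ∀ {n d} → Coprime n d → Coprime n (d * d)
coprime-square {n} {d} coprime {i} (i∣n , i∣dd) = coprime (i∣n ,
  coprime-divisor {i} {d} {d} (λ (j∣i , j∣d) → coprime (∣-trans j∣i i∣n , j∣d)) i∣dd)

abstract
  2-prime : Prime 2
  2-prime = from-yes (prime? 2)

  3-prime : Prime 3
  3-prime = from-yes (prime? 3)

±1-mod-6 : ∀ {q} → ¬ (2 ∣ q) → ¬ (3 ∣ q) → ∃ λ e → q ≡ suc (e * 6) ⊎ q ≡ 5 + e * 6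
±1-mod-6 {q} 2∤q 3∤q = e , cases (q % 6) (DM.m%n<n q 6) (DM.m≡m%n+[m/n]*n q 6)
  where
  e : ℕ
  e = q DM./ 6
  shifted : ∀ {d} r → d ∣ r → d ∣ 6 → q ≡ r + e * 6 → d ∣ q
  shifted {d} r d∣r d∣6 eq = subst (d ∣_) (sym eq) (∣m∣n⇒∣m+n d∣r (∣-trans d∣6 (n∣m*n e)))
  cases : ∀ r → r < 6 → q ≡ r + e * 6 → q ≡ suc (e * 6) ⊎ q ≡ 5 + e * 6
  cases 0 _ eq = contradiction (shifted {2} 0 (divides 0 refl) (divides 3 refl) eq) 2∤q
  cases 1 _ eq = inj₁ eq
  cases 2 _ eq = contradiction (shifted {2} 2 (divides 1 refl) (divides 3 refl) eq) 2∤q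
  cases 3 _ eq = contradiction (shifted {3} 3 (divides 1 refl) (divides 2 refl) eq) 3∤q
  cases 4 _ eq = contradiction (shifted {2} 4 (divides 2 refl) (divides 3 refl) eq) 2∤q
  cases 5 _ eq = inj₂ eq
  cases (suc (suc (suc (suc (suc (suc _)))))) (s≤s (s≤s (s≤s (s≤s (s≤s (s≤s ())))))) _

half≥2 : ∀ {p i} → Prime p → p ≢ 3 → p ≡ suc (i + i) → 2 ≤ i
half≥2 {i = zero}        p-prime _   refl = contradiction p-prime ¬prime[1]
half≥2 {i = suc zero}    _       p≢3 eq   = contradiction eq p≢3
half≥2 {i = suc (suc i)} _       _   _    = s≤s (s≤s z≤n)

half≥2⇒5≤ : ∀ {p i} → 2 ≤ i → p ≡ suc (i + i) → 5 ≤ p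
half≥2⇒5≤ 2≤i refl = s≤s (ℕ.+-mono-≤ 2≤i 2≤i)

×-• : ∀ {X Y : Set} {_+ˣ_ : X → X → X} {0ˣ : X} {⊖ˣ_ : X → X} {_+ʸ_ : Y → Y → Y} {0ʸ : Y} {⊖ʸ_ : Y → Y}
  (isX : IsAbelianGroup _≡_ _+ˣ_ 0ˣ ⊖ˣ_) (isY : IsAbelianGroup _≡_ _+ʸ_ 0ʸ ⊖ʸ_) →
  ∀ k x y → Abelian._•_ (×-isAbelianGroup isX isY) k (x , y) ≡ (Abelian._•_ isX k x , Abelian._•_ isY k y)
×-• isX isY k x y = cong₂ _,_
  (Homomorphism.hom-• (×-isAbelianGroup isX isY) isX proj₁ (λ _ _ → refl) k (x , y))
  (Homomorphism.hom-• (×-isAbelianGroup isX isY) isY proj₂ (λ _ _ → refl) k (x , y))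

module Basis (p : ℕ) .{{_ : NonZero p}} (p-prime : Prime p) where
  open ResidueRing p
  open Zmod p using (0ₙ; 1ₙ; _+ₙ_)
  private
    isV = ×-isAbelianGroup isAbelianGroup isAbelianGroup
    module F = Abelian isAbelianGroup
    module E = Exponents isAbelianGroup
    module X = Homomorphism isV isAbelianGroup proj₁ (λ _ _ → refl)
    module Y = Homomorphism isV isAbelianGroup proj₂ (λ _ _ → refl)
    open Exponents isV using (zmul)

    zmul-0⇒∣ : ∀ i c → c ≢ 0ₙ → E.zmul i c ≡ 0ₙ → p ∣ ∣ i ∣
    zmul-0⇒∣ i c c≢0 eq with euclidsLemma ∣ i ∣ (toℕ c) p-prime
      (red-0⁻ (trans (sym (•-red ∣ i ∣ (toℕ c))) (trans (cong (∣ i ∣ F.•_) (red-toℕ c)) (E.zmul-0⁻ i eq))))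
    ... | inj₁ p∣i = p∣i
    ... | inj₂ p∣c = contradiction (toℕ-0⁻ p∣c) c≢0

  -- The system is triangular: the second coordinate involves only `j` and gives p ∣ j, after which
  -- the first coordinate reduces to a condition on `i`.
  independent : ∀ l d → d ≢ 0ₙ → ∀ i j g h → g ≡ zmul i (1ₙ , 0ₙ) → h ≡ zmul j (l , d) →
    (proj₁ g +ₙ proj₁ h , proj₂ g +ₙ proj₂ h) ≡ (0ₙ , 0ₙ) → (ℤ.+ p ℤ∣.∣ i) × (ℤ.+ p ℤ∣.∣ j)
  independent l d d≢0 i j g h refl refl eq = ℤ∣.∣ᵤ⇒∣ p∣i , ℤ∣.∣ᵤ⇒∣ p∣j
    where
    p∣j : p ∣ ∣ j ∣
    p∣j = zmul-0⇒∣ j d d≢0 (trans (sym (Y.hom-zmul j (l , d))) (trans (sym (F.identityˡ _))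
      (trans (cong (_+ₙ proj₂ (zmul j (l , d))) (sym (trans (Y.hom-zmul i (1ₙ , 0ₙ)) (E.zmul-0 i)))) (cong proj₂ eq))))
    p∣i : p ∣ ∣ i ∣
    p∣i = zmul-0⇒∣ i 1ₙ (1≢0 (Prime⇒1< p-prime)) (trans (sym (X.hom-zmul i (1ₙ , 0ₙ))) (trans (sym (F.identityʳ _))
      (trans (cong (proj₁ (zmul i (1ₙ , 0ₙ)) +ₙ_) (sym (trans (X.hom-zmul j (l , d)) (E.zmul-∣ j p∣j (E.lagrange (↔-id _) l))))) (cong proj₁ eq))))

module Decomposition (p q m : ℕ) .{{_ : NonZero p}} .{{_ : NonZero q}} .{{_ : NonZero m}} (B : FinAbGroup)
  (p-prime : Prime p) (5≤p : 5 ≤ p) (κ′ : ℕ) (p≡ : suc (suc κ′ + suc κ′) ≡ p)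
  (ρ : ℕ) (q≡ : q ≡ suc (ρ + ρ)) (p∤q : ¬ (p ∣ q))
  (2∤B : ¬ (2 ∣ FinAbGroup.order B)) (3∤B : ¬ (3 ∣ FinAbGroup.order B)) (p∤B : ¬ (p ∣ FinAbGroup.order B))
  (coprime : Coprime (p * p * FinAbGroup.order B) m)
  (α : Ambient.A p m B → Ambient.A p m B) (α-+ : ∀ x y → α (Ambient._+A_ p m B x y) ≡ Ambient._+A_ p m B (α x) (α y))
  (period : ∀ x → iter q α x ≡ x) (restrict-period : ∀ x → iter q (Ambient.restrict p m B α) x ≡ x)
  (not-diagonalisable : ¬ Ambient.Diagonalisable p m B (Ambient.matrixOf p m B (Ambient.restrict p m B α))) where

  open Ambient p m B using (A; Vp; _+A_; 0A; restrict)
  open FinAbGroup B using (Carrier; 0#; order) renaming (_+_ to _+B_; isAbelianGroup to isB)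
  open Zmod p using (0ₙ; 1ₙ; _+ₙ_)
  private
    module Rp = Residues p
    module Rm = Residues m

    isV = ×-isAbelianGroup Rp.isAbelianGroup Rp.isAbelianGroup
    isN = ×-isAbelianGroup isV isB

    N : Set
    N = Vp × Carrier

    0ᴺ : N
    0ᴺ = (0ₙ , 0ₙ) , 0#

    _⊕_ : N → N → N
    (f , b) ⊕ (f′ , b′) = (proj₁ f +ₙ proj₁ f′ , proj₂ f +ₙ proj₂ f′) , (b +B b′)

    ν : ℕ
    ν = p * p * order

    N↔ν : N ↔ Fin ν
    N↔ν = ↔-sym Fin.*↔× ↔-∘ (↔-sym Fin.*↔× ×-↔ carrier↔ B)

    module V = Abelian isV
    module N = Abelian isN
    module B′ = Abelian isB

    N-exponent : ∀ n → ν N.• n ≡ 0ᴺ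
    N-exponent = Exponents.lagrange isN N↔ν

    join : N → Fin m → A
    join (f , b) c = f , c , b

    α′ : N × Fin m → N × Fin m
    α′ (n , c) = let (f , c , b) = α (join n c) in (f , b) , c

    module S = Split isN Rm.isAbelianGroup {ν} {m} coprime N-exponent (Exponents.lagrange Rm.isAbelianGroup (↔-id _)) α′
      (λ n c n′ c′ → cong (λ (f , c , b) → (f , b) , c) (α-+ (join n c) (join n′ c′)))

  open S public using (κ) renaming (κ-⊞ to κ-+)

  private
    a : N → N
    a = S.αᴺ

    iter-α : ∀ k n c → iter k α (join n c) ≡ join (iter k a n) (iter k κ c)
    iter-α zero    n c = refl
    iter-α (suc k) n c = trans (cong α (iter-α k n c)) (cong (λ (n , c) → join n c) (S.split (iter k a n) (iter k κ c)))

    a-period : ∀ n → iter q a n ≡ n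
    a-period n = cong (λ (f , _ , b) → f , b) (trans (sym (iter-α q n (Zmod.0ₙ m))) (period (join n (Zmod.0ₙ m))))

  κ-period : ∀ c → iter q κ c ≡ c
  κ-period c = cong (λ (_ , c , _) → c) (trans (sym (iter-α q ((0ₙ , 0ₙ) , 0#) c)) (period (join ((0ₙ , 0ₙ) , 0#) c)))

  private
    2∤ν : ¬ (2 ∣ ν)
    2∤ν = ∤-p²n 2-prime p-prime (ℕ.>⇒≢ (ℕ.≤-trans (s≤s (s≤s (s≤s z≤n))) 5≤p)) 2∤B

    3∤ν : ¬ (3 ∣ ν)
    3∤ν = ∤-p²n 3-prime p-prime (ℕ.>⇒≢ (ℕ.≤-trans (s≤s (s≤s (s≤s (s≤s z≤n)))) 5≤p)) 3∤B

    ν-half : ∃ λ ε → ν ≡ suc (ε + ε)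
    ν-half = odd-half 2∤ν

    v : N
    v = (1ₙ , 0ₙ) , 0#

    v-torsion : p N.• v ≡ 0ᴺ
    v-torsion = trans (×-• isV isB p (1ₙ , 0ₙ) 0#) (cong₂ _,_
      (trans (×-• Rp.isAbelianGroup Rp.isAbelianGroup p 1ₙ 0ₙ) (cong₂ _,_ (F-exponent 1ₙ) (F-exponent 0ₙ))) (B′.•-0 p))
      where
      F-exponent = Exponents.lagrange Rp.isAbelianGroup (↔-id _)

    f : Vp → Vp
    f = restrict α

    f-+ : ∀ i j i′ j′ → f (i +ₙ i′ , j +ₙ j′) ≡ (proj₁ (f (i , j)) +ₙ proj₁ (f (i′ , j′)) , proj₂ (f (i , j)) +ₙ proj₂ (f (i′ , j′)))
    f-+ i j i′ j′ = trans (cong (λ b → proj₁ (a ((i +ₙ i′ , j +ₙ j′) , b))) (sym (B′.identityˡ 0#)))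
      (cong proj₁ (S.αᴺ-⊕ ((i , j) , 0#) ((i′ , j′) , 0#)))

    f-period : ∀ x → iter (suc (ρ + ρ)) f x ≡ x
    f-period x = trans (cong (λ k → iter k f x) (sym q≡)) (restrict-period x)

    -- Non-diagonalisability enters here: the image of (1 , 0) leaves the first axis, so `v` and
    -- `a v` project to a basis of ℤₚ².
    f-e₁ : proj₂ (f (1ₙ , 0ₙ)) ≢ 0ₙ
    f-e₁ = Eigenvector.not-eigenvector p m B p-prime f f-+ f-period (p∤q ∘ subst (p ∣_) (sym q≡)) not-diagonalisable

    module Π = Homomorphism isN isV proj₁ (λ _ _ → refl)

    independent : ∀ i j → proj₁ (Exponents.zmul isN i v ⊕ Exponents.zmul isN j (a v)) ≡ (0ₙ , 0ₙ) → (ℤ.+ p ℤ∣.∣ i) × (ℤ.+ p ℤ∣.∣ j)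
    independent i j eq = Basis.independent p p-prime _ _ f-e₁ i j _ _ (Π.hom-zmul i v) (Π.hom-zmul j (a v)) eq

    kernel : List N
    kernel = map ((0ₙ , 0ₙ) ,_) (map (FinAbGroup.enum B) (allFin order))

    kernel-sound : ∀ {n} → n ∈ kernel → proj₁ n ≡ (0ₙ , 0ₙ)
    kernel-sound n∈ with _ , _ , refl ← ∈-map⁻ ((0ₙ , 0ₙ) ,_) n∈ = refl

    kernel-complete : ∀ n → proj₁ n ≡ (0ₙ , 0ₙ) → n ∈ kernel
    kernel-complete (_ , b) refl = ∈-map⁺ ((0ₙ , 0ₙ) ,_) (subst (_∈ map (FinAbGroup.enum B) (allFin order))
      (Inverse.strictlyInverseʳ (carrier↔ B) b) (∈-map⁺ (FinAbGroup.enum B) (∈-allFin (Inverse.to (carrier↔ B) b))))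

  module _ (act : ℕ → Fin m → Fin m) (act-κ : ∀ k c → iter k κ c ≡ act k c) where

    setup : Setup q m act
    setup = record
      { isAb = isN ; N↔ν = N↔ν ; a = a ; a-⊕ = S.αᴺ-⊕ ; a-period = a-period ; ρ = ρ ; q-odd = q≡
      ; 2-free = OddOrder.two-free isN {ν} N-exponent 2∤ν 3∤ν 2-prime
      ; 3-free = OddOrder.three-free isN {ν} N-exponent 2∤ν 3∤ν 3-prime }

    open Semidirect q _+A_ 0A α using (G; e) renaming (_·_ to _⋆_)
    open Units setup using (Γ; _·_; 1Γ)

    from-extension : Sequenceable Γ _·_ 1Γ → Sequenceable G _⋆_ e
    from-extension = transport {_·_ = _·_} {_⋆_ = _⋆_} regroup regroup-· refl
      where
      regroup : Γ ↔ G
      regroup = mk↔ₛ′ (λ ((u , c) , n) → u , join n c) (λ (u , (f , c , b)) → (u , c) , f , b) (λ _ → refl) (λ _ → refl)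
      regroup-· : ∀ x y → Inverse.to regroup (x · y) ≡ Inverse.to regroup x ⋆ Inverse.to regroup y
      regroup-· ((u , c) , n) ((u′ , c′) , n′) = cong (Zmod._+ₙ_ q u u′ ,_)
        (trans (cong (λ d → join (iter (toℕ u′) a n ⊕ n′) (Zmod._+ₙ_ m d c′)) (sym (act-κ (toℕ u′) c)))
          (cong (_+A join n′ c′) (sym (iter-α (toℕ u′) n c))))

    module Sequencing = Cuts setup isV proj₁ (λ _ _ → refl) p p-prime 5≤p (↔-id _) kernel kernel-sound kernel-complete
      v v-torsion independent κ′ p≡ (proj₁ ν-half) (λ n → trans (cong (N._• n) (sym (proj₂ ν-half))) (N-exponent n))

    from-rstar : RStar q m act → Sequenceable G _⋆_ e
    from-rstar R = from-extension (Sequencing.rstar R)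

iter-identity : ∀ {X : Set} {f : X → X} → (∀ x → f x ≡ x) → ∀ k x → iter k f x ≡ x
iter-identity {f = f} eq zero    x = refl
iter-identity {f = f} eq (suc k) x = trans (cong f (iter-identity eq k x)) (eq x)

module Claims (p : ℕ) .{{_ : NonZero p}} (p-prime : Prime p) (5≤p : 5 ≤ p) (κ′ : ℕ) (p≡ : suc (suc κ′ + suc κ′) ≡ p)
  (B : FinAbGroup) (2∤B : ¬ (2 ∣ FinAbGroup.order B)) (3∤B : ¬ (3 ∣ FinAbGroup.order B)) (p∤B : ¬ (p ∣ FinAbGroup.order B)) where

  private
    coprime₃ : Coprime (p * p * FinAbGroup.order B) 3
    coprime₃ = ∤⇒coprime 3-prime (∤-p²n 3-prime p-prime (ℕ.>⇒≢ (ℕ.≤-trans (s≤s (s≤s (s≤s (s≤s z≤n)))) 5≤p)) 3∤B)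

    coprime₉ : Coprime (p * p * FinAbGroup.order B) 9
    coprime₉ = coprime-square coprime₃

  claim₃ : ∀ q .{{_ : NonZero q}} → Prime q → ¬ (2 ∣ q) → ¬ (p ∣ q) → Claim p q 3 B
  claim₃ q q-prime 2∤q p∤q α (α-+ , _) (period , _) (restrict-period , _) not-diagonalisable with q ℕ.≟ 3
  ... | yes refl = D.from-extension act act-κ (D.Sequencing.three-three act act-κ (ThreeThree.sequenceable (D.setup act act-κ)))
    where
    module D = Decomposition p 3 3 B p-prime 5≤p κ′ p≡ 1 refl p∤q 2∤B 3∤B p∤B coprime₃ α α-+ period restrict-period not-diagonalisable
    act = ThreeThree.trivial
    act-κ : ∀ k c → iter k D.κ c ≡ c
    act-κ = iter-identity (trivial-on-3 D.κ D.κ-+ 1 D.κ-period)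
  ... | no q≢3 with ρ , refl ← odd-half 2∤q = D.from-rstar _ (iter-identity (trivial-on-3 D.κ D.κ-+ ρ D.κ-period))
      -- The quotient has order 3q, so k = q and `κ` is `ρ`.
      (family q 3 (∤⇒coprime 3-prime (prime-≢⇒∤ 3-prime q-prime q≢3)) ρ (half≥2 q-prime q≢3 refl) (Prime⇒1< q-prime) ∣-refl (ℕ.*-comm q 3))
    where
    module D = Decomposition p q 3 B p-prime 5≤p κ′ p≡ ρ refl p∤q 2∤B 3∤B p∤B coprime₃ α α-+ period restrict-period not-diagonalisable

  claim₉ : ∀ q .{{_ : NonZero q}} → Prime q → ¬ (2 ∣ q) → ¬ (p ∣ q) → Claim p q 9 B
  claim₉ q q-prime 2∤q p∤q α (α-+ , _) (period , _) (restrict-period , _) not-diagonalisable with q ℕ.≟ 3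
  ... | yes refl = by-multiplier (AutomorphismOf9.order-three D.κ D.κ-+ D.κ-period)
    where
    module D = Decomposition p 3 9 B p-prime 5≤p κ′ p≡ 1 refl p∤q 2∤B 3∤B p∤B coprime₉ α α-+ period restrict-period not-diagonalisable
    by-multiplier : (∃ λ r → (r ≡ 1 ⊎ r ≡ 4 ⊎ r ≡ 7) × (∀ c → D.κ c ≡ multiply 9 r c)) →
      Sequenceable _ (Semidirect._·_ 3 (Ambient._+A_ p 9 B) (Ambient.0A p 9 B) α) (Semidirect.e 3 (Ambient._+A_ p 9 B) (Ambient.0A p 9 B) α)
    by-multiplier (_ , inj₁ refl , eq)        = D.from-rstar (TwentySeven.multiplied 1) (iter-cong eq) TwentySeven.rstar₁
    by-multiplier (_ , inj₂ (inj₁ refl) , eq) = D.from-rstar (TwentySeven.multiplied 4) (iter-cong eq) TwentySeven.rstar₄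
    by-multiplier (_ , inj₂ (inj₂ refl) , eq) = D.from-rstar (TwentySeven.multiplied 7) (iter-cong eq) TwentySeven.rstar₇
  ... | no q≢3 with ρ , refl ← odd-half 2∤q = D.from-rstar _ (iter-identity κ-identity)
      -- The quotient has order 9q, so k = 3q = 2`κ` + 1 with `κ` = 3`ρ` + 1.
      (family q 9 (coprime-square (∤⇒coprime 3-prime 3∤q)) (suc (ρ + ρ + ρ)) (s≤s (ℕ.≤-trans (ℕ.<⇒≤ 2≤ρ) (ℕ.m≤n+m ρ (ρ + ρ))))
        (Prime⇒1< q-prime) (divides 3 (3q ρ)) (trans (9q ρ) (cong (3 *_) (sym (3q ρ)))))
    where
    module D = Decomposition p q 9 B p-prime 5≤p κ′ p≡ ρ refl p∤q 2∤B 3∤B p∤B coprime₉ α α-+ period restrict-period not-diagonalisable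
    3∤q : ¬ (3 ∣ q)
    3∤q = prime-≢⇒∤ 3-prime q-prime q≢3
    2≤ρ : 2 ≤ ρ
    2≤ρ = half≥2 q-prime q≢3 refl
    κ-identity : ∀ c → D.κ c ≡ c
    κ-identity = AutomorphismOf9.coprime-order D.κ D.κ-+ (proj₁ (±1-mod-6 2∤q 3∤q)) (proj₂ (±1-mod-6 2∤q 3∤q)) D.κ-period
    3q : ∀ ρ → suc (suc (ρ + ρ + ρ) + suc (ρ + ρ + ρ)) ≡ 3 * suc (ρ + ρ)
    3q = solve-∀
    9q : ∀ ρ → suc (ρ + ρ) * 9 ≡ 3 * (3 * suc (ρ + ρ))
    9q = solve-∀

theorem3p9 : (p q : ℕ) .{{_ : NonZero p}} .{{_ : NonZero q}} →
  Prime p → Prime q → ¬ (2 ∣ p) → ¬ (2 ∣ q) → p ≢ 3 → q ∣ (p * p ∸ 1) →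
  (B : FinAbGroup) → ¬ (2 ∣ FinAbGroup.order B) → ¬ (3 ∣ FinAbGroup.order B) →
  ¬ (p ∣ FinAbGroup.order B) →
  Claim p q 3 B × Claim p q 9 B
theorem3p9 p q p-prime q-prime 2∤p 2∤q p≢3 q∣p²-1 B 2∤B 3∤B p∤B = by-half (odd-half 2∤p)
  where
  p∤q : ¬ (p ∣ q)
  -- If p divided q, it would divide both p² - 1 and p², hence 1.
  p∤q p∣q = contradiction (∣⇒≤ (∣m+n∣m⇒∣n (subst (p ∣_) (sym (ℕ.m∸n+n≡m (ℕ.*-mono-≤ 1≤p 1≤p))) (m∣m*n p)) (∣-trans p∣q q∣p²-1)))
    (ℕ.<⇒≱ (Prime⇒1< p-prime))
    where
    1≤p : 1 ≤ p
    1≤p = ℕ.<⇒≤ (Prime⇒1< p-prime)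
  by-half : (∃ λ i → p ≡ suc (i + i)) → Claim p q 3 B × Claim p q 9 B
  by-half (zero , p≡)   = contradiction (half≥2 {i = zero} p-prime p≢3 p≡) λ ()
  by-half (suc κ′ , p≡) = C.claim₃ q q-prime 2∤q p∤q , C.claim₉ q q-prime 2∤q p∤q
    where
    module C = Claims p p-prime (half≥2⇒5≤ {i = suc κ′} (half≥2 p-prime p≢3 p≡) p≡) κ′ (sym p≡) B 2∤B 3∤B p∤B
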